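{- There is a constant such that, for all sufficiently large $n$ and all $k \geq 1600 \ln n$ (for which $\mathbf{NGC}_{n,k}$ is well defined), the robust randomized one-way communication complexity of $\mathbf{NGC}_{n,k}$ with error $1/3$ is $\Omega(n)$ bits.
   Context: $\mathbf{NGC}_{n,k}$ (Noisy Gap Cycle Counting) is the following problem. The input is an $n$-vertex graph $G=(V,E)$ of one of two types: (i) $G$ contains $n/(4k)$ vertex-disjoint cycles of length $2k$, or (ii) $G$ contains $n/(2k)$ vertex-disjoint cycles of length $k$. In both cases $G$ additionally contains $n/(2k)$ vertex-disjoint paths of length $k-1$. The goal is to decide which type $G$ is. Robust one-way communication model: an input graph $G$ is chosen adversarially from the allowed class. Each edge of $G$ is then independently and uniformly at random assigned either to Alice's edge set $E_A$ or to Bob's edge set $E_B$. The players share public random bits $R$. Alice sends a single message depending on $(E_A,R)$ to Bob, and Bob outputs an answer depending on the message, $E_B$ and $R$. A protocol has error $\delta$ if for every allowed $G$ it outputs the correct answer with probability at least $1-\delta$, where the probability is over the random edge partition and over $R$. Its cost is the worst-case length of Alice's message. The robust randomized one-way communication complexity with error $\delta$ is the minimum cost of a protocol with error $\delta$. -}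

module Defs where

open import Data.Bool using (Bool; true; false; _∧_; _∨_; not; if_then_else_)
open import Data.Nat using (ℕ; zero; suc; _+_; _*_; _∸_; _^_; _≤_; _≡ᵇ_; _<ᵇ_; pred; _/_; _%_; _!)
open import Data.Fin using (Fin; toℕ)
open import Data.Fin.Properties using () renaming (_≟_ to _≟F_)
open import Data.List using (List; []; _∷_; length; concatMap; map; allFin; filterᵇ)
open import Data.Vec using (Vec; []; _∷_)
open import Data.Product using (Σ; ∃; _×_; _,_; proj₁; proj₂)
open import Relation.Nullary.Decidable using (⌊_⌋)
open import Relation.Binary.PropositionalEquality using (_≡_)
open import Function.Definitions using (Bijective)

Graph : ℕ → Set
Graph n = Fin n → Fin n → Bool

-- Canonical NGC graphs on vertices 0..n-1 (as naturals).
-- Vertices [0, n/2) : cycles of length L (L = 2k for type (i), L = k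
-- for type (ii)), consecutive blocks of L vertices.
-- Vertices [n/2, n) : paths with k vertices (length k-1), consecutive
-- blocks of k vertices.
-- Division/modulus by L are taken for L ≥ 1 (suc (pred L) = L).

divP : ℕ → ℕ → ℕ
divP a L = a / suc (pred L)

modP : ℕ → ℕ → ℕ
modP a L = a % suc (pred L)

succMod : ℕ → ℕ → ℕ → Bool
succMod L x y = (suc x ≡ᵇ y) ∨ ((suc x ≡ᵇ L) ∧ (y ≡ᵇ 0))

cycAdj : ℕ → ℕ → ℕ → Bool
cycAdj L a b = (divP a L ≡ᵇ divP b L)
             ∧ (succMod L (modP a L) (modP b L) ∨ succMod L (modP b L) (modP a L))

pathAdj : ℕ → ℕ → ℕ → Bool
pathAdj L a b = (divP a L ≡ᵇ divP b L)
              ∧ ((suc (modP a L) ≡ᵇ modP b L) ∨ (suc (modP b L) ≡ᵇ modP a L))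

-- t = true : type (i)  (n/(4k) cycles of length 2k)
-- t = false: type (ii) (n/(2k) cycles of length k)
-- plus, in both cases, n/(2k) paths of length k-1.
canon : Bool → ℕ → ℕ → ℕ → ℕ → Bool
canon t n k a b =
  if (a <ᵇ h) ∧ (b <ᵇ h) then cycAdj (if t then 2 * k else k) a b
  else (if not (a <ᵇ h) ∧ not (b <ᵇ h) then pathAdj k (a ∸ h) (b ∸ h) else false)
  where h = n / 2

IsNGC : Bool → (n k : ℕ) → Graph n → Set
IsNGC t n k G = Σ (Fin n → Fin n) λ π →
  Bijective _≡_ _≡_ π × (∀ u v → G (π u) (π v) ≡ canon t n k (toℕ u) (toℕ v))

allPairs : (n : ℕ) → List (Fin n × Fin n)
allPairs n = concatMap (λ u → map (λ v → u , v) (allFin n)) (allFin n)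

edgesOf : {n : ℕ} → Graph n → List (Fin n × Fin n)
edgesOf {n} G = filterᵇ (λ p → (toℕ (proj₁ p) <ᵇ toℕ (proj₂ p)) ∧ G (proj₁ p) (proj₂ p)) (allPairs n)

-- Given a partition σ of the edge list (true = Alice, false = Bob),
-- the adjacency function of side b's edge set.
sideAdj : {n : ℕ} → Bool → (es : List (Fin n × Fin n)) → Vec Bool (length es) → Graph n
sideAdj b [] [] u v = false
sideAdj b ((x , y) ∷ es) (s ∷ ss) u v =
  ((if b then s else not s) ∧ ((⌊ x ≟F u ⌋ ∧ ⌊ y ≟F v ⌋) ∨ (⌊ x ≟F v ⌋ ∧ ⌊ y ≟F u ⌋)))
  ∨ sideAdj b es ss u v

allVec : (l : ℕ) → List (Vec Bool l)
allVec zero = [] ∷ []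
allVec (suc l) = concatMap (λ v → (true ∷ v) ∷ (false ∷ v) ∷ []) (allVec l)

-- One-way protocols with r public random bits and worst-case message
-- length at most c.  Bob's output true means "type (i)".

record Protocol (n r c : ℕ) : Set where
  field
    alice  : Graph n → Vec Bool r → List Bool
    msgLen : ∀ EA R → length (alice EA R) ≤ c
    bob    : List Bool → Graph n → Vec Bool r → Bool

open Protocol public

outcome : {n r c : ℕ} → Protocol n r c → (G : Graph n) →
          Vec Bool (length (edgesOf G)) → Vec Bool r → Bool
outcome P G σ R =
  bob P (alice P (sideAdj true (edgesOf G) σ) R) (sideAdj false (edgesOf G) σ) R

boolEq : Bool → Bool → Bool
boolEq true b = b
boolEq false b = not b

countL : {A : Set} → (A → Bool) → List A → ℕ
countL p [] = 0
countL p (x ∷ xs) = (if p x then 1 else 0) + countL p xs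

sumL : {A : Set} → (A → ℕ) → List A → ℕ
sumL f [] = 0
sumL f (x ∷ xs) = f x + sumL f xs

successes : {n r c : ℕ} → Protocol n r c → Bool → Graph n → ℕ
successes {r = r} P t G =
  sumL (λ σ → countL (λ R → boolEq t (outcome P G σ R)) (allVec r))
       (allVec (length (edgesOf G)))

-- P has error at most 1/3 on NGC_{n,k}: for every allowed G of type t,
-- Pr_{σ,R}[Bob outputs t] ≥ 2/3 (uniform over 2^|E| partitions and 2^r seeds).
ErrorAtMostThird : {n r c : ℕ} → (k : ℕ) → Protocol n r c → Set
ErrorAtMostThird {n} {r} k P = ∀ t (G : Graph n) → IsNGC t n k G →
  2 * (2 ^ length (edgesOf G) * 2 ^ r) ≤ 3 * successes P t G

-- k ≥ 1600 ln n  ⟺  e^k ≥ n^1600  ⟺  ∃ m. Σ_{j≤m} k^j/j! ≥ n^1600.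
-- expNum k m = m! · Σ_{j≤m} k^j / j!  (a natural number).
expNum : ℕ → ℕ → ℕ
expNum k zero = 1
expNum k (suc m) = suc m * expNum k m + k ^ suc m

KgeLn : ℕ → ℕ → Set
KgeLn k n = ∃ λ m → n ^ 1600 * m ! ≤ expNum k m

{-# OPTIONS --safe #-}
module Submission where

-- Pair up the strands: vertex (2p + s)k + i is level i of strand s ∈ {0,1} of pair p, and the graph is a
-- double cover of M cycles and M paths with k levels.  Crossing the two strands of a cycle pair an even or
-- odd number of times gives two k-cycles or one 2k-cycle, whereas crossings are irrelevant on path pairs.
-- A block of three consecutive levels is good if its middle edges all go to Alice and the edges around them
-- all go to Bob; then only Alice sees whether the block is crossed, and only Bob sees where it lies.
-- A Chernoff bound gives Ω(k) good blocks on every pair.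
--
-- Changing the parity of the cycle pairs one after another (hybrids), Bob has to guess the parity of
-- Alice's bits along a random word, obtained by swapping ℓ ≈ log n good blocks of the cycle pair with
-- random good blocks of the path pairs.  For a fixed reply strategy of Bob, his bias as a function of
-- Alice's bits is a sum of distinct characters, and its r-th moment is at most the number of words of
-- length rℓ in which every letter occurs an even number of times.  A union bound over Alice's messages
-- with r ≈ c/ℓ shows that the total bias over all hybrids is small unless c = Ω(n).

open import Defs
open import Data.Bool using (Bool; true; false; _∧_; _∨_; not; if_then_else_; T?; _xor_)
open import Data.Bool.Properties using (T-≡; T-∧; ∧-assoc; ∧-identityʳ; ∧-zeroʳ; not-involutive; xor-assoc; xor-comm; xor-identityʳ) renaming (_≟_ to _≟B_)
open import Data.Empty using (⊥; ⊥-elim)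
open import Data.Fin using (Fin; zero; suc; toℕ; fromℕ<; cast; combine; remQuot; _↑ˡ_; _↑ʳ_)
open import Data.Fin.Patterns using (0F; 1F; 2F)
open import Data.Fin.Permutation.Components using (transpose; transpose-inverse)
open import Data.Fin.Properties using (all?; any?; ¬∀⟶∃¬; cast-is-id; cast-trans; combine-injective; combine-remQuot; remQuot-combine; toℕ-cast; toℕ-combine; toℕ-fromℕ<; toℕ-injective; toℕ-↑ˡ; toℕ-↑ʳ; toℕ<n; ↑ʳ-injective) renaming (_≟_ to _≟F_)
open import Data.Integer using (ℤ; -[1+_]; ∣_∣; 0ℤ; 1ℤ; -1ℤ) renaming (+_ to ⁺_; -_ to ⁻_; _+_ to _⊕_; _-_ to _⊖_; _*_ to _⊛_; _^_ to _⊛^_)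
import Data.Integer.Properties as ZP
import Data.Integer.Tactic.RingSolver as ZR
open import Data.List using (List; []; _∷_; _++_; map; length; allFin; tabulate; take; drop; filter; filterᵇ; concatMap; cartesianProduct; cartesianProductWith)
open import Data.List.Membership.DecPropositional using () renaming (_∈?_ to mem?)
open import Data.List.Membership.Propositional using (_∈_; _∉_)
open import Data.List.Membership.Propositional.Properties using (∈-∃++; ∈-++⁻; ∈-++⁺ˡ; ∈-++⁺ʳ; ∈-map⁺; ∈-allFin; ∈-filter⁻; ∈-filter⁺; ∈-cartesianProduct⁺; ∈-cartesianProductWith⁺; ∈-cartesianProductWith⁻)
open import Data.List.Properties using (length-map; length-take; map-tabulate; take++drop≡id; ∷-injective)
import Data.List.Properties as LP
open import Data.List.Relation.Unary.All as All using (All; []; _∷_)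
open import Data.List.Relation.Unary.AllPairs using ([]; _∷_)
open import Data.List.Relation.Unary.Any using (here; there)
open import Data.List.Relation.Unary.Unique.Propositional using (Unique)
import Data.List.Relation.Unary.Unique.Propositional.Properties as Uniq
open import Data.Nat using (ℕ; zero; suc; _+_; _*_; _∸_; _^_; _≤_; _<_; _<ᵇ_; _≡ᵇ_; _≤ᵇ_; _/_; _%_; _!; z≤n; s≤s; NonZero; >-nonZero)
open import Data.Nat.Divisibility using (_∣_; divides; n∣m*n)
open import Data.Nat.DivMod
open import Data.Nat.Properties
open import Data.Nat.Tactic.RingSolver using (solve-∀)
open import Data.Product using (Σ; ∃; _×_; _,_; proj₁; proj₂)
open import Data.Sum using (_⊎_; inj₁; inj₂)
open import Data.Unit using (tt)
open import Data.Vec using (Vec; []; _∷_)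
import Data.Vec as V
import Data.Vec.Properties as VP
open import Function using (_∘_; id; Equivalence)
open import Relation.Binary.PropositionalEquality using (_≡_; _≢_; refl; sym; trans; cong; cong₂; subst; subst₂; module ≡-Reasoning)
open import Relation.Nullary using (¬_; Dec; yes; no; does; _×-dec_; _⊎-dec_)
open import Relation.Nullary.Decidable using (⌊_⌋)

-- Each edge is coloured at the position of its source, and colours belong to positions. The
-- colouring can therefore be fixed before the labels and the crossings are drawn, and swapping
-- blocks is a bijection of the remaining randomness.
--
-- The obstacle is the number `M` of hybrids: Bob's bias must be below `1/M` at each of them. Every
-- hidden letter gains a factor 2, whence a word of `ℓ` letters with `48 * M ≤ 2 ^ ℓ`. The bound on
-- `k` enters twice: each pair must offer `ℓ` good blocks, and all `2M` pairs must do so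
-- simultaneously. Path pairs supply the letters because they can be twisted freely; there are `w` =
-- Ω(n) good blocks on them.
--
-- A moment of total word length `L` slightly above `c` turns the union over the messages into a
-- factor 2 per letter. Even words number at most about `(L * Q) ^ (L / 2)`, so everything fits
-- below `v ^ L`, with `v = w / 2`, once `4 * (L * Q) ≤ v * v`. Since `Q` and `v` are both linear in
-- `n`, this still allows `L`, and hence `c`, to be a small constant times `n`.

private
  variable
    𝔸 𝔹 ℂ : Set

-- Finite sums of natural numbers

sum-cong : {f g : 𝔸 → ℕ} → (∀ x → f x ≡ g x) → ∀ xs → sumL f xs ≡ sumL g xs
sum-cong e [] = refl
sum-cong e (x ∷ xs) = cong₂ _+_ (e x) (sum-cong e xs)

sum-cong-∈ : {f g : 𝔸 → ℕ} → ∀ xs → (∀ x → x ∈ xs → f x ≡ g x) → sumL f xs ≡ sumL g xs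
sum-cong-∈ [] e = refl
sum-cong-∈ (x ∷ xs) e = cong₂ _+_ (e x (here refl)) (sum-cong-∈ xs (λ y y∈ → e y (there y∈)))

sum-mono-∈ : {f g : 𝔸 → ℕ} → ∀ xs → (∀ x → x ∈ xs → f x ≤ g x) → sumL f xs ≤ sumL g xs
sum-mono-∈ [] e = z≤n
sum-mono-∈ (x ∷ xs) e = +-mono-≤ (e x (here refl)) (sum-mono-∈ xs (λ y y∈ → e y (there y∈)))

sum-mono : {f g : 𝔸 → ℕ} → (∀ x → f x ≤ g x) → ∀ xs → sumL f xs ≤ sumL g xs
sum-mono e xs = sum-mono-∈ xs (λ x _ → e x)

interchange : ∀ a b c d → (a + b) + (c + d) ≡ (a + c) + (b + d)
interchange = solve-∀

sum-+ : (f g : 𝔸 → ℕ) → ∀ xs → sumL (λ x → f x + g x) xs ≡ sumL f xs + sumL g xs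
sum-+ f g [] = refl
sum-+ f g (x ∷ xs) = trans (cong (f x + g x +_) (sum-+ f g xs)) (interchange (f x) (g x) _ _)

sum-*ˡ : (k : ℕ) (f : 𝔸 → ℕ) → ∀ xs → sumL (λ x → k * f x) xs ≡ k * sumL f xs
sum-*ˡ k f [] = sym (*-zeroʳ k)
sum-*ˡ k f (x ∷ xs) = trans (cong (k * f x +_) (sum-*ˡ k f xs)) (sym (*-distribˡ-+ k (f x) _))

sum-const : (k : ℕ) (xs : List 𝔸) → sumL (λ _ → k) xs ≡ length xs * k
sum-const k [] = refl
sum-const k (x ∷ xs) = cong (k +_) (sum-const k xs)

sum-0 : (xs : List 𝔸) → sumL (λ _ → 0) xs ≡ 0
sum-0 [] = refl
sum-0 (x ∷ xs) = sum-0 xs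

sum-swap : (f : 𝔸 → 𝔹 → ℕ) (xs : List 𝔸) (ys : List 𝔹) →
  sumL (λ x → sumL (f x) ys) xs ≡ sumL (λ y → sumL (λ x → f x y) xs) ys
sum-swap f [] ys = sym (sum-0 ys)
sum-swap f (x ∷ xs) ys = trans (cong (sumL (f x) ys +_) (sum-swap f xs ys)) (sym (sum-+ (f x) _ ys))

sum-++ : (f : 𝔸 → ℕ) → ∀ xs ys → sumL f (xs ++ ys) ≡ sumL f xs + sumL f ys
sum-++ f [] ys = refl
sum-++ f (x ∷ xs) ys = trans (cong (f x +_) (sum-++ f xs ys)) (sym (+-assoc (f x) _ _))

sum-map : (f : 𝔹 → ℕ) (h : 𝔸 → 𝔹) → ∀ xs → sumL f (map h xs) ≡ sumL (f ∘ h) xs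
sum-map f h [] = refl
sum-map f h (x ∷ xs) = cong (f (h x) +_) (sum-map f h xs)

sum-product : (F : ℂ → ℕ) (h : 𝔸 → 𝔹 → ℂ) → ∀ xs ys →
  sumL F (cartesianProductWith h xs ys) ≡ sumL (λ x → sumL (λ y → F (h x y)) ys) xs
sum-product F h [] ys = refl
sum-product F h (x ∷ xs) ys =
  trans (sum-++ F (map (h x) ys) _) (cong₂ _+_ (sum-map F (h x) ys) (sum-product F h xs ys))

term≤sum : (f : 𝔸 → ℕ) → ∀ {x} xs → x ∈ xs → f x ≤ sumL f xs
term≤sum f (x ∷ xs) (here refl) = m≤m+n (f x) _
term≤sum f (y ∷ xs) (there x∈) = m≤n⇒m≤o+n (f y) (term≤sum f xs x∈)

sum-⊆ : (f : 𝔸 → ℕ) → ∀ {xs} ys → Unique xs → (∀ x → x ∈ xs → x ∈ ys) → sumL f xs ≤ sumL f ys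
sum-⊆ f {[]} ys u ⊆ = z≤n
sum-⊆ f {x ∷ xs} ys (x# ∷ u) ⊆ with ∈-∃++ (⊆ x (here refl))
... | ys₁ , ys₂ , refl = begin
    f x + sumL f xs                      ≤⟨ +-monoʳ-≤ (f x) (sum-⊆ f (ys₁ ++ ys₂) u rest) ⟩
    f x + sumL f (ys₁ ++ ys₂)            ≡⟨ cong (f x +_) (sum-++ f ys₁ ys₂) ⟩
    f x + (sumL f ys₁ + sumL f ys₂)      ≡⟨ +-assoc (f x) _ _ ⟨
    (f x + sumL f ys₁) + sumL f ys₂      ≡⟨ cong (_+ sumL f ys₂) (+-comm (f x) _) ⟩
    (sumL f ys₁ + f x) + sumL f ys₂      ≡⟨ +-assoc (sumL f ys₁) _ _ ⟩
    sumL f ys₁ + sumL f (x ∷ ys₂)        ≡⟨ sum-++ f ys₁ (x ∷ ys₂) ⟨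
    sumL f (ys₁ ++ x ∷ ys₂)              ∎
  where
  open ≤-Reasoning
  rest : ∀ y → y ∈ xs → y ∈ ys₁ ++ ys₂
  rest y y∈ with ∈-++⁻ ys₁ (⊆ y (there y∈))
  ... | inj₁ i = ∈-++⁺ˡ i
  ... | inj₂ (here refl) = ⊥-elim (All.lookup x# y∈ refl)
  ... | inj₂ (there i) = ∈-++⁺ʳ ys₁ i

map-∈⁻ : {h : 𝔸 → 𝔹} → ∀ {y} xs → y ∈ map h xs → ∃ λ x → x ∈ xs × y ≡ h x
map-∈⁻ (x ∷ xs) (here e) = x , here refl , e
map-∈⁻ (x ∷ xs) (there i) with map-∈⁻ xs i
... | x' , x'∈ , e = x' , there x'∈ , e

All-map-∉ : {h : 𝔸 → 𝔹} → ∀ {y} xs → (∀ x → x ∈ xs → y ≢ h x) → All (y ≢_) (map h xs)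
All-map-∉ [] ne = []
All-map-∉ (x ∷ xs) ne = ne x (here refl) ∷ All-map-∉ xs (λ z z∈ → ne z (there z∈))

Unique-map-∈ : {h : 𝔸 → 𝔹} → ∀ {xs} → Unique xs →
  (∀ x y → x ∈ xs → y ∈ xs → h x ≡ h y → x ≡ y) → Unique (map h xs)
Unique-map-∈ [] inj = []
Unique-map-∈ {xs = x ∷ xs} (x# ∷ u) inj =
  All-map-∉ xs (λ z z∈ e → All.lookup x# z∈ (inj x z (here refl) (there z∈) e))
  ∷ Unique-map-∈ u (λ a b a∈ b∈ → inj a b (there a∈) (there b∈))

sum-inj : (F : 𝔹 → ℕ) (h : 𝔸 → 𝔹) → ∀ {xs} ys → Unique xs →
  (∀ x y → x ∈ xs → y ∈ xs → h x ≡ h y → x ≡ y) → (∀ x → x ∈ xs → h x ∈ ys) →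
  sumL (F ∘ h) xs ≤ sumL F ys
sum-inj F h {xs} ys u inj into = subst (_≤ sumL F ys) (sum-map F h xs)
  (sum-⊆ F ys (Unique-map-∈ u inj) λ y y∈ → helper y (map-∈⁻ xs y∈))
  where
  helper : ∀ y → (∃ λ x → x ∈ xs × y ≡ h x) → y ∈ ys
  helper y (x , x∈ , refl) = into x x∈

-- Terms are nonnegative, so an injection of `xs` into itself gives an inequality between sums.
-- Using `f` and then `g` gives both directions without constructing a permutation of lists.
sum-bij : (F : 𝔸 → ℕ) (f g : 𝔸 → 𝔸) → ∀ {xs} → Unique xs →
  (∀ x → g (f x) ≡ x) → (∀ x → f (g x) ≡ x) →
  (∀ x → x ∈ xs → f x ∈ xs) → (∀ x → x ∈ xs → g x ∈ xs) →
  sumL (F ∘ f) xs ≡ sumL F xs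
sum-bij F f g {xs} u gf fg f∈ g∈ = ≤-antisym
  (sum-inj F f xs u (λ x y _ _ e → trans (sym (gf x)) (trans (cong g e) (gf y))) f∈)
  (subst (_≤ sumL (F ∘ f) xs) (sum-cong (λ x → cong F (fg x)) xs)
    (sum-inj (F ∘ f) g xs u (λ x y _ _ e → trans (sym (fg x)) (trans (cong f e) (fg y))) g∈))

-- Words and vectors over a finite alphabet

words : List 𝔸 → ℕ → List (List 𝔸)
words xs zero = [] ∷ []
words xs (suc l) = cartesianProductWith _∷_ xs (words xs l)

vecs : List 𝔸 → (l : ℕ) → List (Vec 𝔸 l)
vecs xs zero = [] ∷ []
vecs xs (suc l) = cartesianProductWith _∷_ xs (vecs xs l)

length-product : (h : 𝔸 → 𝔹 → ℂ) → ∀ xs ys → length (cartesianProductWith h xs ys) ≡ length xs * length ys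
length-product h [] ys = refl
length-product h (x ∷ xs) ys = trans (LP.length-++ (map (h x) ys))
  (cong₂ _+_ (length-map (h x) ys) (length-product h xs ys))

length-words : (xs : List 𝔸) → ∀ l → length (words xs l) ≡ length xs ^ l
length-words xs zero = refl
length-words xs (suc l) = trans (length-product _∷_ xs (words xs l)) (cong (length xs *_) (length-words xs l))

length-vecs : (xs : List 𝔸) → ∀ l → length (vecs xs l) ≡ length xs ^ l
length-vecs xs zero = refl
length-vecs xs (suc l) = trans (length-product _∷_ xs (vecs xs l)) (cong (length xs *_) (length-vecs xs l))

Unique-words : {xs : List 𝔸} → Unique xs → ∀ l → Unique (words xs l)
Unique-words u zero = [] ∷ []
Unique-words u (suc l) = Uniq.cartesianProductWith⁺ _∷_ (λ { refl → refl , refl }) u (Unique-words u l)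

Unique-vecs : {xs : List 𝔸} → Unique xs → ∀ l → Unique (vecs xs l)
Unique-vecs u zero = [] ∷ []
Unique-vecs u (suc l) = Uniq.cartesianProductWith⁺ _∷_ (λ { refl → refl , refl }) u (Unique-vecs u l)

∈-vecs : {xs : List 𝔸} → (∀ x → x ∈ xs) → ∀ {l} (v : Vec 𝔸 l) → v ∈ vecs xs l
∈-vecs all [] = here refl
∈-vecs all (x ∷ v) = ∈-cartesianProductWith⁺ _∷_ (all x) (∈-vecs all v)

∈-words : {xs : List 𝔸} → (∀ x → x ∈ xs) → ∀ w → w ∈ words xs (length w)
∈-words all [] = here refl
∈-words all (x ∷ w) = ∈-cartesianProductWith⁺ _∷_ (all x) (∈-words all w)

length-∈-words : (xs : List 𝔸) → ∀ l {w} → w ∈ words xs l → length w ≡ l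
length-∈-words xs zero (here refl) = refl
length-∈-words xs (suc l) w∈ with ∈-cartesianProductWith⁻ _∷_ xs (words xs l) w∈
... | _ , _ , _ , w'∈ , refl = cong suc (length-∈-words xs l w'∈)

∈-∈-words : (xs : List 𝔸) → ∀ l {w} → w ∈ words xs l → All (_∈ xs) w
∈-∈-words xs zero (here refl) = []
∈-∈-words xs (suc l) w∈ with ∈-cartesianProductWith⁻ _∷_ xs (words xs l) w∈
... | _ , _ , x∈ , w'∈ , refl = x∈ ∷ ∈-∈-words xs l w'∈

sum-words-++ : (F : List 𝔸 → ℕ) (xs : List 𝔸) → ∀ a b →
  sumL F (words xs (a + b)) ≡ sumL (λ u → sumL (λ w → F (u ++ w)) (words xs b)) (words xs a)
sum-words-++ F xs zero b = sym (+-identityʳ _)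
sum-words-++ F xs (suc a) b = begin
  sumL F (words xs (suc a + b))
    ≡⟨ sum-product F _∷_ xs (words xs (a + b)) ⟩
  sumL (λ x → sumL (λ w → F (x ∷ w)) (words xs (a + b))) xs
    ≡⟨ sum-cong (λ x → sum-words-++ (λ w → F (x ∷ w)) xs a b) xs ⟩
  sumL (λ x → sumL (λ u → sumL (λ w → F (x ∷ u ++ w)) (words xs b)) (words xs a)) xs
    ≡⟨ sum-product (λ u → sumL (λ w → F (u ++ w)) (words xs b)) _∷_ xs (words xs a) ⟨
  sumL (λ u → sumL (λ w → F (u ++ w)) (words xs b)) (words xs (suc a)) ∎
  where open ≡-Reasoning

bools : List Bool
bools = true ∷ false ∷ []

∈-bools : ∀ b → b ∈ bools
∈-bools true = here refl
∈-bools false = there (here refl)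

Unique-bools : Unique bools
Unique-bools = ((λ ()) ∷ []) ∷ [] ∷ []

bvecs : (l : ℕ) → List (Vec Bool l)
bvecs = vecs bools

Unique-bvecs : ∀ l → Unique (bvecs l)
Unique-bvecs = Unique-vecs Unique-bools

∈-bvecs : ∀ {l} (v : Vec Bool l) → v ∈ bvecs l
∈-bvecs = ∈-vecs ∈-bools

lookup-ext : ∀ {l} (v w : Vec 𝔸 l) → (∀ i → V.lookup v i ≡ V.lookup w i) → v ≡ w
lookup-ext v w e = trans (sym (VP.tabulate∘lookup v)) (trans (VP.tabulate-cong e) (VP.tabulate∘lookup w))

flip : ∀ {l} → Fin l → Vec Bool l → Vec Bool l
flip i v = V.updateAt v i not

flip-involutive : ∀ {l} (i : Fin l) v → flip i (flip i v) ≡ v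
flip-involutive zero (true ∷ v) = refl
flip-involutive zero (false ∷ v) = refl
flip-involutive (suc i) (x ∷ v) = cong (x ∷_) (flip-involutive i v)

sum-flip : ∀ {l} (F : Vec Bool l → ℕ) i → sumL (F ∘ flip i) (bvecs l) ≡ sumL F (bvecs l)
sum-flip {l} F i = sum-bij F (flip i) (flip i) (Unique-bvecs l) (flip-involutive i) (flip-involutive i)
  (λ v _ → ∈-bvecs (flip i v)) (λ v _ → ∈-bvecs (flip i v))

-- Flipping coordinate i preserves the uniform measure and the other coordinates.
sum-marginal-step : ∀ {l} (f : List Bool → ℕ) i is → i ∉ is →
  2 * sumL (λ c → f (map (V.lookup c) (i ∷ is))) (bvecs l) ≡
  sumL (λ c → f (true ∷ map (V.lookup c) is)) (bvecs l) + sumL (λ c → f (false ∷ map (V.lookup c) is)) (bvecs l)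
sum-marginal-step {l} f i is i∉ = begin
  2 * S                                  ≡⟨ cong (S +_) (+-identityʳ S) ⟩
  S + S                                  ≡⟨ cong (S +_) (sum-flip _ i) ⟨
  S + sumL (λ c → f (map (V.lookup (flip i c)) (i ∷ is))) (bvecs l)
    ≡⟨ sum-+ _ _ (bvecs l) ⟨
  sumL (λ c → f (map (V.lookup c) (i ∷ is)) + f (map (V.lookup (flip i c)) (i ∷ is))) (bvecs l)
    ≡⟨ sum-cong pointwise (bvecs l) ⟩
  sumL (λ c → f (true ∷ map (V.lookup c) is) + f (false ∷ map (V.lookup c) is)) (bvecs l)
    ≡⟨ sum-+ _ _ (bvecs l) ⟩
  _ ∎
  where
  open ≡-Reasoning
  S = sumL (λ c → f (map (V.lookup c) (i ∷ is))) (bvecs l)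
  unchanged : ∀ c js → i ∉ js → map (V.lookup (flip i c)) js ≡ map (V.lookup c) js
  unchanged c [] _ = refl
  unchanged c (j ∷ js) i∉ = cong₂ _∷_
    (VP.lookup∘updateAt′ j i (λ e → i∉ (here (sym e))) c) (unchanged c js (i∉ ∘ there))
  pointwise : ∀ c → f (map (V.lookup c) (i ∷ is)) + f (map (V.lookup (flip i c)) (i ∷ is)) ≡
    f (true ∷ map (V.lookup c) is) + f (false ∷ map (V.lookup c) is)
  pointwise c rewrite unchanged c is i∉ | VP.lookup∘updateAt i {not} c with V.lookup c i
  ... | true = refl
  ... | false = +-comm (f (false ∷ map (V.lookup c) is)) (f (true ∷ map (V.lookup c) is))

-- Distinct coordinates of a uniform vector are independent fair bits. This serves to trade random
-- edges for random vertices, and to find the law of the six colours of each block.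
sum-marginal : ∀ {l} (f : List Bool → ℕ) is → Unique is →
  2 ^ length is * sumL (λ c → f (map (V.lookup c) is)) (bvecs l) ≡ 2 ^ l * sumL f (words bools (length is))
sum-marginal {l} f [] u = begin
  sumL (λ c → f []) (bvecs l) + 0    ≡⟨ +-identityʳ _ ⟩
  sumL (λ c → f []) (bvecs l)        ≡⟨ sum-const (f []) (bvecs l) ⟩
  length (bvecs l) * f []            ≡⟨ cong₂ _*_ (length-vecs bools l) (sym (+-identityʳ (f []))) ⟩
  2 ^ l * (f [] + 0)                 ∎
  where open ≡-Reasoning
sum-marginal {l} f (i ∷ is) (i# ∷ u) = begin
  2 * p * S                                  ≡⟨ cong (_* S) (*-comm 2 p) ⟩
  p * 2 * S                                  ≡⟨ *-assoc p 2 S ⟩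
  p * (2 * S)                                ≡⟨ cong (p *_) (sum-marginal-step f i is (λ i∈ → All.lookup i# i∈ refl)) ⟩
  p * (sumL _ (bvecs l) + sumL _ (bvecs l))  ≡⟨ *-distribˡ-+ p _ _ ⟩
  p * sumL _ (bvecs l) + p * sumL _ (bvecs l)
    ≡⟨ cong₂ _+_ (sum-marginal (f ∘ (true ∷_)) is u) (sum-marginal (f ∘ (false ∷_)) is u) ⟩
  2 ^ l * sumL _ (words bools (length is)) + 2 ^ l * sumL _ (words bools (length is))
    ≡⟨ *-distribˡ-+ (2 ^ l) _ _ ⟨
  2 ^ l * (sumL (f ∘ (true ∷_)) (words bools (length is)) + sumL (f ∘ (false ∷_)) (words bools (length is)))
    ≡⟨ cong (λ z → 2 ^ l * (sumL (f ∘ (true ∷_)) (words bools (length is)) + z)) (+-identityʳ _) ⟨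
  2 ^ l * (sumL (f ∘ (true ∷_)) (words bools (length is)) + (sumL (f ∘ (false ∷_)) (words bools (length is)) + 0))
    ≡⟨ cong (2 ^ l *_) (sum-product f _∷_ bools (words bools (length is))) ⟨
  2 ^ l * sumL f (words bools (suc (length is))) ∎
  where
  open ≡-Reasoning
  p = 2 ^ length is
  S = sumL (λ c → f (map (V.lookup c) (i ∷ is))) (bvecs l)

^-distribʳ-* : ∀ l a b → (a * b) ^ l ≡ a ^ l * b ^ l
^-distribʳ-* zero a b = refl
^-distribʳ-* (suc l) a b = trans (cong ((a * b) *_) (^-distribʳ-* l a b)) (four a b (a ^ l) (b ^ l))
  where
  four : ∀ a b c d → (a * b) * (c * d) ≡ (a * c) * (b * d)
  four = solve-∀

ind : Bool → ℕ
ind b = if b then 1 else 0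

-- Finite sums of integers

sumZ : (𝔸 → ℤ) → List 𝔸 → ℤ
sumZ f [] = 0ℤ
sumZ f (x ∷ xs) = f x ⊕ sumZ f xs

sumZ-cong : {f g : 𝔸 → ℤ} → (∀ x → f x ≡ g x) → ∀ xs → sumZ f xs ≡ sumZ g xs
sumZ-cong e [] = refl
sumZ-cong e (x ∷ xs) = cong₂ _⊕_ (e x) (sumZ-cong e xs)

interchangeZ : ∀ a b c d → (a ⊕ b) ⊕ (c ⊕ d) ≡ (a ⊕ c) ⊕ (b ⊕ d)
interchangeZ = ZR.solve-∀

sumZ-+ : (f g : 𝔸 → ℤ) → ∀ xs → sumZ (λ x → f x ⊕ g x) xs ≡ sumZ f xs ⊕ sumZ g xs
sumZ-+ f g [] = refl
sumZ-+ f g (x ∷ xs) = trans (cong (f x ⊕ g x ⊕_) (sumZ-+ f g xs)) (interchangeZ (f x) (g x) _ _)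

sumZ-*ˡ : (k : ℤ) (f : 𝔸 → ℤ) → ∀ xs → sumZ (λ x → k ⊛ f x) xs ≡ k ⊛ sumZ f xs
sumZ-*ˡ k f [] = sym (ZP.*-zeroʳ k)
sumZ-*ˡ k f (x ∷ xs) = trans (cong (k ⊛ f x ⊕_) (sumZ-*ˡ k f xs)) (sym (ZP.*-distribˡ-+ k (f x) _))

sumZ-*ʳ : (k : ℤ) (f : 𝔸 → ℤ) → ∀ xs → sumZ (λ x → f x ⊛ k) xs ≡ sumZ f xs ⊛ k
sumZ-*ʳ k f xs = trans (sumZ-cong (λ x → ZP.*-comm (f x) k) xs) (trans (sumZ-*ˡ k f xs) (ZP.*-comm k _))

sumZ-0 : (xs : List 𝔸) → sumZ (λ _ → 0ℤ) xs ≡ 0ℤ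
sumZ-0 [] = refl
sumZ-0 (x ∷ xs) = trans (ZP.+-identityˡ _) (sumZ-0 xs)

sumZ-swap : (f : 𝔸 → 𝔹 → ℤ) (xs : List 𝔸) (ys : List 𝔹) →
  sumZ (λ x → sumZ (f x) ys) xs ≡ sumZ (λ y → sumZ (λ x → f x y) xs) ys
sumZ-swap f [] ys = sym (sumZ-0 ys)
sumZ-swap f (x ∷ xs) ys = trans (cong (sumZ (f x) ys ⊕_) (sumZ-swap f xs ys)) (sym (sumZ-+ (f x) _ ys))

sumZ-pos : (f : 𝔸 → ℕ) → ∀ xs → sumZ (λ x → ⁺ f x) xs ≡ ⁺ sumL f xs
sumZ-pos f [] = refl
sumZ-pos f (x ∷ xs) = trans (cong (⁺ f x ⊕_) (sumZ-pos f xs)) (sym (ZP.pos-+ (f x) _))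

sumZ-++ : (f : 𝔸 → ℤ) → ∀ xs ys → sumZ f (xs ++ ys) ≡ sumZ f xs ⊕ sumZ f ys
sumZ-++ f [] ys = sym (ZP.+-identityˡ _)
sumZ-++ f (x ∷ xs) ys = trans (cong (f x ⊕_) (sumZ-++ f xs ys)) (sym (ZP.+-assoc (f x) _ _))

sumZ-map : (f : 𝔹 → ℤ) (h : 𝔸 → 𝔹) → ∀ xs → sumZ f (map h xs) ≡ sumZ (f ∘ h) xs
sumZ-map f h [] = refl
sumZ-map f h (x ∷ xs) = cong (f (h x) ⊕_) (sumZ-map f h xs)

∣sumZ∣≤ : (f : 𝔸 → ℤ) → ∀ xs → ∣ sumZ f xs ∣ ≤ sumL (λ x → ∣ f x ∣) xs
∣sumZ∣≤ f [] = z≤n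
∣sumZ∣≤ f (x ∷ xs) = ≤-trans (ZP.∣i+j∣≤∣i∣+∣j∣ (f x) _) (+-monoʳ-≤ ∣ f x ∣ (∣sumZ∣≤ f xs))

sumZ-bvecs : ∀ {l} (F : Vec Bool (suc l) → ℤ) →
  sumZ F (bvecs (suc l)) ≡ sumZ (F ∘ (true ∷_)) (bvecs l) ⊕ sumZ (F ∘ (false ∷_)) (bvecs l)
sumZ-bvecs {l} F = begin
  sumZ F (map (true ∷_) (bvecs l) ++ map (false ∷_) (bvecs l) ++ [])
    ≡⟨ sumZ-++ F (map (true ∷_) (bvecs l)) _ ⟩
  sumZ F (map (true ∷_) (bvecs l)) ⊕ sumZ F (map (false ∷_) (bvecs l) ++ [])
    ≡⟨ cong₂ _⊕_ (sumZ-map F _ (bvecs l))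
         (trans (cong (sumZ F) (LP.++-identityʳ (map (false ∷_) (bvecs l)))) (sumZ-map F _ (bvecs l))) ⟩
  _ ∎
  where open ≡-Reasoning

sumZ-flip : ∀ {l} (F : Vec Bool l → ℤ) i → sumZ (F ∘ flip i) (bvecs l) ≡ sumZ F (bvecs l)
sumZ-flip {suc l} F zero = begin
  sumZ (F ∘ flip zero) (bvecs (suc l)) ≡⟨ sumZ-bvecs (F ∘ flip zero) ⟩
  sumZ (F ∘ (false ∷_)) (bvecs l) ⊕ sumZ (F ∘ (true ∷_)) (bvecs l)
    ≡⟨ ZP.+-comm (sumZ (F ∘ (false ∷_)) (bvecs l)) (sumZ (F ∘ (true ∷_)) (bvecs l)) ⟩
  sumZ (F ∘ (true ∷_)) (bvecs l) ⊕ sumZ (F ∘ (false ∷_)) (bvecs l) ≡⟨ sumZ-bvecs F ⟨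
  sumZ F (bvecs (suc l)) ∎
  where open ≡-Reasoning
sumZ-flip {suc l} F (suc i) = begin
  sumZ (F ∘ flip (suc i)) (bvecs (suc l)) ≡⟨ sumZ-bvecs (F ∘ flip (suc i)) ⟩
  _ ≡⟨ cong₂ _⊕_ (sumZ-flip (F ∘ (true ∷_)) i) (sumZ-flip (F ∘ (false ∷_)) i) ⟩
  sumZ (F ∘ (true ∷_)) (bvecs l) ⊕ sumZ (F ∘ (false ∷_)) (bvecs l) ≡⟨ sumZ-bvecs F ⟨
  sumZ F (bvecs (suc l)) ∎
  where open ≡-Reasoning

-- Characters of the cube

parity : (𝔸 → Bool) → List 𝔸 → Bool
parity f [] = false
parity f (a ∷ w) = f a xor parity f w

sg : Bool → ℤ
sg true = -1ℤ
sg false = 1ℤ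

sg-xor : ∀ a b → sg (a xor b) ≡ sg a ⊛ sg b
sg-xor true true = refl
sg-xor true false = refl
sg-xor false true = refl
sg-xor false false = refl

sg-square : ∀ a → sg a ⊛ sg a ≡ 1ℤ
sg-square true = refl
sg-square false = refl

sg-not : ∀ a → sg (not a) ≡ ⁻ sg a
sg-not true = refl
sg-not false = refl

∣sg∣ : ∀ a → ∣ sg a ∣ ≡ 1
∣sg∣ true = refl
∣sg∣ false = refl

module _ {Q : ℕ} where

  -- The Walsh character of the set of letters that occur an odd number of times in `w`. Indexing by
  -- words rather than by sets turns products into concatenations.
  χ : List (Fin Q) → Vec Bool Q → ℤ
  χ w x = sg (parity (V.lookup x) w)

  χ-∷ : ∀ a w x → χ (a ∷ w) x ≡ sg (V.lookup x a) ⊛ χ w x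
  χ-∷ a w x = sg-xor (V.lookup x a) (parity (V.lookup x) w)

  χ-++ : ∀ u w x → χ (u ++ w) x ≡ χ u x ⊛ χ w x
  χ-++ [] w x = sym (ZP.*-identityˡ (χ w x))
  χ-++ (a ∷ u) w x = begin
    χ (a ∷ u ++ w) x                       ≡⟨ χ-∷ a (u ++ w) x ⟩
    sg (V.lookup x a) ⊛ χ (u ++ w) x       ≡⟨ cong (sg (V.lookup x a) ⊛_) (χ-++ u w x) ⟩
    sg (V.lookup x a) ⊛ (χ u x ⊛ χ w x)    ≡⟨ ZP.*-assoc (sg (V.lookup x a)) (χ u x) (χ w x) ⟨
    (sg (V.lookup x a) ⊛ χ u x) ⊛ χ w x    ≡⟨ cong (_⊛ χ w x) (χ-∷ a u x) ⟨
    χ (a ∷ u) x ⊛ χ w x                    ∎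
    where open ≡-Reasoning

  norm : (Vec Bool Q → ℤ) → ℕ
  norm ψ = ∣ sumZ ψ (bvecs Q) ∣

  norm-cong : {ψ φ : Vec Bool Q → ℤ} → (∀ x → ψ x ≡ φ x) → norm ψ ≡ norm φ
  norm-cong e = cong ∣_∣ (sumZ-cong e (bvecs Q))

  letters : List (Fin Q)
  letters = allFin Q

  -- For `ψ = one` a term is `2 ^ Q` if every letter of `W` occurs an even number of times, and zero
  -- otherwise. The factor `ψ` holds the letters already split off in the inductions below.
  spread : (Vec Bool Q → ℤ) → ℕ → ℕ
  spread ψ L = sumL (λ W → norm (λ x → χ W x ⊛ ψ x)) (words letters L)

  norm-combination : (I : Set) (𝒜 : List I) (ε : I → ℤ) → (∀ a → ∣ ε a ∣ ≤ 1) →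
    (u : I → Vec Bool Q → ℤ) (g : Vec Bool Q → ℤ) →
    norm (λ x → sumZ (λ a → ε a ⊛ u a x) 𝒜 ⊛ g x) ≤ sumL (λ a → norm (λ x → u a x ⊛ g x)) 𝒜
  norm-combination I 𝒜 ε ε≤1 u g = subst (_≤ sumL (λ a → norm (λ x → u a x ⊛ g x)) 𝒜) (cong ∣_∣ (sym exchange))
    (≤-trans (∣sumZ∣≤ _ 𝒜) (sum-mono termwise 𝒜))
    where
    exchange : sumZ (λ x → sumZ (λ a → ε a ⊛ u a x) 𝒜 ⊛ g x) (bvecs Q) ≡
      sumZ (λ a → ε a ⊛ sumZ (λ x → u a x ⊛ g x) (bvecs Q)) 𝒜
    exchange = begin
      sumZ (λ x → sumZ (λ a → ε a ⊛ u a x) 𝒜 ⊛ g x) (bvecs Q)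
        ≡⟨ sumZ-cong (λ x → sumZ-*ʳ (g x) (λ a → ε a ⊛ u a x) 𝒜) (bvecs Q) ⟨
      sumZ (λ x → sumZ (λ a → (ε a ⊛ u a x) ⊛ g x) 𝒜) (bvecs Q)
        ≡⟨ sumZ-swap _ (bvecs Q) 𝒜 ⟩
      sumZ (λ a → sumZ (λ x → (ε a ⊛ u a x) ⊛ g x) (bvecs Q)) 𝒜
        ≡⟨ sumZ-cong (λ a → trans (sumZ-cong (λ x → ZP.*-assoc (ε a) (u a x) (g x)) (bvecs Q))
             (sumZ-*ˡ (ε a) (λ x → u a x ⊛ g x) (bvecs Q))) 𝒜 ⟩
      _ ∎
      where open ≡-Reasoning
    termwise : ∀ a → ∣ ε a ⊛ sumZ (λ x → u a x ⊛ g x) (bvecs Q) ∣ ≤ norm (λ x → u a x ⊛ g x)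
    termwise a = begin
      ∣ ε a ⊛ sumZ (λ x → u a x ⊛ g x) (bvecs Q) ∣ ≡⟨ ZP.abs-* (ε a) _ ⟩
      ∣ ε a ∣ * N                                  ≤⟨ *-monoˡ-≤ N (ε≤1 a) ⟩
      1 * N                                        ≡⟨ *-identityˡ N ⟩
      N                                            ∎
      where
      open ≤-Reasoning
      N = norm (λ x → u a x ⊛ g x)

  -- Expanding an r-th power of a sum of distinct characters with coefficients in {-1,0,1}.
  moment≤spread : {I : Set} (𝒜 : List I) (wd : I → List (Fin Q)) (ℓ : ℕ) → Unique 𝒜 →
    (∀ a b → a ∈ 𝒜 → b ∈ 𝒜 → wd a ≡ wd b → a ≡ b) → (∀ a → a ∈ 𝒜 → length (wd a) ≡ ℓ) →
    (ε : I → ℤ) → (∀ a → ∣ ε a ∣ ≤ 1) → ∀ r ψ →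
    norm (λ x → (sumZ (λ a → ε a ⊛ χ (wd a) x) 𝒜 ⊛^ r) ⊛ ψ x) ≤ spread ψ (r * ℓ)
  moment≤spread 𝒜 wd ℓ u inj len ε ε≤1 zero ψ = m≤m+n _ 0
  moment≤spread {I} 𝒜 wd ℓ u inj len ε ε≤1 (suc r) ψ = begin
    norm (λ x → (f x ⊛^ suc r) ⊛ ψ x)
      ≡⟨ norm-cong (λ x → ZP.*-assoc (f x) (f x ⊛^ r) (ψ x)) ⟩
    norm (λ x → f x ⊛ ((f x ⊛^ r) ⊛ ψ x))
      ≤⟨ norm-combination I 𝒜 ε ε≤1 (λ a → χ (wd a)) (λ x → (f x ⊛^ r) ⊛ ψ x) ⟩
    sumL (λ a → norm (λ x → χ (wd a) x ⊛ ((f x ⊛^ r) ⊛ ψ x))) 𝒜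
      ≡⟨ sum-cong (λ a → norm-cong (λ x → rearrange (χ (wd a) x) (f x ⊛^ r) (ψ x))) 𝒜 ⟩
    sumL (λ a → norm (λ x → (f x ⊛^ r) ⊛ (χ (wd a) x ⊛ ψ x))) 𝒜
      ≤⟨ sum-mono (λ a → moment≤spread 𝒜 wd ℓ u inj len ε ε≤1 r (λ x → χ (wd a) x ⊛ ψ x)) 𝒜 ⟩
    sumL (λ a → spread (λ x → χ (wd a) x ⊛ ψ x) (r * ℓ)) 𝒜
      -- Here the distinctness of the words is used: the sum over `𝒜` is dominated by the sum over
      -- all words of length `ℓ`.
      ≤⟨ sum-inj (λ w → spread (λ x → χ w x ⊛ ψ x) (r * ℓ)) wd (words letters ℓ) u inj
           (λ a a∈ → subst (λ l → wd a ∈ words letters l) (len a a∈) (∈-words ∈-allFin (wd a))) ⟩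
    sumL (λ w → spread (λ x → χ w x ⊛ ψ x) (r * ℓ)) (words letters ℓ)
      ≡⟨ sum-cong (λ w → sum-cong (λ W → norm-cong (λ x → merge w W x)) (words letters (r * ℓ))) (words letters ℓ) ⟩
    sumL (λ w → sumL (λ W → norm (λ x → χ (w ++ W) x ⊛ ψ x)) (words letters (r * ℓ))) (words letters ℓ)
      ≡⟨ sum-words-++ (λ W → norm (λ x → χ W x ⊛ ψ x)) letters ℓ (r * ℓ) ⟨
    spread ψ (suc r * ℓ) ∎
    where
    open ≤-Reasoning
    f : Vec Bool Q → ℤ
    f x = sumZ (λ a → ε a ⊛ χ (wd a) x) 𝒜
    rearrange : ∀ a b c → a ⊛ (b ⊛ c) ≡ b ⊛ (a ⊛ c)
    rearrange = ZR.solve-∀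
    merge : ∀ w W x → χ W x ⊛ (χ w x ⊛ ψ x) ≡ χ (w ++ W) x ⊛ ψ x
    merge w W x = trans (rearrange (χ W x) (χ w x) (ψ x))
      (trans (sym (ZP.*-assoc (χ w x) (χ W x) (ψ x))) (cong (_⊛ ψ x) (sym (χ-++ w W x))))

  -- A letter of a word with nonzero character sum must occur again: pairing it with one of
  -- its other occurrences bounds the spread of two more letters.

  pairings : Fin Q → (Vec Bool Q → ℤ) → List (Fin Q) → ℕ
  pairings a ψ [] = 0
  pairings a ψ (b ∷ w) = ind (does (b ≟F a)) * norm (λ x → χ w x ⊛ ψ x) + pairings a (λ x → sg (V.lookup x b) ⊛ ψ x) w

  allPairings : (Vec Bool Q → ℤ) → List (Fin Q) → ℕ
  allPairings ψ [] = 0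
  allPairings ψ (b ∷ w) = norm (λ x → χ w x ⊛ ψ x) + allPairings (λ x → sg (V.lookup x b) ⊛ ψ x) w

  -- The square of a sign is 1, so `a` cancels against the occurrence that the membership proof
  -- points to. The letters passed on the way are absorbed into `ψ`.
  norm≤pairings : ∀ a ψ w → a ∈ w → norm (λ x → sg (V.lookup x a) ⊛ (χ w x ⊛ ψ x)) ≤ pairings a ψ w
  norm≤pairings a ψ (b ∷ w) (here refl) with a ≟F a
  ... | no a≢a = ⊥-elim (a≢a refl)
  ... | yes _ = begin
    norm (λ x → sg (V.lookup x a) ⊛ (χ (a ∷ w) x ⊛ ψ x))  ≡⟨ norm-cong cancel ⟩
    norm (λ x → χ w x ⊛ ψ x)                              ≡⟨ *-identityˡ (norm (λ x → χ w x ⊛ ψ x)) ⟨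
    1 * norm (λ x → χ w x ⊛ ψ x)                          ≤⟨ m≤m+n _ _ ⟩
    1 * norm (λ x → χ w x ⊛ ψ x) + pairings a (λ x → sg (V.lookup x a) ⊛ ψ x) w ∎
    where
    open ≤-Reasoning
    regroup : ∀ s c p → s ⊛ ((s ⊛ c) ⊛ p) ≡ (s ⊛ s) ⊛ (c ⊛ p)
    regroup = ZR.solve-∀
    cancel : ∀ x → sg (V.lookup x a) ⊛ (χ (a ∷ w) x ⊛ ψ x) ≡ χ w x ⊛ ψ x
    cancel x = trans (cong (λ z → sg (V.lookup x a) ⊛ (z ⊛ ψ x)) (χ-∷ a w x))
      (trans (regroup (sg (V.lookup x a)) (χ w x) (ψ x))
        (trans (cong (_⊛ (χ w x ⊛ ψ x)) (sg-square (V.lookup x a))) (ZP.*-identityˡ _)))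
  norm≤pairings a ψ (b ∷ w) (there a∈) = begin
    norm (λ x → sg (V.lookup x a) ⊛ (χ (b ∷ w) x ⊛ ψ x))
      ≡⟨ norm-cong (λ x → trans (cong (λ z → sg (V.lookup x a) ⊛ (z ⊛ ψ x)) (χ-∷ b w x))
           (regroup (sg (V.lookup x a)) (sg (V.lookup x b)) (χ w x) (ψ x))) ⟩
    norm (λ x → sg (V.lookup x a) ⊛ (χ w x ⊛ (sg (V.lookup x b) ⊛ ψ x)))
      ≤⟨ norm≤pairings a (λ x → sg (V.lookup x b) ⊛ ψ x) w a∈ ⟩
    pairings a (λ x → sg (V.lookup x b) ⊛ ψ x) w
      ≤⟨ m≤n+m _ _ ⟩
    pairings a ψ (b ∷ w) ∎
    where
    open ≤-Reasoning
    regroup : ∀ s t c p → s ⊛ ((t ⊛ c) ⊛ p) ≡ s ⊛ (c ⊛ (t ⊛ p))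
    regroup = ZR.solve-∀

  parity-flip-∉ : ∀ a w (x : Vec Bool Q) → a ∉ w → parity (V.lookup (flip a x)) w ≡ parity (V.lookup x) w
  parity-flip-∉ a [] x a∉ = refl
  parity-flip-∉ a (b ∷ w) x a∉ = cong₂ _xor_
    (VP.lookup∘updateAt′ b a (λ e → a∉ (here (sym e))) x) (parity-flip-∉ a w x (a∉ ∘ there))

  i≡-i⇒i≡0 : ∀ i → i ≡ ⁻ i → i ≡ 0ℤ
  i≡-i⇒i≡0 (⁺ zero) e = refl
  i≡-i⇒i≡0 (⁺ suc n) ()
  i≡-i⇒i≡0 -[1+ n ] ()

  -- Flipping coordinate `a` permutes the cube and negates the character, so the sum equals its own
  -- negative.
  norm-lone-letter : ∀ a w → a ∉ w → norm (χ (a ∷ w)) ≡ 0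
  norm-lone-letter a w a∉ = cong ∣_∣ (i≡-i⇒i≡0 S (begin
    S                                        ≡⟨ sumZ-flip (χ (a ∷ w)) a ⟨
    sumZ (χ (a ∷ w) ∘ flip a) (bvecs Q)      ≡⟨ sumZ-cong negated (bvecs Q) ⟩
    sumZ (λ x → -1ℤ ⊛ χ (a ∷ w) x) (bvecs Q) ≡⟨ sumZ-*ˡ -1ℤ (χ (a ∷ w)) (bvecs Q) ⟩
    -1ℤ ⊛ S                                  ≡⟨ ZP.-1*i≡-i S ⟩
    ⁻ S                                      ∎))
    where
    open ≡-Reasoning
    S = sumZ (χ (a ∷ w)) (bvecs Q)
    negated : ∀ x → χ (a ∷ w) (flip a x) ≡ -1ℤ ⊛ χ (a ∷ w) x
    negated x = begin
      χ (a ∷ w) (flip a x)                        ≡⟨ χ-∷ a w (flip a x) ⟩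
      sg (V.lookup (flip a x) a) ⊛ χ w (flip a x)
        ≡⟨ cong₂ _⊛_ (trans (cong sg (VP.lookup∘updateAt a x)) (sg-not (V.lookup x a)))
             (cong sg (parity-flip-∉ a w x a∉)) ⟩
      (⁻ sg (V.lookup x a)) ⊛ χ w x               ≡⟨ neg (sg (V.lookup x a)) (χ w x) ⟩
      -1ℤ ⊛ (sg (V.lookup x a) ⊛ χ w x)           ≡⟨ cong (-1ℤ ⊛_) (χ-∷ a w x) ⟨
      -1ℤ ⊛ χ (a ∷ w) x                           ∎
      where
      neg : ∀ s c → (⁻ s) ⊛ c ≡ -1ℤ ⊛ (s ⊛ c)
      neg = ZR.solve-∀

  -- Every position of `w` holds exactly one letter, so the sum over `a` removes the indicator.
  sum-pairings : ∀ ψ w → sumL (λ a → pairings a ψ w) letters ≡ allPairings ψ w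
  sum-pairings ψ [] = sum-0 letters
  sum-pairings ψ (b ∷ w) = trans (sum-+ _ _ letters) (cong₂ _+_ single (sum-pairings (λ x → sg (V.lookup x b) ⊛ ψ x) w))
    where
    N = norm (λ x → χ w x ⊛ ψ x)
    zeros : ∀ ys → b ∉ ys → sumL (λ a → ind (does (b ≟F a)) * N) ys ≡ 0
    zeros [] b∉ = refl
    zeros (y ∷ ys) b∉ with b ≟F y
    ... | yes refl = ⊥-elim (b∉ (here refl))
    ... | no _ = zeros ys (b∉ ∘ there)
    once : ∀ ys → Unique ys → b ∈ ys → sumL (λ a → ind (does (b ≟F a)) * N) ys ≡ N
    once (y ∷ ys) (y# ∷ u) (here refl) with b ≟F b
    ... | no b≢b = ⊥-elim (b≢b refl)
    ... | yes _ = trans (cong₂ _+_ (*-identityˡ N) (zeros ys (λ b∈ → All.lookup y# b∈ refl))) (+-identityʳ N)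
    once (y ∷ ys) (y# ∷ u) (there b∈) with b ≟F y
    ... | yes refl = ⊥-elim (All.lookup y# b∈ refl)
    ... | no _ = once ys u b∈
    single : sumL (λ a → ind (does (b ≟F a)) * N) letters ≡ N
    single = once letters (Uniq.allFin⁺ Q) (∈-allFin b)

  -- Any of the `suc j` positions may be the one deleted; its letter has `Q` choices, and the
  -- letters before it, parked in `ψ`, rejoin the others to form an arbitrary word of length `j`.
  sum-allPairings : ∀ j ψ → sumL (allPairings ψ) (words letters (suc j)) ≡ suc j * (Q * spread ψ j)
  sum-allPairings j ψ = begin
    sumL (allPairings ψ) (words letters (suc j))
      ≡⟨ sum-product (allPairings ψ) _∷_ letters (words letters j) ⟩
    sumL (λ b → sumL (λ w → norm (λ x → χ w x ⊛ ψ x) + allPairings (ψ′ b) w) (words letters j)) letters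
      ≡⟨ sum-cong (λ b → sum-+ _ (allPairings (ψ′ b)) (words letters j)) letters ⟩
    sumL (λ b → spread ψ j + sumL (allPairings (ψ′ b)) (words letters j)) letters
      ≡⟨ sum-+ (λ _ → spread ψ j) _ letters ⟩
    sumL (λ b → spread ψ j) letters + sumL (λ b → sumL (allPairings (ψ′ b)) (words letters j)) letters
      ≡⟨ cong₂ _+_ (trans (sum-const (spread ψ j) letters) (cong (_* spread ψ j) (LP.length-tabulate {n = Q} id))) (later j) ⟩
    Q * spread ψ j + j * (Q * spread ψ j) ∎
    where
    open ≡-Reasoning
    ψ′ : Fin Q → Vec Bool Q → ℤ
    ψ′ b x = sg (V.lookup x b) ⊛ ψ x
    move : ∀ s c p → c ⊛ (s ⊛ p) ≡ (s ⊛ c) ⊛ p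
    move = ZR.solve-∀
    later : ∀ j → sumL (λ b → sumL (allPairings (ψ′ b)) (words letters j)) letters ≡ j * (Q * spread ψ j)
    later zero = sum-0 letters
    later (suc j) = begin
      sumL (λ b → sumL (allPairings (ψ′ b)) (words letters (suc j))) letters
        ≡⟨ sum-cong (λ b → sum-allPairings j (ψ′ b)) letters ⟩
      sumL (λ b → suc j * (Q * spread (ψ′ b) j)) letters
        ≡⟨ sum-*ˡ (suc j) _ letters ⟩
      suc j * sumL (λ b → Q * spread (ψ′ b) j) letters
        ≡⟨ cong (suc j *_) (sum-*ˡ Q _ letters) ⟩
      suc j * (Q * sumL (λ b → spread (ψ′ b) j) letters)
        ≡⟨ cong (λ z → suc j * (Q * z)) (sum-cong (λ b → sum-cong (λ w → norm-cong (λ x →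
             trans (move (sg (V.lookup x b)) (χ w x) (ψ x)) (cong (_⊛ ψ x) (sym (χ-∷ b w x))))) (words letters j)) letters) ⟩
      suc j * (Q * sumL (λ b → sumL (λ w → norm (λ x → χ (b ∷ w) x ⊛ ψ x)) (words letters j)) letters)
        ≡⟨ cong (λ z → suc j * (Q * z)) (sum-product (λ W → norm (λ x → χ W x ⊛ ψ x)) _∷_ letters (words letters j)) ⟨
      suc j * (Q * spread ψ (suc j)) ∎

  one : Vec Bool Q → ℤ
  one _ = 1ℤ

  -- The first letter is either matched with one of the `suc j` other positions or occurs only once,
  -- in which case its term vanishes.
  spread-step : ∀ j → spread one (2 + j) ≤ suc j * (Q * spread one j)
  spread-step j = begin
    spread one (2 + j)
      ≡⟨ sum-product (λ W → norm (λ x → χ W x ⊛ 1ℤ)) _∷_ letters (words letters (suc j)) ⟩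
    sumL (λ a → sumL (λ w → norm (λ x → χ (a ∷ w) x ⊛ 1ℤ)) (words letters (suc j))) letters
      ≤⟨ sum-mono (λ a → sum-mono (bound a) (words letters (suc j))) letters ⟩
    sumL (λ a → sumL (pairings a one) (words letters (suc j))) letters
      ≡⟨ sum-swap (λ a w → pairings a one w) letters (words letters (suc j)) ⟩
    sumL (λ w → sumL (λ a → pairings a one w) letters) (words letters (suc j))
      ≡⟨ sum-cong (sum-pairings one) (words letters (suc j)) ⟩
    sumL (allPairings one) (words letters (suc j))
      ≡⟨ sum-allPairings j one ⟩
    suc j * (Q * spread one j) ∎
    where
    open ≤-Reasoning
    bound : ∀ a w → norm (λ x → χ (a ∷ w) x ⊛ 1ℤ) ≤ pairings a one w
    bound a w with mem? _≟F_ a w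
    ... | yes a∈ = subst (_≤ pairings a one w)
      (norm-cong (λ x → trans (sym (ZP.*-assoc (sg (V.lookup x a)) (χ w x) 1ℤ)) (cong (_⊛ 1ℤ) (sym (χ-∷ a w x)))))
      (norm≤pairings a one w a∈)
    ... | no a∉ = subst (_≤ pairings a one w)
      (sym (trans (norm-cong (λ x → ZP.*-identityʳ (χ (a ∷ w) x))) (norm-lone-letter a w a∉))) z≤n

  -- Iterating the step counts at most `(2j - 1)!! * Q ^ j` even words, and the double factorial is
  -- at most `(2j) ^ j`.
  spread-bound : ∀ j → spread one (j + j) ≤ 2 ^ Q * ((j + j) * Q) ^ j
  spread-bound zero = ≤-reflexive (begin
    norm (λ x → 1ℤ) + 0          ≡⟨ +-identityʳ _ ⟩
    norm (λ x → ⁺ 1)             ≡⟨ cong ∣_∣ (sumZ-pos (λ _ → 1) (bvecs Q)) ⟩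
    sumL (λ _ → 1) (bvecs Q)     ≡⟨ sum-const 1 (bvecs Q) ⟩
    length (bvecs Q) * 1         ≡⟨ cong (_* 1) (length-vecs bools Q) ⟩
    2 ^ Q * 1                    ∎)
    where open ≡-Reasoning
  spread-bound (suc j) = begin
    spread one (suc j + suc j)              ≡⟨ cong (spread one) (cong suc (+-suc j j)) ⟩
    spread one (2 + (j + j))                ≤⟨ spread-step (j + j) ⟩
    suc (j + j) * (Q * spread one (j + j))  ≤⟨ *-monoʳ-≤ (suc (j + j)) (*-monoʳ-≤ Q (spread-bound j)) ⟩
    suc (j + j) * (Q * (2 ^ Q * ((j + j) * Q) ^ j)) ≡⟨ regroup (suc (j + j)) Q (2 ^ Q) _ ⟩
    2 ^ Q * ((suc (j + j) * Q) * ((j + j) * Q) ^ j)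
      ≤⟨ *-monoʳ-≤ (2 ^ Q) (*-mono-≤ (*-monoˡ-≤ Q (s≤s (+-monoʳ-≤ j (n≤1+n j))))
           (^-monoˡ-≤ j (*-monoˡ-≤ Q (+-mono-≤ (n≤1+n j) (n≤1+n j))))) ⟩
    2 ^ Q * ((suc j + suc j) * Q) ^ suc j   ∎
    where
    open ≤-Reasoning
    regroup : ∀ a b c d → a * (b * (c * d)) ≡ c * ((a * b) * d)
    regroup = solve-∀

square-pos : ∀ i → i ⊛ i ≡ ⁺ (∣ i ∣ * ∣ i ∣)
square-pos (⁺ n) = sym (ZP.pos-* n n)
square-pos -[1+ n ] = refl

abs-^ : ∀ i h → ∣ i ⊛^ h ∣ ≡ ∣ i ∣ ^ h
abs-^ i zero = refl
abs-^ i (suc h) = trans (ZP.abs-* i (i ⊛^ h)) (cong (∣ i ∣ *_) (abs-^ i h))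

-- An even moment of the absolute value is a polynomial in the signed sum and can be expanded into
-- characters; this is why all moments have order `h + h`.
even-power : ∀ i h → i ⊛^ (h + h) ≡ ⁺ (∣ i ∣ ^ (h + h))
even-power i h = begin
  i ⊛^ (h + h)                    ≡⟨ ZP.^-distribˡ-+-* i h h ⟩
  (i ⊛^ h) ⊛ (i ⊛^ h)             ≡⟨ square-pos (i ⊛^ h) ⟩
  ⁺ (∣ i ⊛^ h ∣ * ∣ i ⊛^ h ∣)     ≡⟨ cong (λ z → ⁺ (z * z)) (abs-^ i h) ⟩
  ⁺ (∣ i ∣ ^ h * ∣ i ∣ ^ h)       ≡⟨ cong ⁺_ (^-distribˡ-+-* ∣ i ∣ h h) ⟨
  ⁺ (∣ i ∣ ^ (h + h))             ∎
  where open ≡-Reasoning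

-- Replaces Hölder's inequality: after division by `θ ^ r` it bounds a mean by `θ` plus a moment of
-- order `suc r`.
truncate : ∀ θ y r → θ ^ r * y ≤ θ ^ suc r + y ^ suc r
truncate θ y r with ≤-total y θ
... | inj₁ y≤θ = ≤-trans (≤-trans (*-monoʳ-≤ (θ ^ r) y≤θ) (≤-reflexive (*-comm (θ ^ r) θ))) (m≤m+n _ _)
... | inj₂ θ≤y = ≤-trans (≤-trans (*-monoˡ-≤ y (^-monoˡ-≤ r θ≤y)) (≤-reflexive (*-comm (y ^ r) y))) (m≤n+m _ _)

-- One-way protocols cannot guess the parity of a hidden word

module HiddenParity {Q : ℕ} {I Msg : Set} (𝒜 : List I) (wd : I → List (Fin Q)) (ℓ : ℕ) (u : Unique 𝒜)
  (inj : ∀ a b → a ∈ 𝒜 → b ∈ 𝒜 → wd a ≡ wd b → a ≡ b) (len : ∀ a → a ∈ 𝒜 → length (wd a) ≡ ℓ)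
  (K : List Msg) (o : Msg → I → Bool) (al : Vec Bool Q → Msg) (al∈ : ∀ x → al x ∈ K)
  (s₁ : I → Bool) (s₂ : Vec Bool Q → Bool) where

  -- Alice holds `x`, Bob holds `a`. Shifts depending on one input only are harmless: `s₁` is
  -- absorbed into Bob's coefficients and `s₂` into a sign that is constant in `a`.
  par : Vec Bool Q → I → Bool
  par x a = s₂ x xor (s₁ a xor parity (V.lookup x) (wd a))

  coeff : Msg → I → ℤ
  coeff κ a = ⁺ ind (o κ a) ⊛ sg (s₁ a)

  ∣coeff∣≤1 : ∀ κ a → ∣ coeff κ a ∣ ≤ 1
  ∣coeff∣≤1 κ a with o κ a | s₁ a
  ... | true | true = ≤-refl
  ... | true | false = ≤-refl
  ... | false | true = z≤n
  ... | false | false = z≤n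

  -- Once the message is fixed, Bob's answer depends on `a` alone, so the coefficients do not
  -- involve `x` and the moment expansion applies.
  f : Msg → Vec Bool Q → ℤ
  f κ x = sumZ (λ a → coeff κ a ⊛ χ (wd a) x) 𝒜

  -- The sign of `par x a` is the indicator of even parity minus that of odd parity, and it is the
  -- product of the signs of the three summands of `par x a`.
  bias : ∀ x → ⁺ sumL (λ a → ind (par x a ∧ o (al x) a)) 𝒜 ⊕ sg (s₂ x) ⊛ f (al x) x ≡
    ⁺ sumL (λ a → ind (not (par x a) ∧ o (al x) a)) 𝒜
  bias x = begin
    ⁺ sumL (λ a → ind (par x a ∧ o (al x) a)) 𝒜 ⊕ sg (s₂ x) ⊛ f (al x) x
      ≡⟨ cong₂ _⊕_ (sumZ-pos _ 𝒜) (sumZ-*ˡ (sg (s₂ x)) _ 𝒜) ⟨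
    sumZ (λ a → ⁺ ind (par x a ∧ o (al x) a)) 𝒜 ⊕ sumZ (λ a → sg (s₂ x) ⊛ (coeff (al x) a ⊛ χ (wd a) x)) 𝒜
      ≡⟨ sumZ-+ _ _ 𝒜 ⟨
    sumZ (λ a → ⁺ ind (par x a ∧ o (al x) a) ⊕ sg (s₂ x) ⊛ (coeff (al x) a ⊛ χ (wd a) x)) 𝒜
      ≡⟨ sumZ-cong (λ a → pointwise (s₂ x) (s₁ a) (parity (V.lookup x) (wd a)) (o (al x) a)) 𝒜 ⟩
    sumZ (λ a → ⁺ ind (not (par x a) ∧ o (al x) a)) 𝒜
      ≡⟨ sumZ-pos _ 𝒜 ⟩
    ⁺ sumL (λ a → ind (not (par x a) ∧ o (al x) a)) 𝒜 ∎
    where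
    open ≡-Reasoning
    pointwise : ∀ s t p b → ⁺ ind ((s xor (t xor p)) ∧ b) ⊕ sg s ⊛ ((⁺ ind b ⊛ sg t) ⊛ sg p) ≡ ⁺ ind (not (s xor (t xor p)) ∧ b)
    pointwise false false false false = refl
    pointwise false false false true = refl
    pointwise false false true false = refl
    pointwise false false true true = refl
    pointwise false true false false = refl
    pointwise false true false true = refl
    pointwise false true true false = refl
    pointwise false true true true = refl
    pointwise true false false false = refl
    pointwise true false false true = refl
    pointwise true false true false = refl
    pointwise true false true true = refl
    pointwise true true false false = refl
    pointwise true true false true = refl
    pointwise true true true false = refl
    pointwise true true true true = refl

  bias≤ : ∀ x → sumL (λ a → ind (par x a ∧ o (al x) a)) 𝒜 ≤
    sumL (λ a → ind (not (par x a) ∧ o (al x) a)) 𝒜 + ∣ f (al x) x ∣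
  bias≤ x = begin
    p                              ≡⟨ cong ∣_∣ split ⟩
    ∣ ⁺ m ⊖ (sg (s₂ x) ⊛ F) ∣    ≤⟨ ZP.∣i-j∣≤∣i∣+∣j∣ (⁺ m) (sg (s₂ x) ⊛ F) ⟩
    m + ∣ sg (s₂ x) ⊛ F ∣          ≡⟨ cong (_+_ m) (trans (ZP.abs-* (sg (s₂ x)) F) (trans (cong (_* ∣ F ∣) (∣sg∣ (s₂ x))) (*-identityˡ ∣ F ∣))) ⟩
    m + ∣ F ∣                      ∎
    where
    open ≤-Reasoning
    p = sumL (λ a → ind (par x a ∧ o (al x) a)) 𝒜
    m = sumL (λ a → ind (not (par x a) ∧ o (al x) a)) 𝒜
    F = f (al x) x
    cancel : ∀ i j → i ≡ (i ⊕ j) ⊖ j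
    cancel = ZR.solve-∀
    split : ⁺ p ≡ ⁺ m ⊖ (sg (s₂ x) ⊛ F)
    split = trans (cancel (⁺ p) (sg (s₂ x) ⊛ F)) (cong (_⊖ (sg (s₂ x) ⊛ F)) (bias x))

  moment : ∀ κ h → sumL (λ x → ∣ f κ x ∣ ^ (h + h)) (bvecs Q) ≤ spread one ((h + h) * ℓ)
  moment κ h = subst (_≤ spread one ((h + h) * ℓ))
    (trans (norm-cong (λ x → trans (ZP.*-identityʳ _) (even-power (f κ x) h))) (cong ∣_∣ (sumZ-pos _ (bvecs Q))))
    (moment≤spread 𝒜 wd ℓ u inj len (coeff κ) (∣coeff∣≤1 κ) (h + h) one)

  -- The message varies with `x`. Adding up the moments for all possible messages removes this
  -- dependence, at the price of the factor `length K`.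
  union-moment : ∀ h → sumL (λ x → ∣ f (al x) x ∣ ^ (h + h)) (bvecs Q) ≤ length K * spread one ((h + h) * ℓ)
  union-moment h = begin
    sumL (λ x → ∣ f (al x) x ∣ ^ (h + h)) (bvecs Q)
      ≤⟨ sum-mono (λ x → term≤sum (λ κ → ∣ f κ x ∣ ^ (h + h)) K (al∈ x)) (bvecs Q) ⟩
    sumL (λ x → sumL (λ κ → ∣ f κ x ∣ ^ (h + h)) K) (bvecs Q)
      ≡⟨ sum-swap (λ x κ → ∣ f κ x ∣ ^ (h + h)) (bvecs Q) K ⟩
    sumL (λ κ → sumL (λ x → ∣ f κ x ∣ ^ (h + h)) (bvecs Q)) K
      ≤⟨ sum-mono (λ κ → moment κ h) K ⟩
    sumL (λ _ → spread one ((h + h) * ℓ)) K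
      ≡⟨ sum-const _ K ⟩
    length K * spread one ((h + h) * ℓ) ∎
    where open ≤-Reasoning

  total-bias : ∀ h θ → 1 ≤ θ → length K * spread one ((suc h + suc h) * ℓ) ≤ 2 ^ Q * θ ^ (suc h + suc h) →
    sumL (λ x → ∣ f (al x) x ∣) (bvecs Q) ≤ 2 * (2 ^ Q * θ)
  total-bias h θ θ≥1 small = *-cancelˡ-≤ (θ ^ r) {{m^n≢0 θ r {{>-nonZero θ≥1}}}} (begin
    θ ^ r * sumL (λ x → ∣ f (al x) x ∣) (bvecs Q)
      ≡⟨ sum-*ˡ (θ ^ r) _ (bvecs Q) ⟨
    sumL (λ x → θ ^ r * ∣ f (al x) x ∣) (bvecs Q)
      ≤⟨ sum-mono (λ x → truncate θ ∣ f (al x) x ∣ r) (bvecs Q) ⟩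
    sumL (λ x → θ ^ suc r + ∣ f (al x) x ∣ ^ suc r) (bvecs Q)
      ≡⟨ sum-+ _ _ (bvecs Q) ⟩
    sumL (λ x → θ ^ suc r) (bvecs Q) + sumL (λ x → ∣ f (al x) x ∣ ^ suc r) (bvecs Q)
      ≤⟨ +-mono-≤ (≤-reflexive (trans (sum-const _ (bvecs Q)) (cong (_* θ ^ suc r) (length-vecs bools Q))))
           (≤-trans (union-moment (suc h)) small) ⟩
    2 ^ Q * θ ^ suc r + 2 ^ Q * θ ^ suc r
      ≡⟨ regroup (2 ^ Q) θ (θ ^ r) ⟩
    θ ^ r * (2 * (2 ^ Q * θ)) ∎)
    where
    open ≤-Reasoning
    -- `suc r` computes to the even order `suc h + suc h` of `union-moment`.
    r = h + suc h
    regroup : ∀ a t p → a * (t * p) + a * (t * p) ≡ p * (2 * (a * t))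
    regroup = solve-∀

  hidden-parity : ∀ h θ → 1 ≤ θ → length K * spread one ((suc h + suc h) * ℓ) ≤ 2 ^ Q * θ ^ (suc h + suc h) →
    sumL (λ x → sumL (λ a → ind (par x a ∧ o (al x) a)) 𝒜) (bvecs Q) ≤
    sumL (λ x → sumL (λ a → ind (not (par x a) ∧ o (al x) a)) 𝒜) (bvecs Q) + 2 * (2 ^ Q * θ)
  hidden-parity h θ θ≥1 small = begin
    sumL (λ x → sumL (λ a → ind (par x a ∧ o (al x) a)) 𝒜) (bvecs Q)
      ≤⟨ sum-mono bias≤ (bvecs Q) ⟩
    sumL (λ x → sumL (λ a → ind (not (par x a) ∧ o (al x) a)) 𝒜 + ∣ f (al x) x ∣) (bvecs Q)
      ≡⟨ sum-+ _ _ (bvecs Q) ⟩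
    _ ≤⟨ +-monoʳ-≤ _ (total-bias h θ θ≥1 small) ⟩
    _ ∎
    where open ≤-Reasoning

-- Edge lists, protocols and random colourings

countL≡sum : (p : 𝔸 → Bool) → ∀ xs → countL p xs ≡ sumL (ind ∘ p) xs
countL≡sum p [] = refl
countL≡sum p (x ∷ xs) = cong (ind (p x) +_) (countL≡sum p xs)

sum-allVec : (f : List Bool → ℕ) → ∀ l → sumL (f ∘ V.toList) (allVec l) ≡ sumL f (words bools l)
sum-allVec f zero = refl
sum-allVec f (suc l) = begin
  sumL (f ∘ V.toList) (allVec (suc l))
    ≡⟨ split (allVec l) ⟩
  sumL (f ∘ (true ∷_) ∘ V.toList) (allVec l) + sumL (f ∘ (false ∷_) ∘ V.toList) (allVec l)
    ≡⟨ cong₂ _+_ (sum-allVec (f ∘ (true ∷_)) l) (trans (sum-allVec (f ∘ (false ∷_)) l) (sym (+-identityʳ _))) ⟩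
  sumL (λ b → sumL (f ∘ (b ∷_)) (words bools l)) bools
    ≡⟨ sum-product f _∷_ bools (words bools l) ⟨
  sumL f (words bools (suc l)) ∎
  where
  open ≡-Reasoning
  regroup : ∀ a b c d → a + (b + (c + d)) ≡ (a + c) + (b + d)
  regroup = solve-∀
  split : ∀ vs → sumL (f ∘ V.toList) (concatMap (λ v → (true ∷ v) ∷ (false ∷ v) ∷ []) vs) ≡
    sumL (f ∘ (true ∷_) ∘ V.toList) vs + sumL (f ∘ (false ∷_) ∘ V.toList) vs
  split [] = refl
  split (v ∷ vs) = trans (cong (λ z → f (true ∷ V.toList v) + (f (false ∷ V.toList v) + z)) (split vs))
    (regroup (f (true ∷ V.toList v)) (f (false ∷ V.toList v)) _ _)

length-allVec : ∀ l → length (allVec l) ≡ 2 ^ l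
length-allVec l = begin
  length (allVec l)                ≡⟨ *-identityʳ _ ⟨
  length (allVec l) * 1            ≡⟨ sum-const 1 (allVec l) ⟨
  sumL (λ _ → 1) (allVec l)        ≡⟨ sum-allVec (λ _ → 1) l ⟩
  sumL (λ _ → 1) (words bools l)   ≡⟨ sum-const 1 (words bools l) ⟩
  length (words bools l) * 1       ≡⟨ *-identityʳ _ ⟩
  length (words bools l)           ≡⟨ length-words bools l ⟩
  2 ^ l ∎
  where open ≡-Reasoning

Edge : ℕ → Set
Edge n = Fin n × Fin n

listAdj : ∀ {n} → List (Edge n) → Graph n
listAdj [] u v = false
listAdj ((x , y) ∷ es) u v =
  ((⌊ x ≟F u ⌋ ∧ ⌊ y ≟F v ⌋) ∨ (⌊ x ≟F v ⌋ ∧ ⌊ y ≟F u ⌋)) ∨ listAdj es u v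

select : ∀ {n} → Bool → List (Edge n) → List Bool → List (Edge n)
select b [] _ = []
select b (e ∷ es) [] = []
select b (e ∷ es) (s ∷ ss) = if boolEq b s then e ∷ select b es ss else select b es ss

-- This is an equality of functions: protocols may only be compared on equal graphs, and edges of
-- the other side disappear from sideAdj by computation and η, so no extensionality is needed.
sideAdj≡listAdj : ∀ {n} b (es : List (Edge n)) σ → sideAdj b es σ ≡ listAdj (select b es (V.toList σ))
sideAdj≡listAdj b [] [] = η b
  where
  η : ∀ b → sideAdj b [] [] ≡ listAdj []
  η true = refl
  η false = refl
sideAdj≡listAdj true ((x , y) ∷ es) (true ∷ ss) =
  cong (λ g u v → ((⌊ x ≟F u ⌋ ∧ ⌊ y ≟F v ⌋) ∨ (⌊ x ≟F v ⌋ ∧ ⌊ y ≟F u ⌋)) ∨ g u v) (sideAdj≡listAdj true es ss)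
sideAdj≡listAdj true ((x , y) ∷ es) (false ∷ ss) = sideAdj≡listAdj true es ss
sideAdj≡listAdj false ((x , y) ∷ es) (true ∷ ss) = sideAdj≡listAdj false es ss
sideAdj≡listAdj false ((x , y) ∷ es) (false ∷ ss) =
  cong (λ g u v → ((⌊ x ≟F u ⌋ ∧ ⌊ y ≟F v ⌋) ∨ (⌊ x ≟F v ⌋ ∧ ⌊ y ≟F u ⌋)) ∨ g u v) (sideAdj≡listAdj false es ss)

run : ∀ {n r c} → Protocol n r c → List (Edge n) → List (Edge n) → Vec Bool r → Bool
run P la lb R = bob P (alice P (listAdj la) R) (listAdj lb) R

select-map : ∀ {n} b (κ : Edge n → Bool) es → select b es (map κ es) ≡ filterᵇ (boolEq b ∘ κ) es
select-map b κ [] = refl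
select-map b κ (e ∷ es) with boolEq b (κ e)
... | true = cong (e ∷_) (select-map b κ es)
... | false = select-map b κ es

filterᵇ-filterᵇ : (p p′ p″ : 𝔸 → Bool) → (∀ x → p x ∧ p′ x ≡ p″ x) → ∀ xs → filterᵇ p′ (filterᵇ p xs) ≡ filterᵇ p″ xs
filterᵇ-filterᵇ p p′ p″ e [] = refl
filterᵇ-filterᵇ p p′ p″ e (x ∷ xs) with p x | p′ x in eq | p″ x | e x
... | false | _ | false | _ = filterᵇ-filterᵇ p p′ p″ e xs
... | true | false | false | _ rewrite eq = filterᵇ-filterᵇ p p′ p″ e xs
... | true | true | true | _ rewrite eq = cong (x ∷_) (filterᵇ-filterᵇ p p′ p″ e xs)

filterᵇ-cong : {p p′ : 𝔸 → Bool} → (∀ x → p x ≡ p′ x) → ∀ xs → filterᵇ p xs ≡ filterᵇ p′ xs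
filterᵇ-cong e [] = refl
filterᵇ-cong {p = p} {p′} e (x ∷ xs) with p x | p′ x | e x
... | true | .true | refl = cong (x ∷_) (filterᵇ-cong e xs)
... | false | .false | refl = filterᵇ-cong e xs

-- Pointwise equal adjacencies produce the same list, and through `listAdj` the same function. This
-- is how two inputs are shown to be identical for a player.
ordered : ∀ {n} → (Fin n → Fin n → Bool) → List (Edge n)
ordered {n} G = filterᵇ (λ e → (toℕ (proj₁ e) <ᵇ toℕ (proj₂ e)) ∧ G (proj₁ e) (proj₂ e)) (allPairs n)

ordered-cong : ∀ {n} {G G′ : Fin n → Fin n → Bool} → (∀ u v → G u v ≡ G′ u v) → ordered G ≡ ordered G′
ordered-cong {n} e = filterᵇ-cong (λ p → cong (_ ∧_) (e (proj₁ p) (proj₂ p))) (allPairs n)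

Unique-allPairs : ∀ n → Unique (allPairs n)
Unique-allPairs n = subst Unique (sym (go (allFin n))) (Uniq.cartesianProduct⁺ (Uniq.allFin⁺ n) (Uniq.allFin⁺ n))
  where
  go : ∀ xs → concatMap (λ u → map (λ v → u , v) (allFin n)) xs ≡ cartesianProduct xs (allFin n)
  go [] = refl
  go (x ∷ xs) = cong (map (x ,_) (allFin n) ++_) (go xs)

-- Colouring a graph edge by edge is the same as colouring the sources of its edges.
average-over-sources : ∀ {n r c k} (P : Protocol n r c) → ErrorAtMostThird k P → ∀ t (G : Graph n) → IsNGC t n k G →
  (src : Edge n → Fin n) →
  (∀ u v u′ v′ → toℕ u < toℕ v → G u v ≡ true → toℕ u′ < toℕ v′ → G u′ v′ ≡ true →
    src (u , v) ≡ src (u′ , v′) → (u , v) ≡ (u′ , v′)) →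
  (view : Bool → Vec Bool n → Fin n → Fin n → Bool) →
  (∀ b c u v → G u v ∧ boolEq b (V.lookup c (src (u , v))) ≡ view b c u v) →
  2 * (2 ^ n * 2 ^ r) ≤
    3 * sumL (λ c → sumL (λ R → ind (boolEq t (run P (ordered (view true c)) (ordered (view false c)) R))) (allVec r)) (bvecs n)
average-over-sources {n} {r} P err t G ngc src src-inj view view≡ = *-cancelˡ-≤ (2 ^ l) {{m^n≢0 2 l}} (begin
    2 ^ l * (2 * (2 ^ n * 2 ^ r))       ≡⟨ regroup (2 ^ l) (2 ^ n) (2 ^ r) ⟩
    2 ^ n * (2 * (2 ^ l * 2 ^ r))       ≤⟨ *-monoʳ-≤ (2 ^ n) (err t G ngc) ⟩
    2 ^ n * (3 * successes P t G)       ≡⟨ cong (λ z → 2 ^ n * (3 * z)) successes≡ ⟩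
    2 ^ n * (3 * sumL f (words bools l))     ≡⟨ swap3 (2 ^ n) _ ⟩
    3 * (2 ^ n * sumL f (words bools l))     ≡⟨ cong (λ z → 3 * (2 ^ n * sumL f (words bools z))) (length-map src es) ⟨
    3 * (2 ^ n * sumL f (words bools (length is)))
      ≡⟨ cong (3 *_) (sum-marginal {n} f is unique-is) ⟨
    3 * (2 ^ length is * sumL (λ c → f (map (V.lookup c) is)) (bvecs n))
      ≡⟨ cong (λ z → 3 * (2 ^ z * sumL (λ c → f (map (V.lookup c) is)) (bvecs n))) (length-map src es) ⟩
    3 * (2 ^ l * sumL (λ c → f (map (V.lookup c) is)) (bvecs n))
      ≡⟨ swap3 (2 ^ l) _ ⟨
    2 ^ l * (3 * sumL (λ c → f (map (V.lookup c) is)) (bvecs n))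
      ≡⟨ cong (λ z → 2 ^ l * (3 * z)) (sum-cong (λ c → sum-cong (λ R → cong₂ (λ la lb → ind (boolEq t (run P la lb R)))
           (side≡ true c) (side≡ false c)) (allVec r)) (bvecs n)) ⟩
    2 ^ l * (3 * sumL (λ c → sumL (λ R → ind (boolEq t (run P (ordered (view true c)) (ordered (view false c)) R))) (allVec r)) (bvecs n)) ∎)
  where
  open ≤-Reasoning
  es = edgesOf G
  l = length es
  is = map src es
  regroup : ∀ a b c → a * (2 * (b * c)) ≡ b * (2 * (a * c))
  regroup = solve-∀
  swap3 : ∀ a b → a * (3 * b) ≡ 3 * (a * b)
  swap3 = solve-∀
  f : List Bool → ℕ
  f cs = sumL (λ R → ind (boolEq t (run P (select true es cs) (select false es cs) R))) (allVec r)
  successes≡ : successes P t G ≡ sumL f (words bools l)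
  successes≡ = trans (sum-cong (λ σ → trans (countL≡sum _ (allVec r))
      (sum-cong (λ R → cong₂ (λ a b → ind (boolEq t (bob P (alice P a R) b R)))
        (sideAdj≡listAdj true es σ) (sideAdj≡listAdj false es σ)) (allVec r))) (allVec l))
    (sum-allVec f l)
  edge-true : ∀ e → e ∈ es → toℕ (proj₁ e) < toℕ (proj₂ e) × G (proj₁ e) (proj₂ e) ≡ true
  edge-true e e∈ with ∈-filter⁻ (T? ∘ _) {xs = allPairs n} e∈
  ... | _ , ok with Equivalence.to T-∧ ok
  ... | lt , g = <ᵇ⇒< _ _ lt , Equivalence.to T-≡ g
  unique-is : Unique is
  unique-is = Unique-map-∈ (Uniq.filter⁺ (T? ∘ _) (Unique-allPairs n)) λ x y x∈ y∈ e →
    src-inj _ _ _ _ (proj₁ (edge-true x x∈)) (proj₂ (edge-true x x∈)) (proj₁ (edge-true y y∈)) (proj₂ (edge-true y y∈)) e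
  side≡ : ∀ b c → select b es (map (V.lookup c) is) ≡ ordered (view b c)
  side≡ b c = trans (cong (select b es) (sym (LP.map-∘ es)))
    (trans (select-map b (V.lookup c ∘ src) es)
      (filterᵇ-filterᵇ _ _ _ (λ e → trans (∧-assoc (toℕ (proj₁ e) <ᵇ toℕ (proj₂ e)) _ _)
        (cong (_ ∧_) (view≡ b c (proj₁ e) (proj₂ e)))) (allPairs n)))

-- The logarithmic hypothesis as an inequality between powers of two

-- scaledExp K m = 2ᵐ m! Σ_{j≤m} (K/2)ʲ/j!.  Half-integer steps make the difference quotient small
-- enough for each step of K to at most double it.
scaledExp : ℕ → ℕ → ℕ
scaledExp K zero = 1
scaledExp K (suc m) = 2 * suc m * scaledExp K m + K ^ suc m

-- A mean value estimate: the derivative of the power is increasing, so its value at the right end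
-- bounds the difference.
power-step : ∀ K m → suc K ^ suc m ≤ K ^ suc m + suc m * suc K ^ m
power-step K zero = ≤-reflexive (identity K)
  where
  identity : ∀ K → suc K * 1 ≡ K * 1 + 1
  identity = solve-∀
power-step K (suc m) = begin
  suc K * suc K ^ suc m                               ≤⟨ *-monoʳ-≤ (suc K) (power-step K m) ⟩
  suc K * (K ^ suc m + suc m * suc K ^ m)             ≡⟨ expand K (K ^ suc m) m (suc K ^ m) ⟩
  K * K ^ suc m + (K ^ suc m + suc m * (suc K * suc K ^ m))
    ≤⟨ +-monoʳ-≤ (K * K ^ suc m) (+-monoˡ-≤ _ (^-monoˡ-≤ (suc m) (n≤1+n K))) ⟩
  K ^ suc (suc m) + suc (suc m) * suc K ^ suc m       ∎
  where
  open ≤-Reasoning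
  expand : ∀ K a m b → suc K * (a + suc m * b) ≡ K * a + (a + suc m * (suc K * b))
  expand = solve-∀

-- A truncated exponential has as derivative its truncation one degree lower; `power-step` is summed
-- over the degrees.
scaledExp-step : ∀ K m → scaledExp (suc K) (suc m) ≤ scaledExp K (suc m) + suc m * scaledExp (suc K) m
scaledExp-step K zero = ≤-reflexive (identity K)
  where
  identity : ∀ K → 2 * 1 * 1 + suc K * 1 ≡ 2 * 1 * 1 + K * 1 + 1 * 1
  identity = solve-∀
scaledExp-step K (suc m) = begin
  2 * suc (suc m) * scaledExp (suc K) (suc m) + suc K ^ suc (suc m)
    ≤⟨ +-mono-≤ (*-monoʳ-≤ (2 * suc (suc m)) (scaledExp-step K m)) (power-step K (suc m)) ⟩
  2 * suc (suc m) * (scaledExp K (suc m) + suc m * scaledExp (suc K) m) + (K ^ suc (suc m) + suc (suc m) * suc K ^ suc m)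
    ≡⟨ regroup (suc (suc m)) (suc m) (scaledExp K (suc m)) (scaledExp (suc K) m) (K ^ suc (suc m)) (suc K ^ suc m) ⟩
  2 * suc (suc m) * scaledExp K (suc m) + K ^ suc (suc m) + suc (suc m) * (2 * suc m * scaledExp (suc K) m + suc K ^ suc m) ∎
  where
  open ≤-Reasoning
  regroup : ∀ a b h h′ x y → 2 * a * (h + b * h′) + (x + a * y) ≡ 2 * a * h + x + a * (2 * b * h′ + y)
  regroup = solve-∀

-- A step of one half in the argument adds at most half of the new value, which is absorbed on the
-- left.
scaledExp-double : ∀ K m → scaledExp (suc K) m ≤ 2 * scaledExp K m
scaledExp-double K zero = s≤s z≤n
scaledExp-double K (suc m) = +-cancelʳ-≤ (scaledExp (suc K) (suc m)) _ _ (begin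
  E + E                                          ≡⟨ double E ⟩
  2 * E                                          ≤⟨ *-monoʳ-≤ 2 (scaledExp-step K m) ⟩
  2 * (scaledExp K (suc m) + suc m * scaledExp (suc K) m)
    ≡⟨ regroup (scaledExp K (suc m)) (suc m) (scaledExp (suc K) m) ⟩
  2 * scaledExp K (suc m) + 2 * suc m * scaledExp (suc K) m
    ≤⟨ +-monoʳ-≤ (2 * scaledExp K (suc m)) (m≤m+n _ _) ⟩
  2 * scaledExp K (suc m) + E                    ∎)
  where
  open ≤-Reasoning
  E = scaledExp (suc K) (suc m)
  double : ∀ a → a + a ≡ 2 * a
  double = solve-∀
  regroup : ∀ a b c → 2 * (a + b * c) ≡ 2 * a + 2 * b * c
  regroup = solve-∀

scaledExp-bound : ∀ K m → scaledExp K m ≤ 2 ^ K * (2 ^ m * m !)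
scaledExp-bound zero m = ≤-reflexive (trans (at-zero m) (sym (+-identityʳ _)))
  where
  regroup : ∀ a b c → 2 * a * (b * c) + 0 ≡ 2 * b * (a * c)
  regroup = solve-∀
  at-zero : ∀ m → scaledExp 0 m ≡ 2 ^ m * m !
  at-zero zero = refl
  at-zero (suc m) = trans (cong (λ z → 2 * suc m * z + 0) (at-zero m)) (regroup (suc m) (2 ^ m) (m !))
scaledExp-bound (suc K) m = begin
  scaledExp (suc K) m              ≤⟨ scaledExp-double K m ⟩
  2 * scaledExp K m                ≤⟨ *-monoʳ-≤ 2 (scaledExp-bound K m) ⟩
  2 * (2 ^ K * (2 ^ m * m !))      ≡⟨ *-assoc 2 (2 ^ K) _ ⟨
  2 ^ suc K * (2 ^ m * m !)        ∎
  where open ≤-Reasoning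

scaledExp-even : ∀ k m → scaledExp (2 * k) m ≡ 2 ^ m * expNum k m
scaledExp-even k zero = refl
scaledExp-even k (suc m) = trans (cong₂ (λ a b → 2 * suc m * a + b) (scaledExp-even k m) (^-distribʳ-* (suc m) 2 k))
  (regroup (suc m) (2 ^ m) (expNum k m) (k ^ suc m))
  where
  regroup : ∀ a b c d → 2 * a * (b * c) + (2 * b) * d ≡ (2 * b) * (a * c + d)
  regroup = solve-∀

-- This is `e ^ k ≤ 4 ^ k` for every truncation of the series, obtained by doubling `2 * k` times.
expNum-bound : ∀ k m → expNum k m ≤ 2 ^ (2 * k) * m !
expNum-bound k m = *-cancelˡ-≤ (2 ^ m) {{m^n≢0 2 m}} (begin
  2 ^ m * expNum k m               ≡⟨ scaledExp-even k m ⟨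
  scaledExp (2 * k) m              ≤⟨ scaledExp-bound (2 * k) m ⟩
  2 ^ (2 * k) * (2 ^ m * m !)      ≡⟨ swap (2 ^ (2 * k)) (2 ^ m) (m !) ⟩
  2 ^ m * (2 ^ (2 * k) * m !)      ∎)
  where
  open ≤-Reasoning
  swap : ∀ a b c → a * (b * c) ≡ b * (a * c)
  swap = solve-∀

KgeLn⇒power : ∀ k n → KgeLn k n → n ^ 1600 ≤ 2 ^ (2 * k)
KgeLn⇒power k n (m , le) = *-cancelʳ-≤ (n ^ 1600) (2 ^ (2 * k)) (m !) {{m !≢0}} (≤-trans le (expNum-bound k m))

^-cancel-≤ : ∀ a b → 2 ^ a ≤ 2 ^ b → a ≤ b
^-cancel-≤ a b le = ≮⇒≥ (λ b<a → <⇒≱ (^-monoʳ-< 2 (s≤s (s≤s z≤n)) b<a) le)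

-- Comparing exponents in `2 ^ (1600 * ℓ) ≤ 4 ^ k` halves the constant 1600.
log-bound : ∀ k n ℓ → KgeLn k n → 2 ^ ℓ ≤ n → ℓ * 800 ≤ k
log-bound k n ℓ ge le = *-cancelʳ-≤ (ℓ * 800) k 2 (subst₂′ (sym (*-assoc ℓ 800 2)) (*-comm 2 k) (^-cancel-≤ (ℓ * 1600) (2 * k)
  (≤-trans (≤-reflexive (sym (^-*-assoc 2 ℓ 1600))) (≤-trans (^-monoˡ-≤ 1600 le) (KgeLn⇒power k n ge)))))
  where
  subst₂′ : ∀ {a b c d} → a ≡ c → b ≡ d → a ≤ b → c ≤ d
  subst₂′ refl refl le = le

m<2^m : ∀ m → m < 2 ^ m
m<2^m zero = s≤s z≤n
m<2^m (suc m) = begin-strict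
  suc m              <⟨ s≤s (m<2^m m) ⟩
  1 + 2 ^ m          ≤⟨ +-monoˡ-≤ (2 ^ m) (m^n>0 2 m) ⟩
  2 ^ m + 2 ^ m      ≡⟨ cong (2 ^ m +_) (+-identityʳ (2 ^ m)) ⟨
  2 ^ suc m          ∎
  where open ≤-Reasoning

binary-log : ∀ n → 1 ≤ n → ∃ λ ℓ → 2 ^ ℓ ≤ n × n < 2 ^ suc ℓ
binary-log n 1≤n = search n (m<2^m n)
  where
  search : ∀ b → n < 2 ^ b → ∃ λ ℓ → 2 ^ ℓ ≤ n × n < 2 ^ suc ℓ
  search zero lt = ⊥-elim (<⇒≱ lt 1≤n)
  search (suc b) lt with 2 ^ b ≤? n
  ... | yes le = b , le , lt
  ... | no ≰ = search b (≰⇒> ≰)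

m<[1+m/n]*n : ∀ m n .{{_ : NonZero n}} → m < suc (m / n) * n
m<[1+m/n]*n m n = begin-strict
  m                      ≡⟨ m≡m%n+[m/n]*n m n ⟩
  m % n + m / n * n      <⟨ +-monoˡ-< (m / n * n) (m%n<n m n) ⟩
  suc (m / n) * n        ∎
  where open ≤-Reasoning

-- Numerical parameters

-- 19200 bounds the ratio of n to half the number of good path blocks.

opaque

  κ₀ : ℕ
  κ₀ = 2 ^ 15

  19200≤κ₀ : 19200 ≤ κ₀
  19200≤κ₀ = ≤ᵇ⇒≤ 19200 (2 ^ 15) tt

  -- Forces `ℓ ≥ 40`. From there on `2 ^ ℓ` beats `ℓ * (4 * (κ₀ * κ₀)) = ℓ * 2 ^ 32`, the cost of
  -- rounding the order of the moment up.
  threshold : ℕ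
  threshold = 2 ^ 40

  1≤threshold : 1 ≤ threshold
  1≤threshold = m^n>0 2 40

  threshold-log : ∀ n ℓ → threshold ≤ n → n < 2 ^ suc ℓ → 40 ≤ ℓ
  threshold-log n ℓ le lt = ≤-pred (≮⇒≥ (λ sℓ<41 → <⇒≱ lt (≤-trans (^-monoʳ-≤ 2 (≤-pred sℓ<41)) le)))

  κ₀-log : ∀ ℓ → 40 ≤ ℓ → ℓ * (4 * (κ₀ * κ₀)) ≤ 2 ^ ℓ
  κ₀-log ℓ 40≤ℓ = subst (λ z → z * 2 ^ 32 ≤ 2 ^ z) (m∸n+n≡m 40≤ℓ) (begin
    (i + 40) * 2 ^ 32            ≤⟨ *-monoˡ-≤ (2 ^ 32) bound ⟩
    (2 ^ i * 2 ^ 8) * 2 ^ 32     ≡⟨ *-assoc (2 ^ i) (2 ^ 8) (2 ^ 32) ⟩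
    2 ^ i * 2 ^ 40               ≡⟨ ^-distribˡ-+-* 2 i 40 ⟨
    2 ^ (i + 40)                 ∎)
    where
    open ≤-Reasoning
    i : ℕ
    i = ℓ ∸ 40
    bound : i + 40 ≤ 2 ^ i * 2 ^ 8
    bound = begin
      i + 40                     ≤⟨ +-mono-≤ (<⇒≤ (m<2^m i)) (m≤n*m 40 (2 ^ i) {{m^n≢0 2 i}}) ⟩
      2 ^ i + 2 ^ i * 40         ≡⟨ *-suc (2 ^ i) 40 ⟨
      2 ^ i * 41                 ≤⟨ *-monoʳ-≤ (2 ^ i) (≤ᵇ⇒≤ 41 256 tt) ⟩
      2 ^ i * 2 ^ 8              ∎

  -- (128/127)⁸⁹ > 2
  gap : ∀ t → 2 ^ t * 127 ^ (89 * t) ≤ 128 ^ (89 * t)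
  gap t = begin
    2 ^ t * 127 ^ (89 * t)       ≡⟨ cong (2 ^ t *_) (^-*-assoc 127 89 t) ⟨
    2 ^ t * (127 ^ 89) ^ t       ≡⟨ ^-distribʳ-* t 2 (127 ^ 89) ⟨
    (2 * 127 ^ 89) ^ t           ≤⟨ ^-monoˡ-≤ t (≤ᵇ⇒≤ (2 * 127 ^ 89) (128 ^ 89) tt) ⟩
    (128 ^ 89) ^ t               ≡⟨ ^-*-assoc 128 89 t ⟩
    128 ^ (89 * t)               ∎
    where open ≤-Reasoning

-- By `gap`, `(127/128) ^ q ≤ 2 ^ (- 2s)` as soon as `q ≥ 89 * 2s`. One half of this exponent pays
-- for the Chernoff factor `2 ^ s`, the other for the union over `2M` pairs with a margin of 12.
few-poor-bound : ∀ M s q → 24 * M ≤ 2 ^ s → s * 178 ≤ q → 12 * ((M + M) * (2 ^ s * 127 ^ q)) ≤ 128 ^ q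
few-poor-bound M s q M≤ s≤ = begin
  12 * ((M + M) * (2 ^ s * 127 ^ q))             ≡⟨ regroup M (2 ^ s) (127 ^ q) ⟩
  (24 * M) * 2 ^ s * 127 ^ q                     ≤⟨ *-monoˡ-≤ (127 ^ q) (*-monoˡ-≤ (2 ^ s) M≤) ⟩
  2 ^ s * 2 ^ s * 127 ^ q                        ≡⟨ cong₂ _*_ (sym (^-distribˡ-+-* 2 s s)) (cong (127 ^_) (sym split)) ⟩
  2 ^ t * 127 ^ (89 * t + e)                     ≡⟨ cong (2 ^ t *_) (^-distribˡ-+-* 127 (89 * t) e) ⟩
  2 ^ t * (127 ^ (89 * t) * 127 ^ e)             ≡⟨ *-assoc (2 ^ t) (127 ^ (89 * t)) (127 ^ e) ⟨
  2 ^ t * 127 ^ (89 * t) * 127 ^ e               ≤⟨ *-mono-≤ (gap t) (^-monoˡ-≤ e (n≤1+n 127)) ⟩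
  128 ^ (89 * t) * 128 ^ e                       ≡⟨ ^-distribˡ-+-* 128 (89 * t) e ⟨
  128 ^ (89 * t + e)                             ≡⟨ cong (128 ^_) split ⟩
  128 ^ q                                        ∎
  where
  open ≤-Reasoning
  t = s + s
  double : ∀ s a → a * (s + s) ≡ s * (a * 2)
  double = solve-∀
  e = q ∸ 89 * t
  split : 89 * t + e ≡ q
  split = m+[n∸m]≡n (subst (_≤ q) (sym (double s 89)) s≤)
  regroup : ∀ m a b → 12 * ((m + m) * (a * b)) ≡ (24 * m) * a * b
  regroup = solve-∀

module Parameters (M k ℓ c : ℕ) (ℓ≥40 : 40 ≤ ℓ) (M≥1 : 1 ≤ M) (2^ℓ≤n : 2 ^ ℓ ≤ M * (4 * k)) (n<2^ℓ+1 : M * (4 * k) < 2 ^ suc ℓ)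
  (k≥ : ℓ * 800 ≤ k) (c< : 2 * (κ₀ * κ₀) * c < M * (4 * k)) where

  -- Every pair has q blocks, of which s are good; the moment of order 2 (h + 1) involves words of length L.
  n s q h L : ℕ
  n = M * (4 * k)
  s = k / 800
  q = k / 3
  instance
    2ℓ≢0 : NonZero (2 * ℓ)
    2ℓ≢0 = >-nonZero (≤-trans (s≤s z≤n) (≤-trans ℓ≥40 (m≤n*m ℓ 2)))
  h = c / (2 * ℓ)
  L = (suc h + suc h) * ℓ

  ℓ≤s : ℓ ≤ s
  ℓ≤s = subst (_≤ s) (m*n/n≡m ℓ 800) (/-monoˡ-≤ 800 k≥)

  s≥2 : 2 ≤ s
  s≥2 = ≤-trans (≤ᵇ⇒≤ 2 40 tt) (≤-trans ℓ≥40 ℓ≤s)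

  3q≤k : q * 3 ≤ k
  3q≤k = m/n*n≤m k 3

  800s≤k : s * 800 ≤ k
  800s≤k = m/n*n≤m k 800

  178s≤q : s * 178 ≤ q
  178s≤q = subst (_≤ q) (trans (cong (_/ 3) (sym (*-assoc s 178 3))) (m*n/n≡m (s * 178) 3))
    (/-monoˡ-≤ 3 (≤-trans (*-monoʳ-≤ s (≤ᵇ⇒≤ 534 800 tt)) 800s≤k))

  1≤q : 1 ≤ q
  1≤q = ≤-trans (≤-trans (s≤s z≤n) (*-mono-≤ s≥2 (≤ᵇ⇒≤ 1 178 tt))) 178s≤q

  24≤k : 24 ≤ k
  24≤k = ≤-trans (≤ᵇ⇒≤ 24 800 tt) (≤-trans (m≤n*m 800 ℓ {{>-nonZero (≤-trans (s≤s z≤n) ℓ≥40)}}) k≥)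

  3≤k : 3 ≤ k
  3≤k = ≤-trans (≤ᵇ⇒≤ 3 24 tt) 24≤k

  -- Bounds the number of hybrid steps, each of which loses a multiple of `2 ^ (- ℓ)`:
  -- `96 * M ≤ 4 * k * M = n < 2 * 2 ^ ℓ`.
  few-cycles : 48 * M ≤ 2 ^ ℓ
  few-cycles = *-cancelˡ-≤ 2 (begin
    2 * (48 * M)      ≡⟨ regroup M 2 48 ⟩
    M * (4 * 24)      ≤⟨ *-monoʳ-≤ M (*-monoʳ-≤ 4 24≤k) ⟩
    n                 ≤⟨ <⇒≤ n<2^ℓ+1 ⟩
    2 * 2 ^ ℓ         ∎)
    where
    open ≤-Reasoning
    regroup : ∀ m a b → a * (b * m) ≡ m * (a * b)
    regroup = solve-∀

  few-poor : 12 * ((M + M) * (2 ^ s * 127 ^ q)) ≤ 128 ^ q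
  few-poor = few-poor-bound M s q (≤-trans (*-monoˡ-≤ M (≤ᵇ⇒≤ 24 48 tt)) (≤-trans few-cycles (^-monoʳ-≤ 2 ℓ≤s))) 178s≤q

  -- The order of the moment is chosen for this: with at least one letter per message bit, the union
  -- over messages costs at most a factor 2 per letter.
  c<L : suc c ≤ L
  c<L = subst (suc c ≤_) (regroup h ℓ) (m<[1+m/n]*n c (2 * ℓ))
    where
    regroup : ∀ h ℓ → suc h * (2 * ℓ) ≡ (suc h + suc h) * ℓ
    regroup = solve-∀

  -- `L` consists of about `c` letters, controlled by `c<`, and of `2 * ℓ` letters due to rounding
  -- up, controlled by the threshold.
  L-small : L * (κ₀ * κ₀) ≤ n
  L-small = *-cancelˡ-≤ 2 (begin
    2 * (L * (κ₀ * κ₀))                          ≡⟨ regroup h ℓ (κ₀ * κ₀) ⟩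
    2 * (κ₀ * κ₀) * (h * (2 * ℓ)) + ℓ * (4 * (κ₀ * κ₀))
      ≤⟨ +-mono-≤ (≤-trans (*-monoʳ-≤ (2 * (κ₀ * κ₀)) (m/n*n≤m c (2 * ℓ))) (<⇒≤ c<)) (≤-trans (κ₀-log ℓ ℓ≥40) 2^ℓ≤n) ⟩
    n + n                                        ≡⟨ cong (n +_) (+-identityʳ n) ⟨
    2 * n                                        ∎)
    where
    open ≤-Reasoning
    regroup : ∀ h ℓ z → 2 * ((suc h + suc h) * ℓ * z) ≡ 2 * z * (h * (2 * ℓ)) + ℓ * (4 * z)
    regroup = solve-∀

  Q : ℕ
  Q = (M + M) * q

  4Q≤n : 4 * Q ≤ n
  4Q≤n = begin
    4 * ((M + M) * q)      ≡⟨ regroup M q ⟩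
    M * (4 * (q * 2))      ≤⟨ *-monoʳ-≤ M (*-monoʳ-≤ 4 (≤-trans (*-monoʳ-≤ q (n≤1+n 2)) 3q≤k)) ⟩
    n                      ∎
    where
    open ≤-Reasoning
    regroup : ∀ m q → 4 * ((m + m) * q) ≡ m * (4 * (q * 2))
    regroup = solve-∀

  module _ (w : ℕ) (w≥ : M * s ≤ w) where

    v : ℕ
    v = w / 2

    w≥2 : 2 ≤ w
    w≥2 = ≤-trans (*-mono-≤ M≥1 s≥2) w≥

    v≥1 : 1 ≤ v
    v≥1 = /-monoˡ-≤ 2 w≥2

    w≤3v : w ≤ v * 3
    w≤3v = begin
      w                ≤⟨ ≤-pred (m<[1+m/n]*n w 2) ⟩
      suc (v * 2)      ≤⟨ +-monoˡ-≤ (v * 2) v≥1 ⟩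
      v + v * 2        ≡⟨ *-suc v 2 ⟨
      v * 3            ∎
      where open ≤-Reasoning

    k≤1600s : k ≤ s * 1600
    k≤1600s = begin
      k                      ≤⟨ <⇒≤ (m<[1+m/n]*n k 800) ⟩
      suc s * 800            ≤⟨ *-monoˡ-≤ 800 (+-monoˡ-≤ s (≤-trans (s≤s z≤n) s≥2)) ⟩
      (s + s) * 800          ≡⟨ regroup s 800 ⟩
      s * 1600               ∎
      where
      open ≤-Reasoning
      regroup : ∀ s a → (s + s) * a ≡ s * (2 * a)
      regroup = solve-∀

    n≤κ₀v : n ≤ κ₀ * v
    n≤κ₀v = begin
      M * (4 * k)                ≤⟨ *-monoʳ-≤ M (*-monoʳ-≤ 4 k≤1600s) ⟩
      M * (4 * (s * 1600))       ≡⟨ regroup M s 4 1600 ⟩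
      (M * s) * 6400             ≤⟨ *-monoˡ-≤ 6400 (≤-trans w≥ w≤3v) ⟩
      (v * 3) * 6400             ≡⟨ *-assoc v 3 6400 ⟩
      v * 19200                  ≤⟨ *-monoʳ-≤ v 19200≤κ₀ ⟩
      v * κ₀                     ≡⟨ *-comm v κ₀ ⟩
      κ₀ * v                     ∎
      where
      open ≤-Reasoning
      regroup : ∀ m s a b → m * (a * (s * b)) ≡ (m * s) * (a * b)
      regroup = solve-∀

    κ₀≢0 : NonZero κ₀
    κ₀≢0 = >-nonZero (≤-trans (≤ᵇ⇒≤ 1 19200 tt) 19200≤κ₀)

    Lκ₀≤v : L * κ₀ ≤ v
    Lκ₀≤v = *-cancelˡ-≤ κ₀ {{κ₀≢0}} (begin
      κ₀ * (L * κ₀)      ≡⟨ regroup κ₀ L ⟩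
      L * (κ₀ * κ₀)      ≤⟨ L-small ⟩
      n                  ≤⟨ n≤κ₀v ⟩
      κ₀ * v             ∎)
      where
      open ≤-Reasoning
      regroup : ∀ a l → a * (l * a) ≡ l * (a * a)
      regroup = solve-∀

    -- The ratio `κ₀` of `n` to `v` is lost once for each factor of `v * v`; hence the `κ₀ * κ₀` in
    -- the final constant.
    4LQ≤v² : 4 * (L * Q) ≤ v * v
    4LQ≤v² = begin
      4 * (L * Q)      ≡⟨ regroup L Q ⟩
      L * (4 * Q)      ≤⟨ *-monoʳ-≤ L (≤-trans 4Q≤n n≤κ₀v) ⟩
      L * (κ₀ * v)     ≡⟨ *-assoc L κ₀ v ⟨
      L * κ₀ * v       ≤⟨ *-monoˡ-≤ v Lκ₀≤v ⟩
      v * v            ∎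
      where
      open ≤-Reasoning
      regroup : ∀ l q → 4 * (l * q) ≡ l * (4 * q)
      regroup = solve-∀

    j : ℕ
    j = suc h * ℓ

    L≡j+j : L ≡ j + j
    L≡j+j = *-distribʳ-+ ℓ (suc h) (suc h)

    -- At most `2 ^ L` messages and `(L * Q) ^ (L / 2)` even words: their product is the power
    -- `L / 2` of `4 * (L * Q)`, which `4LQ≤v²` bounds.
    messages-small : 2 ^ suc c * (2 ^ Q * ((j + j) * Q) ^ j) ≤ 2 ^ Q * (v ^ ℓ) ^ (suc h + suc h)
    messages-small = begin
      2 ^ suc c * (2 ^ Q * ((j + j) * Q) ^ j)       ≤⟨ *-monoˡ-≤ _ (^-monoʳ-≤ 2 (subst (suc c ≤_) L≡j+j c<L)) ⟩
      2 ^ (j + j) * (2 ^ Q * ((j + j) * Q) ^ j)     ≡⟨ cong (_* (2 ^ Q * ((j + j) * Q) ^ j)) four ⟩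
      4 ^ j * (2 ^ Q * ((j + j) * Q) ^ j)           ≡⟨ swap (4 ^ j) (2 ^ Q) _ ⟩
      2 ^ Q * (4 ^ j * ((j + j) * Q) ^ j)           ≡⟨ cong (2 ^ Q *_) (^-distribʳ-* j 4 ((j + j) * Q)) ⟨
      2 ^ Q * (4 * ((j + j) * Q)) ^ j               ≤⟨ *-monoʳ-≤ (2 ^ Q) (^-monoˡ-≤ j (subst (λ z → 4 * (z * Q) ≤ v * v) L≡j+j 4LQ≤v²)) ⟩
      2 ^ Q * (v * v) ^ j                           ≡⟨ cong (2 ^ Q *_) powers ⟩
      2 ^ Q * (v ^ ℓ) ^ (suc h + suc h)             ∎
      where
      open ≤-Reasoning
      swap : ∀ a b c → a * (b * c) ≡ b * (a * c)
      swap = solve-∀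
      four : 2 ^ (j + j) ≡ 4 ^ j
      four = trans (^-distribˡ-+-* 2 j j) (sym (^-distribʳ-* j 2 2))
      powers : (v * v) ^ j ≡ (v ^ ℓ) ^ (suc h + suc h)
      powers = trans (^-distribʳ-* j v v) (trans (sym (^-distribˡ-+-* v j j))
        (trans (cong (v ^_) (trans (sym L≡j+j) (*-comm (suc h + suc h) ℓ))) (sym (^-*-assoc v ℓ (suc h + suc h)))))

  -- The bias conceded to Bob. There are `w ^ ℓ` hidden words, so halving the base makes the
  -- relative bias at most `2 ^ (- ℓ)`.
  θ : ℕ → ℕ
  θ w = (w / 2) ^ ℓ

  θ≥1 : ∀ w → M * s ≤ w → 1 ≤ θ w
  θ≥1 w w≥ = m^n>0 (w / 2) {{>-nonZero (v≥1 w w≥)}} ℓ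

  θ≤ : ∀ w → 2 ^ ℓ * θ w ≤ w ^ ℓ
  θ≤ w = begin
    2 ^ ℓ * (w / 2) ^ ℓ      ≡⟨ ^-distribʳ-* ℓ 2 (w / 2) ⟨
    (2 * (w / 2)) ^ ℓ        ≡⟨ cong (_^ ℓ) (*-comm 2 (w / 2)) ⟩
    (w / 2 * 2) ^ ℓ          ≤⟨ ^-monoˡ-≤ ℓ (m/n*n≤m w 2) ⟩
    w ^ ℓ                    ∎
    where open ≤-Reasoning

-- Booleans and decisions

bool-ext : ∀ {a b} → (a ≡ true → b ≡ true) → (b ≡ true → a ≡ true) → a ≡ b
bool-ext {true} {b} f g = sym (f refl)
bool-ext {false} {true} f g = g refl
bool-ext {false} {false} f g = refl

∧-true : ∀ {a b} → a ∧ b ≡ true → a ≡ true × b ≡ true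
∧-true {true} {true} refl = refl , refl

∨-true : ∀ {a b} → a ∨ b ≡ true → a ≡ true ⊎ b ≡ true
∨-true {true} e = inj₁ refl
∨-true {false} e = inj₂ e

∨-introʳ : ∀ a {b} → b ≡ true → a ∨ b ≡ true
∨-introʳ true refl = refl
∨-introʳ false refl = refl

∨-introˡ : ∀ {a} b → a ≡ true → a ∨ b ≡ true
∨-introˡ b refl = refl

⌊⌋-true : {P : Set} (P? : Dec P) → P → ⌊ P? ⌋ ≡ true
⌊⌋-true (yes _) p = refl
⌊⌋-true (no ¬p) p = ⊥-elim (¬p p)

true-⌊⌋ : {P : Set} (P? : Dec P) → ⌊ P? ⌋ ≡ true → P
true-⌊⌋ (yes p) _ = p

⌊⌋-false : {P : Set} (P? : Dec P) → ¬ P → ⌊ P? ⌋ ≡ false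
⌊⌋-false (yes p) ¬p = ⊥-elim (¬p p)
⌊⌋-false (no _) ¬p = refl

xor-cancelʳ : ∀ a b → (a xor b) xor b ≡ a
xor-cancelʳ true true = refl
xor-cancelʳ true false = refl
xor-cancelʳ false true = refl
xor-cancelʳ false false = refl

-- The twist of a strand: bit b sits on the edge leaving level 3b + 1

twist : (ℕ → Bool) → ℕ → Bool
twist f 0 = false
twist f 1 = f 0
twist f 2 = false
twist f (suc (suc (suc i))) = twist (f ∘ suc) i

twist-cong : ∀ f g i → (∀ b → i ≡ suc (b * 3) → f b ≡ g b) → twist f i ≡ twist g i
twist-cong f g 0 e = refl
twist-cong f g 1 e = e 0 refl
twist-cong f g 2 e = refl
twist-cong f g (suc (suc (suc i))) e = twist-cong (f ∘ suc) (g ∘ suc) i (λ b eq → e (suc b) (cong (3 +_) eq))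

twist-mid : ∀ f b → twist f (suc (b * 3)) ≡ f b
twist-mid f zero = refl
twist-mid f (suc b) = twist-mid (f ∘ suc) b

prefix : (ℕ → Bool) → ℕ → Bool
prefix f zero = false
prefix f (suc i) = prefix f i xor twist f i

prefix-3+ : ∀ f i → prefix f (3 + i) ≡ f 0 xor prefix (f ∘ suc) i
prefix-3+ f zero = refl
prefix-3+ f (suc i) = trans (cong (_xor twist (f ∘ suc) i) (prefix-3+ f i)) (xor-assoc (f 0) _ _)

parityUpTo : (ℕ → Bool) → ℕ → Bool
parityUpTo f zero = false
parityUpTo f (suc q) = f 0 xor parityUpTo (f ∘ suc) q

prefix-zero : ∀ f i → (∀ b → f b ≡ false) → prefix f i ≡ false
prefix-zero f zero z = refl
prefix-zero f (suc i) z = cong₂ _xor_ (prefix-zero f i z) (vanish f i z)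
  where
  vanish : ∀ f i → (∀ b → f b ≡ false) → twist f i ≡ false
  vanish f 0 z = refl
  vanish f 1 z = z 0
  vanish f 2 z = refl
  vanish f (suc (suc (suc i))) z = vanish (f ∘ suc) i (z ∘ suc)

-- The blocks fill the first `q * 3` levels and the `e` levels left over carry no twist, so going
-- once around accumulates exactly the parity of the bits.
prefix-total : ∀ f q e → (∀ b → q ≤ b → f b ≡ false) → prefix f (q * 3 + e) ≡ parityUpTo f q
prefix-total f zero e z = prefix-zero f e (λ b → z b z≤n)
prefix-total f (suc q) e z = trans (prefix-3+ f (q * 3 + e))
  (cong (f 0 xor_) (prefix-total (f ∘ suc) q e (λ b le → z (suc b) (s≤s le))))

parity-tabulate : ∀ {A : Set} q (X : A → Bool) (h : Fin q → A) f → (∀ b → f (toℕ b) ≡ X (h b)) →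
  parity X (tabulate h) ≡ parityUpTo f q
parity-tabulate zero X h f e = refl
parity-tabulate (suc q) X h f e = cong₂ _xor_ (sym (e zero)) (parity-tabulate q X (h ∘ suc) (f ∘ suc) (e ∘ suc))

-- Arithmetic of the canonical adjacency

b2n : Bool → ℕ
b2n true = 1
b2n false = 0

≡ᵇ-true : ∀ {x y} → (x ≡ᵇ y) ≡ true → x ≡ y
≡ᵇ-true {x} {y} e = ≡ᵇ⇒≡ x y (Equivalence.from T-≡ e)

true-≡ᵇ : ∀ {x y} → x ≡ y → (x ≡ᵇ y) ≡ true
true-≡ᵇ {x} {y} e = Equivalence.to T-≡ (≡⇒≡ᵇ x y e)

<ᵇ-true : ∀ {x y} → x < y → (x <ᵇ y) ≡ true
<ᵇ-true lt = Equivalence.to T-≡ (<⇒<ᵇ lt)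

<ᵇ-false : ∀ {x y} → y ≤ x → (x <ᵇ y) ≡ false
<ᵇ-false {x} {y} le with x <ᵇ y in e
... | false = refl
... | true = ⊥-elim (<⇒≱ (<ᵇ⇒< x y (Equivalence.from T-≡ e)) le)

quotient-unique : ∀ i y d .{{_ : NonZero d}} → i < d → (i + y * d) / d ≡ y
quotient-unique i y d i<d = begin
  (i + y * d) / d       ≡⟨ +-distrib-/-∣ʳ i (n∣m*n y) ⟩
  i / d + y * d / d     ≡⟨ cong₂ _+_ (m<n⇒m/n≡0 i<d) (m*n/n≡m y d) ⟩
  y                     ∎
  where open ≡-Reasoning

remainder-unique : ∀ i y d .{{_ : NonZero d}} → i < d → (i + y * d) % d ≡ i
remainder-unique i y d i<d = trans ([m+kn]%n≡m%n i y d) (m<n⇒m%n≡m i<d)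

Succ : ℕ → ℕ → ℕ → Set
Succ L x y = (suc x ≡ y) ⊎ (suc x ≡ L × y ≡ 0)

succMod-true : ∀ L x y → succMod L x y ≡ true → Succ L x y
succMod-true L x y e with ∨-true {suc x ≡ᵇ y} e
... | inj₁ e₁ = inj₁ (≡ᵇ-true e₁)
... | inj₂ e₂ with ∧-true {suc x ≡ᵇ L} e₂
... | e₃ , e₄ = inj₂ (≡ᵇ-true e₃ , ≡ᵇ-true e₄)

true-succMod : ∀ L x y → Succ L x y → succMod L x y ≡ true
true-succMod L x y (inj₁ e) = ∨-introˡ _ (true-≡ᵇ e)
true-succMod L x y (inj₂ (e₁ , e₂)) = ∨-introʳ (suc x ≡ᵇ y) (cong₂ _∧_ (true-≡ᵇ e₁) (true-≡ᵇ e₂))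

-- `cycAdj` with quotients and remainders as variables, so that their values in strand coordinates
-- can be substituted.
cycBody : ℕ → ℕ → ℕ → ℕ → ℕ → Bool
cycBody L d e d′ e′ = (d ≡ᵇ d′) ∧ (succMod L e e′ ∨ succMod L e′ e)

pathBody : ℕ → ℕ → ℕ → ℕ → Bool
pathBody d e d′ e′ = (d ≡ᵇ d′) ∧ ((suc e ≡ᵇ e′) ∨ (suc e′ ≡ᵇ e))

cycBody-true : ∀ L d e d′ e′ → cycBody L d e d′ e′ ≡ true → (d ≡ d′ × Succ L e e′) ⊎ (d′ ≡ d × Succ L e′ e)
cycBody-true L d e d′ e′ eq with ∧-true {d ≡ᵇ d′} eq
... | e₁ , e₂ with ∨-true {succMod L e e′} e₂
... | inj₁ e₃ = inj₁ (≡ᵇ-true e₁ , succMod-true L e e′ e₃)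
... | inj₂ e₃ = inj₂ (sym (≡ᵇ-true e₁) , succMod-true L e′ e e₃)

true-cycBody : ∀ L d e d′ e′ → (d ≡ d′ × Succ L e e′) ⊎ (d′ ≡ d × Succ L e′ e) → cycBody L d e d′ e′ ≡ true
true-cycBody L d e d′ e′ (inj₁ (e₁ , e₂)) = cong₂ _∧_ (true-≡ᵇ e₁) (∨-introˡ _ (true-succMod L e e′ e₂))
true-cycBody L d e d′ e′ (inj₂ (e₁ , e₂)) = cong₂ _∧_ (true-≡ᵇ (sym e₁)) (∨-introʳ (succMod L e e′) (true-succMod L e′ e e₂))

pathBody-true : ∀ d e d′ e′ → pathBody d e d′ e′ ≡ true → (d ≡ d′ × suc e ≡ e′) ⊎ (d′ ≡ d × suc e′ ≡ e)
pathBody-true d e d′ e′ eq with ∧-true {d ≡ᵇ d′} eq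
... | e₁ , e₂ with ∨-true {suc e ≡ᵇ e′} e₂
... | inj₁ e₃ = inj₁ (≡ᵇ-true e₁ , ≡ᵇ-true e₃)
... | inj₂ e₃ = inj₂ (sym (≡ᵇ-true e₁) , ≡ᵇ-true e₃)

true-pathBody : ∀ d e d′ e′ → (d ≡ d′ × suc e ≡ e′) ⊎ (d′ ≡ d × suc e′ ≡ e) → pathBody d e d′ e′ ≡ true
true-pathBody d e d′ e′ (inj₁ (e₁ , e₂)) = cong₂ _∧_ (true-≡ᵇ e₁) (∨-introˡ _ (true-≡ᵇ e₂))
true-pathBody d e d′ e′ (inj₂ (e₁ , e₂)) = cong₂ _∧_ (true-≡ᵇ (sym e₁)) (∨-introʳ (suc e ≡ᵇ e′) (true-≡ᵇ e₂))

double-bit : ∀ p s p′ s′ → 2 * p + b2n s ≡ 2 * p′ + b2n s′ → p ≡ p′ × s ≡ s′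
double-bit p true p′ true e = *-cancelˡ-≡ p p′ 2 (+-cancelʳ-≡ 1 (2 * p) (2 * p′) e) , refl
double-bit p false p′ false e = *-cancelˡ-≡ p p′ 2 (+-cancelʳ-≡ 0 (2 * p) (2 * p′) e) , refl
double-bit p true p′ false e = ⊥-elim (even≢odd p′ p (trans (sym (+-identityʳ (2 * p′))) (trans (sym e) (+-comm (2 * p) 1))))
double-bit p false p′ true e = ⊥-elim (even≢odd p p′ (trans (sym (+-identityʳ (2 * p))) (trans e (+-comm (2 * p′) 1))))

-- Products of transpositions and the words they spell

transpose-cases : ∀ {m} (i j k : Fin m) →
  (transpose i j k ≡ k) ⊎ ((k ≡ i × transpose i j k ≡ j) ⊎ (k ≡ j × transpose i j k ≡ i))
transpose-cases i j k with k ≟F i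
... | yes e = inj₂ (inj₁ (e , refl))
... | no _ with k ≟F j
...   | yes e = inj₂ (inj₂ (e , refl))
...   | no _ = inj₁ refl

transpose-left : ∀ {m} (i j : Fin m) → transpose i j i ≡ j
transpose-left i j with i ≟F i
... | yes _ = refl
... | no i≢i = ⊥-elim (i≢i refl)

transpose-other : ∀ {m} (i j k : Fin m) → k ≢ i → k ≢ j → transpose i j k ≡ k
transpose-other i j k ki kj with k ≟F i
... | yes e = ⊥-elim (ki e)
... | no _ with k ≟F j
...   | yes e = ⊥-elim (kj e)
...   | no _ = refl

transpose-injective : ∀ {m} (i j : Fin m) {k l} → transpose i j k ≡ transpose i j l → k ≡ l
transpose-injective i j {k} {l} e = trans (sym (transpose-inverse j i)) (trans (cong (transpose j i) e) (transpose-inverse j i))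

module _ {m : ℕ} where

  -- The last pair of entries is exchanged first. Letters of the second list may repeat, in which
  -- case the transpositions do not commute and their order matters.
  swaps : List (Fin m) → List (Fin m) → Fin m → Fin m
  swaps (β ∷ C) (a ∷ as) x = transpose β a (swaps C as x)
  swaps _ _ x = x

  swaps⁻ : List (Fin m) → List (Fin m) → Fin m → Fin m
  swaps⁻ (β ∷ C) (a ∷ as) x = swaps⁻ C as (transpose a β x)
  swaps⁻ _ _ x = x

  swaps-swaps⁻ : ∀ C as x → swaps C as (swaps⁻ C as x) ≡ x
  swaps-swaps⁻ [] as x = refl
  swaps-swaps⁻ (β ∷ C) [] x = refl
  swaps-swaps⁻ (β ∷ C) (a ∷ as) x =
    trans (cong (transpose β a) (swaps-swaps⁻ C as (transpose a β x))) (transpose-inverse β a)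

  swaps⁻-swaps : ∀ C as x → swaps⁻ C as (swaps C as x) ≡ x
  swaps⁻-swaps [] as x = refl
  swaps⁻-swaps (β ∷ C) [] x = refl
  swaps⁻-swaps (β ∷ C) (a ∷ as) x =
    trans (cong (swaps⁻ C as) (transpose-inverse a β)) (swaps⁻-swaps C as x)

  swaps-cases : (S : Fin m → Set) → ∀ C as → All S C → All S as → ∀ x →
    (swaps C as x ≡ x) ⊎ (S x × S (swaps C as x))
  swaps-cases S [] as _ _ x = inj₁ refl
  swaps-cases S (β ∷ C) [] _ _ x = inj₁ refl
  swaps-cases S (β ∷ C) (a ∷ as) (sβ ∷ sC) (sa ∷ sas) x
    with swaps-cases S C as sC sas x | transpose-cases β a (swaps C as x)
  ... | inj₁ e | inj₁ e′ = inj₁ (trans e′ e)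
  ... | inj₁ e | inj₂ (inj₁ (e₁ , e₂)) = inj₂ (subst S (trans (sym e₁) e) sβ , subst S (sym e₂) sa)
  ... | inj₁ e | inj₂ (inj₂ (e₁ , e₂)) = inj₂ (subst S (trans (sym e₁) e) sa , subst S (sym e₂) sβ)
  ... | inj₂ (sx , sy) | inj₁ e′ = inj₂ (sx , subst S (sym e′) sy)
  ... | inj₂ (sx , sy) | inj₂ (inj₁ (e₁ , e₂)) = inj₂ (sx , subst S (sym e₂) sa)
  ... | inj₂ (sx , sy) | inj₂ (inj₂ (e₁ , e₂)) = inj₂ (sx , subst S (sym e₂) sβ)

  swaps⁻-cases : (S : Fin m → Set) → ∀ C as → All S C → All S as → ∀ x →
    (swaps⁻ C as x ≡ x) ⊎ (S x × S (swaps⁻ C as x))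
  swaps⁻-cases S C as sC sas x with swaps-cases S C as sC sas (swaps⁻ C as x)
  ... | inj₁ e = inj₁ (trans (sym e) (swaps-swaps⁻ C as x))
  ... | inj₂ (s₁ , s₂) = inj₂ (subst S (swaps-swaps⁻ C as x) s₂ , s₁)

  swaps-fix : ∀ C as x → x ∉ C → x ∉ as → swaps C as x ≡ x
  swaps-fix [] as x _ _ = refl
  swaps-fix (β ∷ C) [] x _ _ = refl
  swaps-fix (β ∷ C) (a ∷ as) x x∉ x∉′ =
    trans (cong (transpose β a) (swaps-fix C as x (x∉ ∘ there) (x∉′ ∘ there)))
      (transpose-other β a x (x∉ ∘ here) (x∉′ ∘ here))

  -- What is found at the places `C` after the exchange. For distinct letters outside `C` this is
  -- the second list itself; a repeated letter is deflected to an earlier place of `C`.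
  word : List (Fin m) → List (Fin m) → List (Fin m)
  word C as = map (swaps C as) C

  word-∷ : ∀ β C a as → β ∉ C → β ∉ as → word (β ∷ C) (a ∷ as) ≡ a ∷ map (transpose β a) (word C as)
  word-∷ β C a as β∉ β∉′ = cong₂ _∷_
    (trans (cong (transpose β a) (swaps-fix C as β β∉ β∉′)) (transpose-left β a))
    (LP.map-∘ C)

  map-injective : {f : Fin m → Fin m} → (∀ {x y} → f x ≡ f y → x ≡ y) → ∀ u v → map f u ≡ map f v → u ≡ v
  map-injective inj [] [] e = refl
  map-injective inj (x ∷ u) (y ∷ v) e with ∷-injective e
  ... | e₁ , e₂ = cong₂ _∷_ (inj e₁) (map-injective inj u v e₂)

  -- The head of the word is the first letter, since later exchanges leave `β` alone; undoing its
  -- transposition reduces to the tails. Thus repetitions are allowed, and all words over the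
  -- alphabet can serve as hidden words.
  word-injective : ∀ C as as′ → Unique C → length as ≡ length C → length as′ ≡ length C →
    (∀ x → x ∈ C → x ∉ as) → (∀ x → x ∈ C → x ∉ as′) → word C as ≡ word C as′ → as ≡ as′
  word-injective [] [] [] _ _ _ _ _ _ = refl
  word-injective (β ∷ C) (a ∷ as) (a′ ∷ as′) (β# ∷ u) l l′ d d′ e
    with ∷-injective (trans (sym (word-∷ β C a as β∉C (d β (here refl) ∘ there)))
      (trans e (word-∷ β C a′ as′ β∉C (d′ β (here refl) ∘ there))))
    where
    β∉C : β ∉ C
    β∉C β∈ = All.lookup β# β∈ refl
  ... | refl , e₂ = cong (a ∷_) (word-injective C as as′ u (suc-injective l) (suc-injective l′)
    (λ x x∈ → d x (there x∈) ∘ there) (λ x x∈ → d′ x (there x∈) ∘ there)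
    (map-injective (transpose-injective β a) (word C as) (word C as′) e₂))

-- Messages and parities along lists

messages : ℕ → List (List Bool)
messages zero = [] ∷ []
messages (suc c) = [] ∷ cartesianProductWith _∷_ bools (messages c)

∈-messages : ∀ c w → length w ≤ c → w ∈ messages c
∈-messages zero [] _ = here refl
∈-messages (suc c) [] _ = here refl
∈-messages (suc c) (b ∷ w) (s≤s le) = there (∈-cartesianProductWith⁺ _∷_ (∈-bools b) (∈-messages c w le))

length-messages : ∀ c → suc (length (messages c)) ≡ 2 ^ suc c
length-messages zero = refl
length-messages (suc c) = begin
  2 + length (cartesianProductWith _∷_ bools (messages c))  ≡⟨ cong (2 +_) (length-product _∷_ bools (messages c)) ⟩
  2 + 2 * length (messages c)                               ≡⟨ identity (length (messages c)) ⟩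
  2 * suc (length (messages c))                             ≡⟨ cong (2 *_) (length-messages c) ⟩
  2 ^ suc (suc c)                                           ∎
  where
  open ≡-Reasoning
  identity : ∀ l → 2 + 2 * l ≡ 2 * suc l
  identity = solve-∀

parity-xor : {A : Set} (f g : A → Bool) → ∀ w → parity (λ x → f x xor g x) w ≡ parity f w xor parity g w
parity-xor f g [] = refl
parity-xor f g (x ∷ w) = trans (cong ((f x xor g x) xor_) (parity-xor f g w)) (shuffle (f x) (g x) (parity f w) (parity g w))
  where
  shuffle : ∀ a b c d → (a xor b) xor (c xor d) ≡ (a xor c) xor (b xor d)
  shuffle true true true true = refl
  shuffle true true true false = refl
  shuffle true true false true = refl
  shuffle true true false false = refl
  shuffle true false true true = refl
  shuffle true false true false = refl
  shuffle true false false true = refl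
  shuffle true false false false = refl
  shuffle false true true true = refl
  shuffle false true true false = refl
  shuffle false true false true = refl
  shuffle false true false false = refl
  shuffle false false true true = refl
  shuffle false false true false = refl
  shuffle false false false true = refl
  shuffle false false false false = refl

parity-cong-∈ : {A : Set} {f g : A → Bool} → ∀ w → (∀ x → x ∈ w → f x ≡ g x) → parity f w ≡ parity g w
parity-cong-∈ [] e = refl
parity-cong-∈ (x ∷ w) e = cong₂ _xor_ (e x (here refl)) (parity-cong-∈ w (λ y y∈ → e y (there y∈)))

parity-map : {A B : Set} (f : B → Bool) (h : A → B) → ∀ w → parity f (map h w) ≡ parity (f ∘ h) w
parity-map f h [] = refl
parity-map f h (x ∷ w) = cong (f (h x) xor_) (parity-map f h w)

parity-++ : {A : Set} (f : A → Bool) → ∀ u w → parity f (u ++ w) ≡ parity f u xor parity f w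
parity-++ f [] w = refl
parity-++ f (x ∷ u) w = trans (cong (f x xor_) (parity-++ f u w)) (sym (xor-assoc (f x) _ _))

parity-filter : {A : Set} (f : A → Bool) (p : A → Bool) → ∀ w →
  parity f w ≡ parity f (filterᵇ p w) xor parity f (filterᵇ (not ∘ p) w)
parity-filter f p [] = refl
parity-filter f p (x ∷ w) with p x
... | true = trans (cong (f x xor_) (parity-filter f p w)) (sym (xor-assoc (f x) _ _))
... | false = trans (cong (f x xor_) (parity-filter f p w)) (swap (f x) (parity f (filterᵇ p w)) _)
  where
  swap : ∀ a b c → a xor (b xor c) ≡ b xor (a xor c)
  swap true true c = refl
  swap true false c = refl
  swap false b c = refl

∈-filterᵇ⁻ : {A : Set} (p : A → Bool) → ∀ {x} xs → x ∈ filterᵇ p xs → x ∈ xs × p x ≡ true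
∈-filterᵇ⁻ p xs x∈ with ∈-filter⁻ (T? ∘ p) {xs = xs} x∈
... | x∈′ , px = x∈′ , Equivalence.to T-≡ px

∈-take : {A : Set} → ∀ ℓ (xs : List A) {x} → x ∈ take ℓ xs → x ∈ xs
∈-take (suc ℓ) (y ∷ xs) (here e) = here e
∈-take (suc ℓ) (y ∷ xs) (there x∈) = there (∈-take ℓ xs x∈)

∈-drop : {A : Set} → ∀ ℓ (xs : List A) {x} → x ∈ drop ℓ xs → x ∈ xs
∈-drop zero xs x∈ = x∈
∈-drop (suc ℓ) (y ∷ xs) x∈ = there (∈-drop ℓ xs x∈)

take-drop-disjoint : {A : Set} → ∀ ℓ (xs : List A) {x} → Unique xs → x ∈ take ℓ xs → x ∉ drop ℓ xs
take-drop-disjoint (suc ℓ) (y ∷ xs) (y# ∷ u) (here refl) x∈ = All.lookup y# (∈-drop ℓ xs x∈) refl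
take-drop-disjoint (suc ℓ) (y ∷ xs) (y# ∷ u) (there x∈) x∈′ = take-drop-disjoint ℓ xs u x∈ x∈′

ind-∧ : ∀ a b → ind (a ∧ b) ≡ ind a * ind b
ind-∧ true true = refl
ind-∧ true false = refl
ind-∧ false b = refl

length-filterᵇ : {A : Set} (p : A → Bool) → ∀ xs → length (filterᵇ p xs) ≡ sumL (ind ∘ p) xs
length-filterᵇ p [] = refl
length-filterᵇ p (x ∷ xs) with p x
... | true = cong suc (length-filterᵇ p xs)
... | false = length-filterᵇ p xs

-- Twisted double covers

module Configurations (M k₁ q : ℕ) (3≤k : 3 ≤ suc k₁) (3q≤k : q * 3 ≤ suc k₁) (1≤q : 1 ≤ q) where

  k n Q : ℕ
  k = suc k₁
  n = M * (4 * k)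
  Q = (M + M) * q

  Strand : Set
  Strand = Fin (M + M)

  -- (p , s , i) is level i of strand s of pair p; the pairs p < M are cycles, the others paths.
  Vtx : Set
  Vtx = Strand × Bool × Fin k

  b2f : Bool → Fin 2
  b2f false = 0F
  b2f true = 1F

  f2b : Fin 2 → Bool
  f2b 0F = false
  f2b 1F = true

  f2b-b2f : ∀ s → f2b (b2f s) ≡ s
  f2b-b2f true = refl
  f2b-b2f false = refl

  b2f-f2b : ∀ s → b2f (f2b s) ≡ s
  b2f-f2b 0F = refl
  b2f-f2b 1F = refl

  size : (M + M) * 2 * k ≡ n
  size = identity M k
    where
    identity : ∀ m k → (m + m) * 2 * k ≡ m * (4 * k)
    identity = solve-∀

  opaque

    enc : Vtx → Fin n
    enc (p , s , i) = cast size (combine (combine p (b2f s)) i)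

    split : Fin ((M + M) * 2 * k) → Vtx
    split u = assemble (remQuot {(M + M) * 2} k u)
      where
      assemble : Fin ((M + M) * 2) × Fin k → Vtx
      assemble (x , i) = proj₁ (remQuot {M + M} 2 x) , f2b (proj₂ (remQuot {M + M} 2 x)) , i

    dec : Fin n → Vtx
    dec u = split (cast (sym size) u)

    dec-enc : ∀ v → dec (enc v) ≡ v
    dec-enc (p , s , i) = begin
      split (cast (sym size) (cast size y))
        ≡⟨ cong split (trans (cast-trans size (sym size) y) (cast-is-id _ y)) ⟩
      split y
        ≡⟨ cong (λ z → proj₁ (remQuot {M + M} 2 (proj₁ z)) , f2b (proj₂ (remQuot {M + M} 2 (proj₁ z))) , proj₂ z)
             (remQuot-combine {(M + M) * 2} {k} (combine p (b2f s)) i) ⟩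
      (proj₁ (remQuot {M + M} 2 (combine p (b2f s))) , f2b (proj₂ (remQuot {M + M} 2 (combine p (b2f s)))) , i)
        ≡⟨ cong (λ z → proj₁ z , f2b (proj₂ z) , i) (remQuot-combine {M + M} {2} p (b2f s)) ⟩
      (p , f2b (b2f s) , i)
        ≡⟨ cong (λ z → p , z , i) (f2b-b2f s) ⟩
      (p , s , i) ∎
      where
      open ≡-Reasoning
      y : Fin ((M + M) * 2 * k)
      y = combine (combine p (b2f s)) i

    enc-dec : ∀ u → enc (dec u) ≡ u
    enc-dec u = begin
      cast size (combine (combine (proj₁ ps) (b2f (f2b (proj₂ ps)))) (proj₂ xi))
        ≡⟨ cong (λ z → cast size (combine (combine (proj₁ ps) z) (proj₂ xi))) (b2f-f2b (proj₂ ps)) ⟩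
      cast size (combine (combine (proj₁ ps) (proj₂ ps)) (proj₂ xi))
        ≡⟨ cong (λ z → cast size (combine z (proj₂ xi))) (combine-remQuot {M + M} 2 (proj₁ xi)) ⟩
      cast size (combine (proj₁ xi) (proj₂ xi))
        ≡⟨ cong (cast size) (combine-remQuot {(M + M) * 2} k (cast (sym size) u)) ⟩
      cast size (cast (sym size) u)
        ≡⟨ trans (cast-trans (sym size) size u) (cast-is-id _ u) ⟩
      u ∎
      where
      open ≡-Reasoning
      xi : Fin ((M + M) * 2) × Fin k
      xi = remQuot {(M + M) * 2} k (cast (sym size) u)
      ps : Strand × Fin 2
      ps = remQuot {M + M} 2 (proj₁ xi)

    enc-injective : ∀ {v w} → enc v ≡ enc w → v ≡ w
    enc-injective {v} {w} e = trans (sym (dec-enc v)) (trans (cong dec e) (dec-enc w))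

    dec-injective : ∀ {u v} → dec u ≡ dec v → u ≡ v
    dec-injective {u} {v} e = trans (sym (enc-dec u)) (trans (cong enc e) (enc-dec v))

    toℕ-b2f : ∀ s → toℕ (b2f s) ≡ b2n s
    toℕ-b2f true = refl
    toℕ-b2f false = refl

    toℕ-enc : ∀ p s i → toℕ (enc (p , s , i)) ≡ toℕ i + (2 * toℕ p + b2n s) * k
    toℕ-enc p s i = begin
      toℕ (enc (p , s , i))                          ≡⟨ toℕ-cast size _ ⟩
      toℕ (combine (combine p (b2f s)) i)            ≡⟨ toℕ-combine (combine p (b2f s)) i ⟩
      k * toℕ (combine p (b2f s)) + toℕ i            ≡⟨ cong (λ z → k * z + toℕ i) (toℕ-combine p (b2f s)) ⟩
      k * (2 * toℕ p + toℕ (b2f s)) + toℕ i          ≡⟨ cong (λ z → k * (2 * toℕ p + z) + toℕ i) (toℕ-b2f s) ⟩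
      k * (2 * toℕ p + b2n s) + toℕ i                ≡⟨ +-comm _ (toℕ i) ⟩
      toℕ i + k * (2 * toℕ p + b2n s)                ≡⟨ cong (toℕ i +_) (*-comm k _) ⟩
      toℕ i + (2 * toℕ p + b2n s) * k                ∎
      where open ≡-Reasoning

  -- Blocks and their three levels

  row : Fin Q → Strand
  row β = proj₁ (remQuot {M + M} q β)

  col : Fin Q → Fin q
  col β = proj₂ (remQuot {M + M} q β)

  combine-row-col : ∀ β → combine (row β) (col β) ≡ β
  combine-row-col = combine-remQuot {M + M} q

  lev< : (b : Fin q) (j : Fin 3) → toℕ j + toℕ b * 3 < k
  lev< b j = begin-strict
    toℕ j + toℕ b * 3   <⟨ +-monoˡ-< (toℕ b * 3) (toℕ<n j) ⟩
    suc (toℕ b) * 3     ≤⟨ *-monoˡ-≤ 3 (toℕ<n b) ⟩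
    q * 3               ≤⟨ 3q≤k ⟩
    k                   ∎
    where open ≤-Reasoning

  lev : Fin q → Fin 3 → Fin k
  lev b j = fromℕ< (lev< b j)

  toℕ-lev : ∀ b j → toℕ (lev b j) ≡ toℕ j + toℕ b * 3
  toℕ-lev b j = toℕ-fromℕ< (lev< b j)

  lev-injective : ∀ {b j b′ j′} → lev b j ≡ lev b′ j′ → b ≡ b′ × j ≡ j′
  lev-injective {b} {j} {b′} {j′} e = toℕ-injective same-b , toℕ-injective same-j
    where
    open ≡-Reasoning
    same : toℕ j + toℕ b * 3 ≡ toℕ j′ + toℕ b′ * 3
    same = trans (sym (toℕ-lev b j)) (trans (cong toℕ e) (toℕ-lev b′ j′))
    mod3 : ∀ (j : Fin 3) b → (toℕ j + b * 3) % 3 ≡ toℕ j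
    mod3 j b = trans ([m+kn]%n≡m%n (toℕ j) b 3) (m<n⇒m%n≡m (toℕ<n j))
    same-j : toℕ j ≡ toℕ j′
    same-j = trans (sym (mod3 j (toℕ b))) (trans (cong (_% 3) same) (mod3 j′ (toℕ b′)))
    same-b : toℕ b ≡ toℕ b′
    same-b = *-cancelʳ-≡ (toℕ b) (toℕ b′) 3
      (+-cancelˡ-≡ (toℕ j) (toℕ b * 3) (toℕ b′ * 3) (trans same (cong (_+ toℕ b′ * 3) (sym same-j))))

  site : Fin Q → Fin 3 → Bool → Vtx
  site β j s = row β , s , lev (col β) j

  site-injective : ∀ {β j s β′ j′ s′} → site β j s ≡ site β′ j′ s′ → β ≡ β′ × j ≡ j′ × s ≡ s′
  site-injective {β} {j} {s} {β′} e with lev-injective (cong (proj₂ ∘ proj₂) e)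
  ... | eb , ej = trans (sym (combine-row-col β)) (trans (cong₂ combine (cong proj₁ e) eb) (combine-row-col β′))
    , ej , cong (proj₁ ∘ proj₂) e

  site-≡ : ∀ p s i b j → toℕ i ≡ toℕ j + toℕ b * 3 → (p , s , i) ≡ site (combine p b) j s
  site-≡ p s i b j e = trans (cong (λ z → p , s , z) (toℕ-injective (trans e (sym (toℕ-lev b j)))))
    (cong (λ z → proj₁ z , s , lev (proj₂ z) j) (sym (remQuot-combine {k = q} p b)))

  -- The nodes 3b + 1 and 3b + 2 of a block are movable.

  mid : Fin Q → Bool → Bool → Vtx
  mid β o s = site β (if o then 2F else 1F) s

  Mid : Vtx → Set
  Mid v = Σ (Fin Q × Bool × Bool) λ x → v ≡ mid (proj₁ x) (proj₁ (proj₂ x)) (proj₂ (proj₂ x))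

  opaque

    mid? : ∀ v → Dec (Mid v)
    mid? (p , s , i) with any? (λ b → toℕ i ≟ 1 + toℕ b * 3) | any? (λ b → toℕ i ≟ 2 + toℕ b * 3)
    ... | yes (b , e) | _ = yes ((combine p b , false , s) , site-≡ p s i b 1F e)
    ... | no _ | yes (b , e) = yes ((combine p b , true , s) , site-≡ p s i b 2F e)
    ... | no ne₁ | no ne₂ = no impossible
      where
      impossible : ¬ Mid (p , s , i)
      impossible ((β , false , s′) , e) = ne₁ (col β , trans (cong (toℕ ∘ proj₂ ∘ proj₂) e) (toℕ-lev (col β) 1F))
      impossible ((β , true , s′) , e) = ne₂ (col β , trans (cong (toℕ ∘ proj₂ ∘ proj₂) e) (toℕ-lev (col β) 2F))

  mid-injective : ∀ {β o s β′ o′ s′} → mid β o s ≡ mid β′ o′ s′ → β ≡ β′ × o ≡ o′ × s ≡ s′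
  mid-injective {o = o} {o′ = o′} e with site-injective e
  ... | eβ , ej , es = eβ , offset o o′ ej , es
    where
    offset : ∀ o o′ → (if o then 2F else 1F) ≡ (if o′ then 2F else 1F) → o ≡ o′
    offset true true _ = refl
    offset false false _ = refl
    offset true false ()
    offset false true ()

  opaque

    -- The two ends of a middle edge travel together and keep their strands; the first level of
    -- every block and all levels outside blocks stay in place.
    lift : (Fin Q → Fin Q) → Vtx → Vtx
    lift f v with mid? v
    ... | yes ((β , o , s) , _) = mid (f β) o s
    ... | no _ = v

    lift-mid : ∀ f β o s → lift f (mid β o s) ≡ mid (f β) o s
    lift-mid f β o s with mid? (mid β o s)
    ... | no ¬m = ⊥-elim (¬m ((β , o , s) , refl))
    ... | yes ((β′ , o′ , s′) , e) with mid-injective {β} {o} {s} {β′} {o′} {s′} e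
    ... | refl , refl , refl = refl

    lift-other : ∀ f v → ¬ Mid v → lift f v ≡ v
    lift-other f v ¬m with mid? v
    ... | yes m = ⊥-elim (¬m m)
    ... | no _ = refl

    lift-∘ : ∀ f g v → lift f (lift g v) ≡ lift (f ∘ g) v
    lift-∘ f g v with mid? v
    ... | yes ((β , o , s) , _) = lift-mid f (g β) o s
    ... | no ¬m = lift-other f v ¬m

    lift-cong : ∀ {f g} → (∀ β → f β ≡ g β) → ∀ v → lift f v ≡ lift g v
    lift-cong e v with mid? v
    ... | yes ((β , o , s) , _) = cong (λ z → mid z o s) (e β)
    ... | no _ = refl

    lift-id : ∀ f → (∀ β → f β ≡ β) → ∀ v → lift f v ≡ v
    lift-id f e v with mid? v
    ... | yes ((β , o , s) , eq) = trans (cong (λ z → mid z o s) (e β)) (sym eq)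
    ... | no _ = refl

    lift-inverse : ∀ f g → (∀ β → f (g β) ≡ β) → ∀ v → lift f (lift g v) ≡ v
    lift-inverse f g e v = trans (lift-∘ f g v) (lift-id (f ∘ g) e v)

  -- The oriented edges of the twisted strands

  rowBits : (Fin Q → Bool) → Strand → ℕ → Bool
  rowBits X p b with b <? q
  ... | yes b<q = X (combine p (fromℕ< b<q))
  ... | no _ = false

  Step : Strand → Fin k → Fin k → Set
  Step p i i′ = (suc (toℕ i) ≡ toℕ i′) ⊎ (suc (toℕ i) ≡ k × toℕ i′ ≡ 0 × toℕ p < M)

  -- Orienting edges by increasing level, with the closing edge on cycles, gives every vertex at
  -- most one outgoing edge. Hence an edge can be identified with its source.
  Next : (Fin Q → Bool) → Vtx → Vtx → Set
  Next X (p , s , i) (p′ , s′ , i′) = p′ ≡ p × s′ ≡ s xor twist (rowBits X p) (toℕ i) × Step p i i′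

  opaque

    Step? : ∀ p i i′ → Dec (Step p i i′)
    Step? p i i′ = (suc (toℕ i) ≟ toℕ i′) ⊎-dec ((suc (toℕ i) ≟ k) ×-dec (toℕ i′ ≟ 0) ×-dec (toℕ p <? M))

    Next? : ∀ X v w → Dec (Next X v w)
    Next? X (p , s , i) (p′ , s′ , i′) = (p′ ≟F p) ×-dec (s′ ≟B (s xor twist (rowBits X p) (toℕ i))) ×-dec Step? p i i′

  Step-functional : ∀ {p i j j′} → Step p i j → Step p i j′ → j ≡ j′
  Step-functional (inj₁ e) (inj₁ e′) = toℕ-injective (trans (sym e) e′)
  Step-functional {j = j} (inj₁ e) (inj₂ (e′ , _)) = ⊥-elim (<-irrefl (trans (sym e) e′) (toℕ<n j))
  Step-functional {j′ = j′} (inj₂ (e , _)) (inj₁ e′) = ⊥-elim (<-irrefl (trans (sym e′) e) (toℕ<n j′))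
  Step-functional (inj₂ (_ , e , _)) (inj₂ (_ , e′ , _)) = toℕ-injective (trans e (sym e′))

  Next-functional : ∀ {X v w w′} → Next X v w → Next X v w′ → w ≡ w′
  Next-functional (refl , refl , st) (refl , refl , st′) = cong (λ z → _ , _ , z) (Step-functional st st′)

  -- `3≤k` enters here: on two levels the closing edge would be the reverse of the first edge.
  Step-no-return : ∀ {p i j} → Step p i j → Step p j i → ⊥
  Step-no-return {i = i} {j} (inj₁ e) (inj₁ e′) = <-asym (≤-reflexive e) (≤-reflexive e′)
  Step-no-return {i = i} {j} (inj₁ e) (inj₂ (e′ , i0 , _)) =
    <-irrefl (trans (cong (2 +_) (sym i0)) (trans (cong suc e) e′)) 3≤k
  Step-no-return {i = i} {j} (inj₂ (e , j0 , _)) (inj₁ e′) =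
    <-irrefl (trans (cong (2 +_) (sym j0)) (trans (cong suc e′) e)) 3≤k
  Step-no-return {i = i} {j} (inj₂ (e , j0 , _)) (inj₂ (e′ , i0 , _)) =
    <-irrefl (trans (cong suc (sym i0)) e) (≤-trans (s≤s (s≤s z≤n)) 3≤k)

  Next-no-return : ∀ {X v w} → Next X v w → Next X w v → ⊥
  Next-no-return (refl , _ , st) (_ , _ , st′) = Step-no-return st st′

  rowBits-combine : ∀ X p (b : Fin q) → rowBits X p (toℕ b) ≡ X (combine p b)
  rowBits-combine X p b with toℕ b <? q
  ... | yes b<q = cong (X ∘ combine p) (toℕ-injective (toℕ-fromℕ< b<q))
  ... | no b≮q = ⊥-elim (b≮q (toℕ<n b))

  twist-at-mid : ∀ X β → twist (rowBits X (row β)) (toℕ (lev (col β) 1F)) ≡ X β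
  twist-at-mid X β = begin
    twist (rowBits X (row β)) (toℕ (lev (col β) 1F))   ≡⟨ cong (twist (rowBits X (row β))) (toℕ-lev (col β) 1F) ⟩
    twist (rowBits X (row β)) (suc (toℕ (col β) * 3))  ≡⟨ twist-mid (rowBits X (row β)) (toℕ (col β)) ⟩
    rowBits X (row β) (toℕ (col β))                    ≡⟨ rowBits-combine X (row β) (col β) ⟩
    X (combine (row β) (col β))                        ≡⟨ cong X (combine-row-col β) ⟩
    X β                                                ∎
    where open ≡-Reasoning

  Next-mid : ∀ X β s w → Next X (mid β false s) w → w ≡ mid β true (s xor X β)
  Next-mid X β s (p , s′ , i) nx = Next-functional {X} {mid β false s} {p , s′ , i} nx
    (refl , cong (s xor_) (sym (twist-at-mid X β)) , inj₁ (trans (cong suc (toℕ-lev (col β) 1F)) (sym (toℕ-lev (col β) 2F))))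

  mid-Next : ∀ X β s → Next X (mid β false s) (mid β true (s xor X β))
  mid-Next X β s =
    refl , cong (s xor_) (sym (twist-at-mid X β)) , inj₁ (trans (cong suc (toℕ-lev (col β) 1F)) (sym (toℕ-lev (col β) 2F)))

  into-mid : ∀ X v β o s → Next X v (mid β o s) → ∃ λ s′ → v ≡ site β (if o then 1F else 0F) s′
  into-mid X (p , s₀ , i) β o s (refl , _ , inj₁ e) = s₀ , cong (λ z → row β , s₀ , z)
    (toℕ-injective (trans (suc-injective (trans e (trans (toℕ-lev (col β) _) (shift o)))) (sym (toℕ-lev (col β) _))))
    where
    shift : ∀ o → toℕ (if o then 2F else 1F) + toℕ (col β) * 3 ≡ suc (toℕ {3} (if o then 1F else 0F) + toℕ (col β) * 3)
    shift true = refl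
    shift false = refl
  into-mid X (p , s₀ , i) β true s (refl , _ , inj₂ (_ , e , _)) with () ← trans (sym (toℕ-lev (col β) 2F)) e
  into-mid X (p , s₀ , i) β false s (refl , _ , inj₂ (_ , e , _)) with () ← trans (sym (toℕ-lev (col β) 1F)) e

  -- Of all bits, the edge leaving `v` involves at most the one of the block whose second level
  -- contains `v`.
  Next-local : ∀ X X′ v w → (∀ β s → v ≡ mid β false s → X β ≡ X′ β) → Next X v w → Next X′ v w
  Next-local X X′ (p , s , i) w e (ep , es , st) =
    ep , trans es (cong (s xor_) (twist-cong _ _ (toℕ i) same)) , st
    where
    same : ∀ b → toℕ i ≡ suc (b * 3) → rowBits X p b ≡ rowBits X′ p b
    same b eq with b <? q
    ... | no _ = refl
    ... | yes b<q = e _ s (site-≡ p s i (fromℕ< b<q) 1F (trans eq (cong (λ z → suc (z * 3)) (sym (toℕ-fromℕ< b<q)))))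

  -- What the two players see

  module View (c : Vtx → Bool) where

    -- Colours are those of outgoing edges: `false` on the first level gives Bob the edges entering
    -- the middle, `false` on the third level those leaving it, and the middle edges are Alice's.
    Good : Fin Q → Set
    Good β = ∀ s → c (site β 0F s) ≡ false × c (site β 1F s) ≡ true × c (site β 2F s) ≡ false

    Fixed : (Fin Q → Fin Q) → Set
    Fixed π = ∀ β → (π β ≡ β) ⊎ (Good β × Good (π β))

    module _ (π π⁻ : Fin Q → Fin Q) (ππ⁻ : ∀ β → π (π⁻ β) ≡ β) (fixed : Fixed π⁻) (X : Fin Q → Bool) where

      Moved : Vtx → Vtx → Set
      Moved v w = c (lift π⁻ v) ≡ true × Next (X ∘ π) (lift π⁻ v) (lift π⁻ w)

      move-inner : ∀ β s → c (mid β false s) ≡ true → Moved (mid β false s) (mid β true (s xor X β))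
      move-inner β s cv = trans (cong c (lift-mid π⁻ β false s)) (colour (fixed β)) ,
        subst (λ z → Next (X ∘ π) z (lift π⁻ (mid β true (s xor X β)))) (sym (lift-mid π⁻ β false s))
          (subst (Next (X ∘ π) (mid (π⁻ β) false s))
            (trans (cong (λ z → mid (π⁻ β) true (s xor X z)) (ππ⁻ β)) (sym (lift-mid π⁻ β true (s xor X β))))
            (mid-Next (X ∘ π) (π⁻ β) s))
        where
        colour : (π⁻ β ≡ β) ⊎ (Good β × Good (π⁻ β)) → c (mid (π⁻ β) false s) ≡ true
        colour (inj₁ e) = trans (cong (λ z → c (mid z false s)) e) cv
        colour (inj₂ (_ , g)) = proj₁ (proj₂ (g s))

      unmoved : ∀ v w → c v ≡ true → lift π⁻ v ≡ v → lift π⁻ w ≡ w →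
        (∀ β s → v ≢ mid β false s) → Next X v w → Moved v w
      unmoved v w cv ev ew ne nx = trans (cong c ev) cv ,
        subst (λ z → Next (X ∘ π) z (lift π⁻ w)) (sym ev) (subst (Next (X ∘ π) v) (sym ew)
          (Next-local X (X ∘ π) v w (λ β s e → ⊥-elim (ne β s e)) nx))

      -- An edge of Alice leaving the third level shows that the block is not good, so the
      -- permutation fixes it.
      move-outer : ∀ β s w → c (mid β true s) ≡ true → Next X (mid β true s) w → Moved (mid β true s) w
      move-outer β s w cv nx = go (fixed β)
        where
        not-mid : ¬ Mid w
        not-mid ((β′ , false , s′) , e) with into-mid X (mid β true s) β′ false s′ (subst (Next X (mid β true s)) e nx)
        ... | s″ , eq with () ← proj₁ (proj₂ (site-injective {β} {2F} {s} {β′} {0F} {s″} eq))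
        not-mid ((β′ , true , s′) , e) with into-mid X (mid β true s) β′ true s′ (subst (Next X (mid β true s)) e nx)
        ... | s″ , eq with () ← proj₁ (proj₂ (site-injective {β} {2F} {s} {β′} {1F} {s″} eq))
        inner≢ : ∀ β′ s′ → mid β true s ≢ mid β′ false s′
        inner≢ β′ s′ eq with () ← proj₁ (proj₂ (mid-injective {β} {true} {s} {β′} {false} {s′} eq))
        go : (π⁻ β ≡ β) ⊎ (Good β × Good (π⁻ β)) → Moved (mid β true s) w
        go (inj₁ e) = unmoved (mid β true s) w cv (trans (lift-mid π⁻ β true s) (cong (λ z → mid z true s) e))
          (lift-other π⁻ w not-mid) inner≢ nx
        go (inj₂ (g , _)) with () ← trans (sym cv) (proj₂ (proj₂ (g s)))

      move-other : ∀ v w → ¬ Mid v → c v ≡ true → Next X v w → Moved v w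
      move-other v w ¬m cv nx = unmoved v w cv (lift-other π⁻ v ¬m) (target (mid? w)) (λ β s e → ¬m ((β , false , s) , e)) nx
        where
        kept : ∀ β s → Next X v (mid β false s) → (π⁻ β ≡ β) ⊎ (Good β × Good (π⁻ β)) → π⁻ β ≡ β
        kept β s nx (inj₁ e) = e
        kept β s nx (inj₂ (g , _)) with into-mid X v β false s nx
        ... | s′ , e with () ← trans (sym cv) (trans (cong c e) (proj₁ (g s′)))
        target : Dec (Mid w) → lift π⁻ w ≡ w
        target (no ¬m′) = lift-other π⁻ w ¬m′
        target (yes ((β , true , s) , e)) with into-mid X v β true s (subst (Next X v) e nx)
        ... | s′ , e′ = ⊥-elim (¬m ((β , false , s′) , e′))
        target (yes ((β , false , s) , e)) = trans (cong (lift π⁻) e) (trans (lift-mid π⁻ β false s)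
          (trans (cong (λ z → mid z false s) (kept β s (subst (Next X v) e nx) (fixed β))) (sym e)))

      -- Alice only sees good blocks detached from the rest of the graph, so she cannot see where they are.
      Next-permute : ∀ v w → c v ≡ true → Next X v w → Moved v w
      Next-permute v w cv nx = go (mid? v)
        where
        go : Dec (Mid v) → Moved v w
        go (no ¬m) = move-other v w ¬m cv nx
        go (yes ((β , true , s) , e)) = subst (λ z → Moved z w) (sym e)
          (move-outer β s w (trans (cong c (sym e)) cv) (subst (λ z → Next X z w) e nx))
        go (yes ((β , false , s) , e)) = subst (λ z → Moved z w) (sym e)
          (subst (Moved (mid β false s)) (sym (Next-mid X β s w (subst (λ z → Next X z w) e nx)))
            (move-inner β s (trans (cong c (sym e)) cv)))

    -- Bob does not see the twists of good blocks.
    Next-retwist : ∀ X X′ → (∀ β → (X β ≡ X′ β) ⊎ Good β) → ∀ v w → c v ≡ false → Next X v w → Next X′ v w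
    Next-retwist X X′ same v w cv = Next-local X X′ v w (λ β s e → agree β s e (same β))
      where
      agree : ∀ β s → v ≡ mid β false s → (X β ≡ X′ β) ⊎ Good β → X β ≡ X′ β
      agree β s e (inj₁ eq) = eq
      agree β s e (inj₂ g) with () ← trans (sym cv) (trans (cong c e) (proj₁ (proj₂ (g s))))

    arcAt : Bool → (Fin Q → Bool) → Vtx → Vtx → Bool
    arcAt b X v w = boolEq b (c v) ∧ ⌊ Next? X v w ⌋

    arcAt-true : ∀ b X v w → c v ≡ b → Next X v w → arcAt b X v w ≡ true
    arcAt-true true X v w e nx = cong₂ _∧_ e (⌊⌋-true (Next? X v w) nx)
    arcAt-true false X v w e nx = cong₂ (λ a b → not a ∧ b) e (⌊⌋-true (Next? X v w) nx)

    true-arcAt : ∀ b X v w → arcAt b X v w ≡ true → c v ≡ b × Next X v w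
    true-arcAt b X v w e with ∧-true {boolEq b (c v)} e
    ... | e₁ , e₂ = colour b (c v) e₁ , true-⌊⌋ (Next? X v w) e₂
      where
      colour : ∀ b d → boolEq b d ≡ true → d ≡ b
      colour true true _ = refl
      colour false false _ = refl

    -- `u` is a name, `lift Λ (dec u)` the position it occupies. Colour and adjacency are read at
    -- positions, which keeps the colouring independent of the labelling.
    arc : Bool → (Fin Q → Fin Q) → (Fin Q → Bool) → Fin n → Fin n → Bool
    arc b Λ X u v = arcAt b X (lift Λ (dec u)) (lift Λ (dec v))

    view : Bool → (Fin Q → Fin Q) → (Fin Q → Bool) → Fin n → Fin n → Bool
    view b Λ X u v = arc b Λ X u v ∨ arc b Λ X v u

    arcAt-cong : ∀ b X X′ → (∀ β → X β ≡ X′ β) → ∀ v w → arcAt b X v w ≡ true → arcAt b X′ v w ≡ true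
    arcAt-cong b X X′ eX v w e with true-arcAt b X v w e
    ... | cv , nx = arcAt-true b X′ v w cv (Next-local X X′ v w (λ β _ _ → eX β) nx)

    arc-cong : ∀ b {Λ Λ′ X X′} → (∀ β → Λ β ≡ Λ′ β) → (∀ β → X β ≡ X′ β) → ∀ u v → arc b Λ X u v ≡ arc b Λ′ X′ u v
    arc-cong b {Λ} {Λ′} {X} {X′} eΛ eX u v = trans
      (cong₂ (arcAt b X) (lift-cong eΛ (dec u)) (lift-cong eΛ (dec v)))
      (bool-ext (arcAt-cong b X X′ eX _ _) (arcAt-cong b X′ X (λ β → sym (eX β)) _ _))

    view-cong : ∀ b {Λ Λ′ X X′} → (∀ β → Λ β ≡ Λ′ β) → (∀ β → X β ≡ X′ β) → ∀ u v → view b Λ X u v ≡ view b Λ′ X′ u v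
    view-cong b eΛ eX u v = cong₂ _∨_ (arc-cong b eΛ eX u v) (arc-cong b eΛ eX v u)

    module _ (π π⁻ : Fin Q → Fin Q) (ππ⁻ : ∀ β → π (π⁻ β) ≡ β) (π⁻π : ∀ β → π⁻ (π β) ≡ β)
      (fix : Fixed π) (fix⁻ : Fixed π⁻) where

      -- `Next-permute` for the permutation and for its inverse yields the two implications.
      arc-permute : ∀ Λ X u v → arc true (π⁻ ∘ Λ) (X ∘ π) u v ≡ arc true Λ X u v
      arc-permute Λ X u v = trans
        (cong₂ (arcAt true (X ∘ π)) (sym (lift-∘ π⁻ Λ (dec u))) (sym (lift-∘ π⁻ Λ (dec v))))
        (bool-ext forward backward)
        where
        v₀ = lift Λ (dec u)
        w₀ = lift Λ (dec v)
        forward : arcAt true (X ∘ π) (lift π⁻ v₀) (lift π⁻ w₀) ≡ true → arcAt true X v₀ w₀ ≡ true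
        forward e with true-arcAt true (X ∘ π) (lift π⁻ v₀) (lift π⁻ w₀) e
        ... | cv , nx with Next-permute π⁻ π π⁻π fix (X ∘ π) (lift π⁻ v₀) (lift π⁻ w₀) cv nx
        ... | f₁ , f₂ = subst (λ z → arcAt true X z w₀ ≡ true) (lift-inverse π π⁻ ππ⁻ v₀)
          (subst (λ z → arcAt true X (lift π (lift π⁻ v₀)) z ≡ true) (lift-inverse π π⁻ ππ⁻ w₀)
            (arcAt-true true X _ _ f₁ (Next-local (X ∘ π ∘ π⁻) X (lift π (lift π⁻ v₀)) (lift π (lift π⁻ w₀)) (λ β _ _ → cong X (ππ⁻ β)) f₂)))
        backward : arcAt true X v₀ w₀ ≡ true → arcAt true (X ∘ π) (lift π⁻ v₀) (lift π⁻ w₀) ≡ true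
        backward e with true-arcAt true X v₀ w₀ e
        ... | cv , nx with Next-permute π π⁻ ππ⁻ fix⁻ X v₀ w₀ cv nx
        ... | f₁ , f₂ = arcAt-true true (X ∘ π) _ _ f₁ f₂

      alice-permute : ∀ Λ X u v → view true (π⁻ ∘ Λ) (X ∘ π) u v ≡ view true Λ X u v
      alice-permute Λ X u v = cong₂ _∨_ (arc-permute Λ X u v) (arc-permute Λ X v u)

    arcAt-retwist : ∀ X X′ → (∀ β → (X β ≡ X′ β) ⊎ Good β) → ∀ v w → arcAt false X v w ≡ true → arcAt false X′ v w ≡ true
    arcAt-retwist X X′ same v w e with true-arcAt false X v w e
    ... | cv , nx = arcAt-true false X′ v w cv (Next-retwist X X′ same v w cv nx)

    bob-retwist : ∀ X X′ → (∀ β → (X β ≡ X′ β) ⊎ Good β) → ∀ Λ u v → view false Λ X u v ≡ view false Λ X′ u v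
    bob-retwist X X′ same Λ u v = cong₂ _∨_ (equal (lift Λ (dec u)) (lift Λ (dec v))) (equal (lift Λ (dec v)) (lift Λ (dec u)))
      where
      back : ∀ β → (X′ β ≡ X β) ⊎ Good β
      back β with same β
      ... | inj₁ e = inj₁ (sym e)
      ... | inj₂ g = inj₂ g
      equal : ∀ v w → arcAt false X v w ≡ arcAt false X′ v w
      equal v w = bool-ext (arcAt-retwist X X′ same v w) (arcAt-retwist X′ X back v w)

  -- Comparison with the canonical graphs

  Can : Bool → Vtx → Vtx → Set
  Can t (p , s , i) (p′ , s′ , i′) = p′ ≡ p ×
    ((suc (toℕ i) ≡ toℕ i′ × s′ ≡ s) ⊎ (suc (toℕ i) ≡ k × toℕ i′ ≡ 0 × toℕ p < M × s′ ≡ s xor t))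

  num : Vtx → ℕ
  num v = toℕ (enc v)

  strand : Vtx → ℕ
  strand (p , s , i) = 2 * toℕ p + b2n s

  pos : Vtx → ℕ
  pos (p , s , i) = toℕ i

  longPos : Vtx → ℕ
  longPos (p , s , i) = toℕ i + b2n s * k

  h : ℕ
  h = (2 * M) * k

  half : n / 2 ≡ h
  half = trans (cong (_/ 2) (identity M k)) (m*n/n≡m h 2)
    where
    identity : ∀ m k → m * (4 * k) ≡ ((2 * m) * k) * 2
    identity = solve-∀

  b2n≤1 : ∀ s → b2n s ≤ 1
  b2n≤1 true = ≤-refl
  b2n≤1 false = z≤n

  num-low : ∀ p s i → toℕ p < M → num (p , s , i) < h
  num-low p s i p<M = subst (_< h) (sym (toℕ-enc p s i)) (begin-strict
    toℕ i + (2 * toℕ p + b2n s) * k     <⟨ +-monoˡ-< _ (toℕ<n i) ⟩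
    suc (2 * toℕ p + b2n s) * k         ≤⟨ *-monoˡ-≤ k (s≤s (+-monoʳ-≤ (2 * toℕ p) (b2n≤1 s))) ⟩
    suc (2 * toℕ p + 1) * k             ≡⟨ cong (_* k) (identity (toℕ p)) ⟩
    2 * suc (toℕ p) * k                 ≤⟨ *-monoˡ-≤ k (*-monoʳ-≤ 2 p<M) ⟩
    h                                   ∎)
    where
    open ≤-Reasoning
    identity : ∀ p → suc (2 * p + 1) ≡ 2 * suc p
    identity = solve-∀

  num-high : ∀ p s i → M ≤ toℕ p → num (p , s , i) ≡ h + (toℕ i + (2 * (toℕ p ∸ M) + b2n s) * k)
  num-high p s i M≤p = begin
    num (p , s , i)                                       ≡⟨ toℕ-enc p s i ⟩
    toℕ i + (2 * toℕ p + b2n s) * k                       ≡⟨ cong (λ z → toℕ i + (2 * z + b2n s) * k) (m+[n∸m]≡n M≤p) ⟨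
    toℕ i + (2 * (M + (toℕ p ∸ M)) + b2n s) * k           ≡⟨ identity (toℕ i) M (toℕ p ∸ M) (b2n s) k ⟩
    h + (toℕ i + (2 * (toℕ p ∸ M) + b2n s) * k)           ∎
    where
    open ≡-Reasoning
    identity : ∀ i m d s k → i + (2 * (m + d) + s) * k ≡ (2 * m) * k + (i + (2 * d + s) * k)
    identity = solve-∀

  longPos< : ∀ v → longPos v < 2 * k
  longPos< (p , s , i) = begin-strict
    toℕ i + b2n s * k   <⟨ +-monoˡ-< _ (toℕ<n i) ⟩
    suc (b2n s) * k     ≤⟨ *-monoˡ-≤ k (s≤s (b2n≤1 s)) ⟩
    2 * k               ∎
    where open ≤-Reasoning

  num-long : ∀ v → num v ≡ longPos v + toℕ (proj₁ v) * (2 * k)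
  num-long (p , s , i) = trans (toℕ-enc p s i) (identity (toℕ i) (toℕ p) (b2n s) k)
    where
    identity : ∀ i p s k → i + (2 * p + s) * k ≡ (i + s * k) + p * (2 * k)
    identity = solve-∀

  divk : ∀ v → divP (num v) k ≡ strand v
  divk (p , s , i) = trans (cong (_/ k) (toℕ-enc p s i)) (quotient-unique (toℕ i) (2 * toℕ p + b2n s) k (toℕ<n i))

  modk : ∀ v → modP (num v) k ≡ pos v
  modk (p , s , i) = trans (cong (_% k) (toℕ-enc p s i)) (remainder-unique (toℕ i) (2 * toℕ p + b2n s) k (toℕ<n i))

  div2k : ∀ v → divP (num v) (2 * k) ≡ toℕ (proj₁ v)
  div2k v = trans (cong (_/ (2 * k)) (num-long v)) (quotient-unique (longPos v) (toℕ (proj₁ v)) (2 * k) (longPos< v))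

  mod2k : ∀ v → modP (num v) (2 * k) ≡ longPos v
  mod2k v = trans (cong (_% (2 * k)) (num-long v)) (remainder-unique (longPos v) (toℕ (proj₁ v)) (2 * k) (longPos< v))

  branch : Bool → Bool → Bool → Bool → Bool
  branch α β x y = if α ∧ β then x else (if not α ∧ not β then y else false)

  canon≡ : ∀ t v w → canon t n k (num v) (num w) ≡
    branch (num v <ᵇ h) (num w <ᵇ h) (cycAdj (if t then 2 * k else k) (num v) (num w)) (pathAdj k (num v ∸ h) (num w ∸ h))
  canon≡ t v w = cong (λ z → branch (num v <ᵇ z) (num w <ᵇ z) (cycAdj (if t then 2 * k else k) (num v) (num w))
    (pathAdj k (num v ∸ z) (num w ∸ z))) half

  short-iff-to : ∀ v w → toℕ (proj₁ v) < M → strand v ≡ strand w × Succ k (pos v) (pos w) → Can false v w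
  short-iff-to (p , s , i) (p′ , s′ , i′) p<M (e , st) with double-bit (toℕ p) s (toℕ p′) s′ e
  ... | ep , refl = toℕ-injective (sym ep) , go st
    where
    go : Succ k (toℕ i) (toℕ i′) → _
    go (inj₁ e) = inj₁ (e , refl)
    go (inj₂ (e₁ , e₂)) = inj₂ (e₁ , e₂ , p<M , sym (xor-identityʳ s))

  short-iff-from : ∀ v w → Can false v w → strand v ≡ strand w × Succ k (pos v) (pos w)
  short-iff-from (p , s , i) (p′ , s′ , i′) (refl , inj₁ (e , refl)) = refl , inj₁ e
  short-iff-from (p , s , i) (p′ , s′ , i′) (refl , inj₂ (e₁ , e₂ , _ , es)) =
    cong (λ z → 2 * toℕ p + b2n z) (sym (trans es (xor-identityʳ s))) , inj₂ (e₁ , e₂)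

  k+0 : 1 * k ≡ k
  k+0 = *-identityˡ k

  -- The two strands are the two halves of the long cycle. One closing step is its middle step, the
  -- other its wrap-around, and both change the strand.
  long-iff-to : ∀ v w → toℕ (proj₁ v) < M → toℕ (proj₁ v) ≡ toℕ (proj₁ w) × Succ (2 * k) (longPos v) (longPos w) → Can true v w
  long-iff-to (p , s , i) (p′ , s′ , i′) p<M (e , st) = toℕ-injective (sym e) , go s s′ st
    where
    drop0 : ∀ {x y} → suc (x + 0) ≡ y → suc x ≡ y
    drop0 {x} eq = trans (cong suc (sym (+-identityʳ x))) eq
    too-big : ∀ {x y} → suc (x + 1 * k) ≡ y → y < k → ⊥
    too-big {x} refl y<k = <⇒≱ y<k (≤-trans (≤-reflexive (sym k+0)) (m≤n⇒m≤1+n (m≤n+m (1 * k) x)))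
    nonzero : ∀ {x} → x + 1 * k ≡ 0 → ⊥
    nonzero {x} eq with () ← m+n≡0⇒n≡0 x eq
    go : ∀ s s′ → Succ (2 * k) (toℕ i + b2n s * k) (toℕ i′ + b2n s′ * k) →
      (suc (toℕ i) ≡ toℕ i′ × s′ ≡ s) ⊎ (suc (toℕ i) ≡ k × toℕ i′ ≡ 0 × toℕ p < M × s′ ≡ s xor true)
    go false false (inj₁ eq) = inj₁ (trans (drop0 eq) (+-identityʳ (toℕ i′)) , refl)
    go false false (inj₂ (eq , _)) = ⊥-elim (<-irrefl (drop0 eq) (≤-<-trans (toℕ<n i) (m<m+n k (subst (0 <_) (sym k+0) (s≤s z≤n)))))
    go true true (inj₁ eq) = inj₁ (+-cancelʳ-≡ (1 * k) (suc (toℕ i)) (toℕ i′) eq , refl)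
    go true true (inj₂ (_ , eq)) = ⊥-elim (nonzero {toℕ i′} eq)
    go false true (inj₁ eq) = inj₂ (trans (drop0 eq) (trans (cong (_+ 1 * k) i′≡0) k+0) , i′≡0 , p<M , refl)
      where
      i′≡0 : toℕ i′ ≡ 0
      i′≡0 = n≤0⇒n≡0 (+-cancelʳ-≤ k (toℕ i′) 0 (subst (_≤ k) (trans (drop0 eq) (cong (toℕ i′ +_) k+0)) (toℕ<n i)))
    go false true (inj₂ (_ , eq)) = ⊥-elim (nonzero {toℕ i′} eq)
    go true false (inj₁ eq) = ⊥-elim (too-big {toℕ i} (trans eq (+-identityʳ (toℕ i′))) (toℕ<n i′))
    go true false (inj₂ (eq , eq′)) =
      inj₂ (+-cancelʳ-≡ (1 * k) (suc (toℕ i)) k eq , trans (sym (+-identityʳ (toℕ i′))) eq′ , p<M , refl)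

  long-iff-from : ∀ v w → Can true v w → toℕ (proj₁ v) ≡ toℕ (proj₁ w) × Succ (2 * k) (longPos v) (longPos w)
  long-iff-from (p , s , i) (p′ , s′ , i′) (refl , inj₁ (e , refl)) = refl , inj₁ (cong (_+ b2n s * k) e)
  long-iff-from (p , false , i) (p′ , s′ , i′) (refl , inj₂ (e₁ , e₂ , _ , refl)) =
    refl , inj₁ (trans (cong suc (+-identityʳ (toℕ i))) (trans e₁ (trans (sym k+0) (cong (_+ 1 * k) (sym e₂)))))
  long-iff-from (p , true , i) (p′ , s′ , i′) (refl , inj₂ (e₁ , e₂ , _ , refl)) =
    refl , inj₂ (cong (_+ 1 * k) e₁ , trans (+-identityʳ (toℕ i′)) e₂)

  path-num : ∀ v → M ≤ toℕ (proj₁ v) → num v ∸ h ≡ pos v + (2 * (toℕ (proj₁ v) ∸ M) + b2n (proj₁ (proj₂ v))) * k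
  path-num (p , s , i) M≤p = trans (cong (_∸ h) (num-high p s i M≤p)) (m+n∸m≡n h _)

  pathStrand : Vtx → ℕ
  pathStrand (p , s , i) = 2 * (toℕ p ∸ M) + b2n s

  path-div : ∀ v → M ≤ toℕ (proj₁ v) → divP (num v ∸ h) k ≡ pathStrand v
  path-div v@(p , s , i) M≤p = trans (cong (_/ k) (path-num v M≤p)) (quotient-unique (toℕ i) (pathStrand v) k (toℕ<n i))

  path-mod : ∀ v → M ≤ toℕ (proj₁ v) → modP (num v ∸ h) k ≡ pos v
  path-mod v@(p , s , i) M≤p = trans (cong (_% k) (path-num v M≤p)) (remainder-unique (toℕ i) (pathStrand v) k (toℕ<n i))

  path-iff-to : ∀ t v w → M ≤ toℕ (proj₁ v) → M ≤ toℕ (proj₁ w) → pathStrand v ≡ pathStrand w × suc (pos v) ≡ pos w → Can t v w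
  path-iff-to t (p , s , i) (p′ , s′ , i′) M≤p M≤p′ (e , st) with double-bit (toℕ p ∸ M) s (toℕ p′ ∸ M) s′ e
  ... | ep , refl = toℕ-injective (trans (sym (m+[n∸m]≡n M≤p′)) (trans (cong (M +_) (sym ep)) (m+[n∸m]≡n M≤p))) , inj₁ (st , refl)

  path-iff-from : ∀ t v w → M ≤ toℕ (proj₁ v) → Can t v w → pathStrand v ≡ pathStrand w × suc (pos v) ≡ pos w
  path-iff-from t (p , s , i) (p′ , s′ , i′) M≤p (refl , inj₁ (e , refl)) = refl , e
  path-iff-from t (p , s , i) (p′ , s′ , i′) M≤p (refl , inj₂ (_ , _ , p<M , _)) = ⊥-elim (<⇒≱ p<M M≤p)

  ⊎-map : {A B C D : Set} → (A → C) → (B → D) → A ⊎ B → C ⊎ D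
  ⊎-map f g (inj₁ a) = inj₁ (f a)
  ⊎-map f g (inj₂ b) = inj₂ (g b)

  Can-row : ∀ t v w → Can t v w → proj₁ w ≡ proj₁ v
  Can-row t v w (e , _) = e

  row-of : ∀ t v w → Can t v w ⊎ Can t w v → proj₁ w ≡ proj₁ v
  row-of t v w (inj₁ c) = Can-row t v w c
  row-of t v w (inj₂ c) = sym (Can-row t w v c)

  Iff : Bool → Vtx → Vtx → Bool → Set
  Iff t v w x = (x ≡ true → Can t v w ⊎ Can t w v) × (Can t v w ⊎ Can t w v → x ≡ true)

  cyc-iff : ∀ t v w → toℕ (proj₁ v) < M → toℕ (proj₁ w) < M → Iff t v w (cycAdj (if t then 2 * k else k) (num v) (num w))
  cyc-iff false v w v< w< = subst (Iff false v w) (sym body)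
    ( (λ e → ⊎-map (short-iff-to v w v<) (short-iff-to w v w<) (cycBody-true k (strand v) (pos v) (strand w) (pos w) e))
    , (λ c → true-cycBody k (strand v) (pos v) (strand w) (pos w) (⊎-map (short-iff-from v w) (short-iff-from w v) c)))
    where
    body : cycAdj k (num v) (num w) ≡ cycBody k (strand v) (pos v) (strand w) (pos w)
    body = trans (cong₂ (λ d d′ → cycBody k d (modP (num v) k) d′ (modP (num w) k)) (divk v) (divk w))
      (cong₂ (λ e e′ → cycBody k (strand v) e (strand w) e′) (modk v) (modk w))
  cyc-iff true v w v< w< = subst (Iff true v w) (sym body)
    ( (λ e → ⊎-map (long-iff-to v w v<) (long-iff-to w v w<) (cycBody-true (2 * k) _ (longPos v) _ (longPos w) e))
    , (λ c → true-cycBody (2 * k) _ (longPos v) _ (longPos w) (⊎-map (long-iff-from v w) (long-iff-from w v) c)))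
    where
    body : cycAdj (2 * k) (num v) (num w) ≡ cycBody (2 * k) (toℕ (proj₁ v)) (longPos v) (toℕ (proj₁ w)) (longPos w)
    body = trans (cong₂ (λ d d′ → cycBody (2 * k) d (modP (num v) (2 * k)) d′ (modP (num w) (2 * k))) (div2k v) (div2k w))
      (cong₂ (λ e e′ → cycBody (2 * k) (toℕ (proj₁ v)) e (toℕ (proj₁ w)) e′) (mod2k v) (mod2k w))

  path-iff : ∀ t v w → M ≤ toℕ (proj₁ v) → M ≤ toℕ (proj₁ w) → Iff t v w (pathAdj k (num v ∸ h) (num w ∸ h))
  path-iff t v w v≥ w≥ = subst (Iff t v w) (sym body)
    ( (λ e → ⊎-map (path-iff-to t v w v≥ w≥) (path-iff-to t w v w≥ v≥) (pathBody-true (pathStrand v) (pos v) (pathStrand w) (pos w) e))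
    , (λ c → true-pathBody (pathStrand v) (pos v) (pathStrand w) (pos w) (⊎-map (path-iff-from t v w v≥) (path-iff-from t w v w≥) c)))
    where
    body : pathAdj k (num v ∸ h) (num w ∸ h) ≡ pathBody (pathStrand v) (pos v) (pathStrand w) (pos w)
    body = trans (cong₂ (λ d d′ → pathBody d (modP (num v ∸ h) k) d′ (modP (num w ∸ h) k)) (path-div v v≥) (path-div w w≥))
      (cong₂ (λ e e′ → pathBody (pathStrand v) e (pathStrand w) e′) (path-mod v v≥) (path-mod w w≥))

  low-bit : ∀ v → toℕ (proj₁ v) < M → (num v <ᵇ h) ≡ true
  low-bit (p , s , i) lt = <ᵇ-true (num-low p s i lt)

  high-bit : ∀ v → M ≤ toℕ (proj₁ v) → (num v <ᵇ h) ≡ false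
  high-bit (p , s , i) le = <ᵇ-false (subst (h ≤_) (sym (num-high p s i le)) (m≤m+n h _))

  canon-iff : ∀ t v w → Iff t v w (canon t n k (num v) (num w))
  canon-iff t v w = subst (Iff t v w) (sym (canon≡ t v w)) (go (toℕ (proj₁ v) <? M) (toℕ (proj₁ w) <? M))
    where
    x = cycAdj (if t then 2 * k else k) (num v) (num w)
    y = pathAdj k (num v ∸ h) (num w ∸ h)
    at : ∀ {α β} → (num v <ᵇ h) ≡ α → (num w <ᵇ h) ≡ β → Iff t v w (branch α β x y) → Iff t v w (branch (num v <ᵇ h) (num w <ᵇ h) x y)
    at refl refl iff = iff
    go : Dec (toℕ (proj₁ v) < M) → Dec (toℕ (proj₁ w) < M) → Iff t v w (branch (num v <ᵇ h) (num w <ᵇ h) x y)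
    go (yes v<) (yes w<) = at (low-bit v v<) (low-bit w w<) (cyc-iff t v w v< w<)
    go (no v≮) (no w≮) = at (high-bit v (≮⇒≥ v≮)) (high-bit w (≮⇒≥ w≮)) (path-iff t v w (≮⇒≥ v≮) (≮⇒≥ w≮))
    go (yes v<) (no w≮) = at (low-bit v v<) (high-bit w (≮⇒≥ w≮))
      ((λ ()) , λ c → ⊥-elim (w≮ (subst (λ z → toℕ z < M) (sym (row-of t v w c)) v<)))
    go (no v≮) (yes w<) = at (high-bit v (≮⇒≥ v≮)) (low-bit w w<)
      ((λ ()) , λ c → ⊥-elim (v≮ (subst (λ z → toℕ z < M) (row-of t v w c) w<)))

  rowParity : (Fin Q → Bool) → Strand → Bool
  rowParity X p = parity X (map (combine p) (allFin q))

  rowParity≡prefix : ∀ X p → rowParity X p ≡ prefix (rowBits X p) k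
  rowParity≡prefix X p = begin
    parity X (map (combine p) (allFin q))             ≡⟨ cong (parity X) (map-tabulate id (combine p)) ⟩
    parity X (tabulate (combine p))                   ≡⟨ parity-tabulate q X (combine p) (rowBits X p) (rowBits-combine X p) ⟩
    parityUpTo (rowBits X p) q                        ≡⟨ prefix-total (rowBits X p) q (k ∸ q * 3) beyond ⟨
    prefix (rowBits X p) (q * 3 + (k ∸ q * 3))        ≡⟨ cong (prefix (rowBits X p)) (m+[n∸m]≡n 3q≤k) ⟩
    prefix (rowBits X p) k                            ∎
    where
    open ≡-Reasoning
    beyond : ∀ b → q ≤ b → rowBits X p b ≡ false
    beyond b le with b <? q
    ... | yes b<q = ⊥-elim (<⇒≱ b<q le)
    ... | no _ = refl

  HasType : Bool → (Fin Q → Bool) → Set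
  HasType t X = ∀ p → toℕ p < M → rowParity X p ≡ t

  -- Gauge transformation: untwisting every level by the twists before it.
  φ : (Fin Q → Bool) → Vtx → Vtx
  φ X (p , s , i) = p , s xor prefix (rowBits X p) (toℕ i) , i

  φ-involutive : ∀ X v → φ X (φ X v) ≡ v
  φ-involutive X (p , s , i) = cong (λ z → p , z , i) (xor-cancelʳ s _)

  xor-injectiveʳ : ∀ {a b} c → a xor c ≡ b xor c → a ≡ b
  xor-injectiveʳ {a} {b} c e = trans (sym (xor-cancelʳ a c)) (trans (cong (_xor c) e) (xor-cancelʳ b c))

  -- Along a strand the gauge transformation accounts for each twist. The closing edge returns to
  -- level 0, where nothing is accumulated, so the total twist of the row must equal the strand
  -- change `t`; this is `HasType`.
  Can⇒Next : ∀ t X → HasType t X → ∀ v w → Can t v w → Next X (φ X v) (φ X w)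
  Can⇒Next t X ty (p , s , i) (p′ , s′ , i′) (refl , inj₁ (e , refl)) = refl ,
    trans (cong (λ z → s xor prefix (rowBits X p) z) (sym e)) (sym (xor-assoc s _ _)) , inj₁ e
  Can⇒Next t X ty (p , s , i) (p′ , s′ , i′) (refl , inj₂ (e₁ , e₂ , p<M , refl)) = refl , bits , inj₂ (e₁ , e₂ , p<M)
    where
    open ≡-Reasoning
    f = rowBits X p
    bits : (s xor t) xor prefix f (toℕ i′) ≡ (s xor prefix f (toℕ i)) xor twist f (toℕ i)
    bits = begin
      (s xor t) xor prefix f (toℕ i′)                     ≡⟨ cong (λ z → (s xor t) xor prefix f z) e₂ ⟩
      (s xor t) xor false                                 ≡⟨ xor-identityʳ (s xor t) ⟩
      s xor t                                             ≡⟨ cong (s xor_) (ty p p<M) ⟨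
      s xor rowParity X p                                 ≡⟨ cong (s xor_) (rowParity≡prefix X p) ⟩
      s xor prefix f k                                    ≡⟨ cong (λ z → s xor prefix f z) e₁ ⟨
      s xor (prefix f (toℕ i) xor twist f (toℕ i))        ≡⟨ xor-assoc s _ _ ⟨
      (s xor prefix f (toℕ i)) xor twist f (toℕ i)        ∎

  Next⇒Can : ∀ t X → HasType t X → ∀ v w → Next X (φ X v) (φ X w) → Can t v w
  Next⇒Can t X ty (p , s , i) (p′ , s′ , i′) (refl , es , inj₁ e) = refl , inj₁ (e ,
    xor-injectiveʳ (prefix (rowBits X p) (toℕ i′)) (trans es (trans (xor-assoc s _ _)
      (cong (λ z → s xor prefix (rowBits X p) z) e))))
  Next⇒Can t X ty (p , s , i) (p′ , s′ , i′) (refl , es , inj₂ (e₁ , e₂ , p<M)) = refl , inj₂ (e₁ , e₂ , p<M ,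
    xor-injectiveʳ (prefix f (toℕ i′)) (trans es (sym (proj₁ (proj₂
      (Can⇒Next t X ty (p , s , i) (p , s xor t , i′) (refl , inj₂ (e₁ , e₂ , p<M , refl))))))))
    where
    f = rowBits X p

  -- Twisted graphs as inputs, coloured at their sources

  colours : Vec Bool n → Vtx → Bool
  colours c v = V.lookup c (enc v)

  module _ (Λ Λ⁻ : Fin Q → Fin Q) (ΛΛ⁻ : ∀ β → Λ (Λ⁻ β) ≡ β) (Λ⁻Λ : ∀ β → Λ⁻ (Λ β) ≡ β)
    (X : Fin Q → Bool) (t : Bool) (ty : HasType t X) where

    at : Fin n → Vtx
    at u = lift Λ (dec u)

    -- Defined as a relabelled canonical graph, so that membership in the problem is immediate; `G≡`
    -- then recovers the twisted description.
    G : Graph n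
    G u v = canon t n k (num (φ X (at u))) (num (φ X (at v)))

    place : Fin n → Fin n
    place u = enc (lift Λ⁻ (φ X (dec u)))

    unplace : Fin n → Fin n
    unplace u = enc (φ X (at u))

    unplace-place : ∀ u → unplace (place u) ≡ u
    unplace-place u = begin
      enc (φ X (lift Λ (dec (enc (lift Λ⁻ (φ X (dec u)))))))  ≡⟨ cong (λ z → enc (φ X (lift Λ z))) (dec-enc (lift Λ⁻ (φ X (dec u)))) ⟩
      enc (φ X (lift Λ (lift Λ⁻ (φ X (dec u)))))              ≡⟨ cong (λ z → enc (φ X z)) (lift-inverse Λ Λ⁻ ΛΛ⁻ (φ X (dec u))) ⟩
      enc (φ X (φ X (dec u)))                                 ≡⟨ cong enc (φ-involutive X (dec u)) ⟩
      enc (dec u)                                             ≡⟨ enc-dec u ⟩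
      u                                                       ∎
      where open ≡-Reasoning

    place-unplace : ∀ u → place (unplace u) ≡ u
    place-unplace u = begin
      enc (lift Λ⁻ (φ X (dec (enc (φ X (at u))))))            ≡⟨ cong (λ z → enc (lift Λ⁻ (φ X z))) (dec-enc (φ X (at u))) ⟩
      enc (lift Λ⁻ (φ X (φ X (at u))))                        ≡⟨ cong (λ z → enc (lift Λ⁻ z)) (φ-involutive X (at u)) ⟩
      enc (lift Λ⁻ (lift Λ (dec u)))                          ≡⟨ cong enc (lift-inverse Λ⁻ Λ Λ⁻Λ (dec u)) ⟩
      enc (dec u)                                             ≡⟨ enc-dec u ⟩
      u                                                       ∎
      where open ≡-Reasoning

    isNGC : IsNGC t n k G
    isNGC = place ,
      ( (λ {u} {v} e → trans (sym (unplace-place u)) (trans (cong unplace e) (unplace-place v)))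
      , (λ v → unplace v , λ {u} e → trans (cong place e) (place-unplace v))) ,
      λ u v → cong₂ (λ a b → canon t n k (toℕ a) (toℕ b)) (unplace-place u) (unplace-place v)

    at-injective : ∀ {u v} → at u ≡ at v → u ≡ v
    at-injective {u} {v} e = dec-injective (trans (sym (lift-inverse Λ⁻ Λ Λ⁻Λ (dec u)))
      (trans (cong (lift Λ⁻) e) (lift-inverse Λ⁻ Λ Λ⁻Λ (dec v))))

    untwist : ∀ v w → Can t (φ X v) (φ X w) → Next X v w
    untwist v w c = subst (λ z → Next X z w) (φ-involutive X v)
      (subst (Next X (φ X (φ X v))) (φ-involutive X w) (Can⇒Next t X ty (φ X v) (φ X w) c))

    retwist : ∀ v w → Next X v w → Can t (φ X v) (φ X w)
    retwist v w nx = Next⇒Can t X ty (φ X v) (φ X w)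
      (subst (λ z → Next X z (φ X (φ X w))) (sym (φ-involutive X v)) (subst (Next X v) (sym (φ-involutive X w)) nx))

    G≡ : ∀ u v → G u v ≡ ⌊ Next? X (at u) (at v) ⌋ ∨ ⌊ Next? X (at v) (at u) ⌋
    G≡ u v = bool-ext forward backward
      where
      iff = canon-iff t (φ X (at u)) (φ X (at v))
      forward : G u v ≡ true → ⌊ Next? X (at u) (at v) ⌋ ∨ ⌊ Next? X (at v) (at u) ⌋ ≡ true
      forward e with proj₁ iff e
      ... | inj₁ c = ∨-introˡ _ (⌊⌋-true (Next? X (at u) (at v)) (untwist (at u) (at v) c))
      ... | inj₂ c = ∨-introʳ ⌊ Next? X (at u) (at v) ⌋ (⌊⌋-true (Next? X (at v) (at u)) (untwist (at v) (at u) c))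
      backward : ⌊ Next? X (at u) (at v) ⌋ ∨ ⌊ Next? X (at v) (at u) ⌋ ≡ true → G u v ≡ true
      backward e with ∨-true {⌊ Next? X (at u) (at v) ⌋} e
      ... | inj₁ e₁ = proj₂ iff (inj₁ (retwist (at u) (at v) (true-⌊⌋ (Next? X (at u) (at v)) e₁)))
      ... | inj₂ e₂ = proj₂ iff (inj₂ (retwist (at v) (at u) (true-⌊⌋ (Next? X (at v) (at u)) e₂)))

    pick : Bool → Vtx → Vtx → Vtx
    pick d v w = if d then v else w

    -- An unordered edge is listed with increasing names, which need not agree with its orientation;
    -- exactly one of its two orientations is a `Next` step.
    src : Edge n → Fin n
    src (u , v) = enc (pick ⌊ Next? X (at u) (at v) ⌋ (at u) (at v))

    Oriented : Fin n → Fin n → Set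
    Oriented u v = (src (u , v) ≡ enc (at u) × Next X (at u) (at v)) ⊎ (src (u , v) ≡ enc (at v) × Next X (at v) (at u))

    orient : ∀ u v → G u v ≡ true → Oriented u v
    orient u v e = go (Next? X (at u) (at v)) (Next? X (at v) (at u)) refl (trans (sym (G≡ u v)) e)
      where
      go : (d : Dec (Next X (at u) (at v))) (d′ : Dec (Next X (at v) (at u))) →
        ⌊ Next? X (at u) (at v) ⌋ ≡ ⌊ d ⌋ → ⌊ Next? X (at u) (at v) ⌋ ∨ ⌊ Next? X (at v) (at u) ⌋ ≡ true → Oriented u v
      go (yes nx) _ same _ = inj₁ (cong (λ b → enc (pick b (at u) (at v))) same , nx)
      go (no _) (yes nx) same _ = inj₂ (cong (λ b → enc (pick b (at u) (at v))) same , nx)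
      go (no ¬nx) (no ¬nx′) _ e with ∨-true {⌊ Next? X (at u) (at v) ⌋} e
      ... | inj₁ e₁ = ⊥-elim (¬nx (true-⌊⌋ (Next? X (at u) (at v)) e₁))
      ... | inj₂ e₂ = ⊥-elim (¬nx′ (true-⌊⌋ (Next? X (at v) (at u)) e₂))

    same-target : ∀ v {w w′ v′} → at v ≡ at v′ → Next X (at v) (at w) → Next X (at v′) (at w′) → w ≡ w′
    same-target v {w} {w′} e nx nx′ =
      at-injective (Next-functional {X} {at v} {at w} {at w′} nx (subst (λ z → Next X z (at w′)) (sym e) nx′))

    src-injective : ∀ u v u′ v′ → toℕ u < toℕ v → G u v ≡ true → toℕ u′ < toℕ v′ → G u′ v′ ≡ true →
      src (u , v) ≡ src (u′ , v′) → (u , v) ≡ (u′ , v′)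
    src-injective u v u′ v′ lt g lt′ g′ e = go (orient u v g) (orient u′ v′ g′)
      where
      crossed : u ≡ v′ → v ≡ u′ → ⊥
      crossed refl refl = <-asym lt lt′
      source : ∀ {x y} → src (u , v) ≡ enc x → src (u′ , v′) ≡ enc y → x ≡ y
      source s s′ = enc-injective (trans (sym s) (trans e s′))
      go : Oriented u v → Oriented u′ v′ → (u , v) ≡ (u′ , v′)
      go (inj₁ (s , nx)) (inj₁ (s′ , nx′)) = cong₂ _,_ (at-injective (source s s′)) (same-target u (source s s′) nx nx′)
      go (inj₂ (s , nx)) (inj₂ (s′ , nx′)) = cong₂ _,_ (same-target v (source s s′) nx nx′) (at-injective (source s s′))
      go (inj₁ (s , nx)) (inj₂ (s′ , nx′)) = ⊥-elim (crossed (at-injective (source s s′)) (same-target u (source s s′) nx nx′))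
      go (inj₂ (s , nx)) (inj₁ (s′ , nx′)) = ⊥-elim (crossed (same-target v (source s s′) nx nx′) (at-injective (source s s′)))

    view≡ : ∀ b c u v → G u v ∧ boolEq b (V.lookup c (src (u , v))) ≡ View.view (colours c) b Λ X u v
    view≡ b c u v = trans (cong (_∧ boolEq b (V.lookup c (src (u , v)))) (G≡ u v))
      (go (Next? X (at u) (at v)) (Next? X (at v) (at u)))
      where
      go : (d : Dec (Next X (at u) (at v))) (d′ : Dec (Next X (at v) (at u))) →
        (⌊ d ⌋ ∨ ⌊ d′ ⌋) ∧ boolEq b (V.lookup c (enc (pick ⌊ d ⌋ (at u) (at v)))) ≡
        (boolEq b (colours c (at u)) ∧ ⌊ d ⌋) ∨ (boolEq b (colours c (at v)) ∧ ⌊ d′ ⌋)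
      go (yes nx) (yes nx′) = ⊥-elim (Next-no-return {X} {at u} {at v} nx nx′)
      go (yes _) (no _) = only-left (boolEq b (colours c (at u))) (boolEq b (colours c (at v)))
        where
        only-left : ∀ x y → x ≡ (x ∧ true) ∨ (y ∧ false)
        only-left true y = refl
        only-left false true = refl
        only-left false false = refl
      go (no _) (yes _) = only-right (boolEq b (colours c (at u))) (boolEq b (colours c (at v)))
        where
        only-right : ∀ x y → y ≡ (x ∧ false) ∨ (y ∧ true)
        only-right true true = refl
        only-right true false = refl
        only-right false true = refl
        only-right false false = refl
      go (no _) (no _) = neither (boolEq b (colours c (at u))) (boolEq b (colours c (at v)))
        where
        neither : ∀ x y → false ≡ (x ∧ false) ∨ (y ∧ false)
        neither true true = refl
        neither true false = refl
        neither false true = refl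
        neither false false = refl

    success-on-configuration : ∀ {r c} (P : Protocol n r c) → ErrorAtMostThird k P →
      2 * (2 ^ n * 2 ^ r) ≤ 3 * sumL (λ c → sumL (λ R → ind (boolEq t
        (run P (ordered (View.view (colours c) true Λ X)) (ordered (View.view (colours c) false Λ X)) R))) (allVec r)) (bvecs n)
    success-on-configuration P err =
      average-over-sources {k = k} P err t G isNGC src src-injective (λ b c → View.view (colours c) b Λ X) view≡

  -- (Λ , Λ⁻): the movable nodes named β are placed in block Λ β, and Λ⁻ is the inverse of Λ.
  Labelling : Set
  Labelling = Vec (Fin Q) Q × Vec (Fin Q) Q

  Inverse : Labelling → Set
  Inverse (Λ , Λ⁻) = (∀ β → V.lookup Λ (V.lookup Λ⁻ β) ≡ β) × (∀ β → V.lookup Λ⁻ (V.lookup Λ β) ≡ β)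

  inverse? : ∀ g → Dec (Inverse g)
  inverse? (Λ , Λ⁻) = all? (λ β → V.lookup Λ (V.lookup Λ⁻ β) ≟F β) ×-dec all? (λ β → V.lookup Λ⁻ (V.lookup Λ β) ≟F β)

  vectors : List (Vec (Fin Q) Q)
  vectors = vecs (allFin Q) Q

  -- Carrying the inverse along makes bijectivity decidable by inspection; the inverse is determined
  -- by the first component, so no labelling is counted twice.
  labellings : List Labelling
  labellings = filter inverse? (cartesianProduct vectors vectors)

  Unique-labellings : Unique labellings
  Unique-labellings = Uniq.filter⁺ inverse? (Uniq.cartesianProduct⁺ u u)
    where u = Unique-vecs (Uniq.allFin⁺ Q) Q

  ∈-labellings : ∀ g → Inverse g → g ∈ labellings
  ∈-labellings (Λ , Λ⁻) inv = ∈-filter⁺ inverse? (∈-cartesianProduct⁺ (∈-vecs ∈-allFin Λ) (∈-vecs ∈-allFin Λ⁻)) inv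

  labellings-inverse : ∀ g → g ∈ labellings → Inverse g
  labellings-inverse g g∈ = proj₂ (∈-filter⁻ inverse? {xs = cartesianProduct vectors vectors} g∈)

  total : (Labelling → Vec Bool Q → ℕ) → ℕ
  total F = sumL (λ g → sumL (F g) (bvecs Q)) labellings

  total-cong : ∀ {F F′} → (∀ g X → F g X ≡ F′ g X) → total F ≡ total F′
  total-cong e = sum-cong (λ g → sum-cong (e g) (bvecs Q)) labellings

  moveL : (π π⁻ : Fin Q → Fin Q) → Labelling → Labelling
  moveL π π⁻ (Λ , Λ⁻) = V.tabulate (π⁻ ∘ V.lookup Λ) , V.tabulate (V.lookup Λ⁻ ∘ π)

  moveX : (π : Fin Q → Fin Q) → Vec Bool Q → Vec Bool Q
  moveX π X = V.tabulate (V.lookup X ∘ π)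

  twistX : (Fin Q → Bool) → Vec Bool Q → Vec Bool Q
  twistX f X = V.tabulate (λ β → V.lookup X β xor f β)

  moveL-inverse : ∀ π π⁻ → (∀ β → π (π⁻ β) ≡ β) → ∀ g → moveL π⁻ π (moveL π π⁻ g) ≡ g
  moveL-inverse π π⁻ e (Λ , Λ⁻) = cong₂ _,_
    (lookup-ext _ _ (λ β → trans (VP.lookup∘tabulate _ β) (trans (cong π (VP.lookup∘tabulate _ β)) (e _))))
    (lookup-ext _ _ (λ β → trans (VP.lookup∘tabulate _ β) (trans (VP.lookup∘tabulate _ (π⁻ β)) (cong (V.lookup Λ⁻) (e β)))))

  moveX-inverse : ∀ π π⁻ → (∀ β → π (π⁻ β) ≡ β) → ∀ X → moveX π⁻ (moveX π X) ≡ X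
  moveX-inverse π π⁻ e X = lookup-ext _ _ (λ β →
    trans (VP.lookup∘tabulate _ β) (trans (VP.lookup∘tabulate _ (π⁻ β)) (cong (V.lookup X) (e β))))

  moveL-Inverse : ∀ π π⁻ → (∀ β → π (π⁻ β) ≡ β) → (∀ β → π⁻ (π β) ≡ β) → ∀ g → Inverse g → Inverse (moveL π π⁻ g)
  moveL-Inverse π π⁻ e e′ (Λ , Λ⁻) (i , i⁻) =
    (λ β → trans (VP.lookup∘tabulate _ (V.lookup (V.tabulate (V.lookup Λ⁻ ∘ π)) β))
      (trans (cong (π⁻ ∘ V.lookup Λ) (VP.lookup∘tabulate _ β)) (trans (cong π⁻ (i (π β))) (e′ β)))) ,
    (λ β → trans (VP.lookup∘tabulate _ (V.lookup (V.tabulate (π⁻ ∘ V.lookup Λ)) β))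
      (trans (cong (V.lookup Λ⁻ ∘ π) (VP.lookup∘tabulate _ β)) (trans (cong (V.lookup Λ⁻) (e _)) (i⁻ β))))

  twistX-involutive : ∀ f X → twistX f (twistX f X) ≡ X
  twistX-involutive f X = lookup-ext _ _ (λ β →
    trans (VP.lookup∘tabulate _ β) (trans (cong (_xor f β) (VP.lookup∘tabulate _ β)) (xor-cancelʳ (V.lookup X β) (f β))))

  -- Moving names and bits together is a bijection of the configurations, so it preserves their
  -- uniform measure.
  total-move : ∀ π π⁻ → (∀ β → π (π⁻ β) ≡ β) → (∀ β → π⁻ (π β) ≡ β) → ∀ F →
    total (λ g X → F (moveL π π⁻ g) (moveX π X)) ≡ total F
  total-move π π⁻ e e′ F = trans
    (sum-cong (λ g → sum-bij (F (moveL π π⁻ g)) (moveX π) (moveX π⁻) (Unique-bvecs Q)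
      (moveX-inverse π π⁻ e) (moveX-inverse π⁻ π e′) (λ X _ → ∈-bvecs _) (λ X _ → ∈-bvecs _)) labellings)
    (sum-bij (λ g → sumL (F g) (bvecs Q)) (moveL π π⁻) (moveL π⁻ π) Unique-labellings
      (moveL-inverse π π⁻ e) (moveL-inverse π⁻ π e′)
      (λ g g∈ → ∈-labellings _ (moveL-Inverse π π⁻ e e′ g (labellings-inverse g g∈)))
      (λ g g∈ → ∈-labellings _ (moveL-Inverse π⁻ π e′ e g (labellings-inverse g g∈))))

  total-twist : ∀ f F → total (λ g X → F g (twistX f X)) ≡ total F
  total-twist f F = sum-cong (λ g → sum-bij (F g) (twistX f) (twistX f) (Unique-bvecs Q)
    (twistX-involutive f) (twistX-involutive f) (λ X _ → ∈-bvecs _) (λ X _ → ∈-bvecs _)) labellings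

  -- Hybrids: the first j cycle strands have odd twist, the others even twist.

  cyc : Fin M → Strand
  cyc p = p ↑ˡ M

  rowOf : Vec Bool Q → Fin M → Bool
  rowOf X p = rowParity (V.lookup X) (cyc p)

  hyb? : ∀ j X → Dec (∀ p → rowOf X p ≡ (toℕ p <ᵇ j))
  hyb? j X = all? (λ p → rowOf X p ≟B (toℕ p <ᵇ j))

  hyb : ℕ → Vec Bool Q → Bool
  hyb j X = ⌊ hyb? j X ⌋

  others? : ∀ p X → Dec (∀ p′ → (p′ ≡ p) ⊎ (rowOf X p′ ≡ (toℕ p′ <ᵇ toℕ p)))
  others? p X = all? (λ p′ → (p′ ≟F p) ⊎-dec (rowOf X p′ ≟B (toℕ p′ <ᵇ toℕ p)))

  -- The condition shared by hybrids `toℕ p` and `suc (toℕ p)`, which differ only in the parity of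
  -- row `p`.
  others : Fin M → Vec Bool Q → Bool
  others p X = ⌊ others? p X ⌋

  <ᵇ-suc : ∀ {a b} → a ≢ b → (a <ᵇ suc b) ≡ (a <ᵇ b)
  <ᵇ-suc {a} {b} ne with a <? b
  ... | yes lt = trans (<ᵇ-true (m<n⇒m<1+n lt)) (sym (<ᵇ-true lt))
  ... | no ≮ = trans (<ᵇ-false (≤∧≢⇒< (≮⇒≥ ≮) (ne ∘ sym))) (sym (<ᵇ-false (≮⇒≥ ≮)))

  hyb-suc : ∀ p X → hyb (suc (toℕ p)) X ≡ others p X ∧ rowOf X p
  hyb-suc p X = bool-ext forward backward
    where
    forward : hyb (suc (toℕ p)) X ≡ true → others p X ∧ rowOf X p ≡ true
    forward e = cong₂ _∧_ (⌊⌋-true (others? p X) rest) (trans (true-⌊⌋ (hyb? (suc (toℕ p)) X) e p) (<ᵇ-true {toℕ p} {suc (toℕ p)} ≤-refl))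
      where
      rest : ∀ p′ → (p′ ≡ p) ⊎ (rowOf X p′ ≡ (toℕ p′ <ᵇ toℕ p))
      rest p′ with p′ ≟F p
      ... | yes e′ = inj₁ e′
      ... | no ne = inj₂ (trans (true-⌊⌋ (hyb? (suc (toℕ p)) X) e p′) (<ᵇ-suc (ne ∘ toℕ-injective)))
    backward : others p X ∧ rowOf X p ≡ true → hyb (suc (toℕ p)) X ≡ true
    backward e with ∧-true {others p X} e
    ... | e₁ , e₂ = ⌊⌋-true (hyb? (suc (toℕ p)) X) all
      where
      all : ∀ p′ → rowOf X p′ ≡ (toℕ p′ <ᵇ suc (toℕ p))
      all p′ with p′ ≟F p | true-⌊⌋ (others? p X) e₁ p′
      ... | yes refl | _ = trans e₂ (sym (<ᵇ-true {toℕ p} {suc (toℕ p)} ≤-refl))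
      ... | no ne | inj₁ e′ = ⊥-elim (ne e′)
      ... | no ne | inj₂ e′ = trans e′ (sym (<ᵇ-suc (ne ∘ toℕ-injective)))

  hyb-same : ∀ p X → hyb (toℕ p) X ≡ others p X ∧ not (rowOf X p)
  hyb-same p X = bool-ext forward backward
    where
    forward : hyb (toℕ p) X ≡ true → others p X ∧ not (rowOf X p) ≡ true
    forward e = cong₂ _∧_ (⌊⌋-true (others? p X) (λ p′ → inj₂ (true-⌊⌋ (hyb? (toℕ p) X) e p′)))
      (cong not (trans (true-⌊⌋ (hyb? (toℕ p) X) e p) (<ᵇ-false {toℕ p} {toℕ p} ≤-refl)))
    backward : others p X ∧ not (rowOf X p) ≡ true → hyb (toℕ p) X ≡ true
    backward e with ∧-true {others p X} e
    ... | e₁ , e₂ = ⌊⌋-true (hyb? (toℕ p) X) all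
      where
      all : ∀ p′ → rowOf X p′ ≡ (toℕ p′ <ᵇ toℕ p)
      all p′ with true-⌊⌋ (others? p X) e₁ p′
      ... | inj₁ refl = trans (trans (sym (not-involutive _)) (cong not e₂)) (sym (<ᵇ-false {toℕ p} {toℕ p} ≤-refl))
      ... | inj₂ e′ = e′

  others-cong : ∀ p X X′ → (∀ p′ → p′ ≢ p → rowOf X p′ ≡ rowOf X′ p′) → others p X ≡ true → others p X′ ≡ true
  others-cong p X X′ same e = ⌊⌋-true (others? p X′) all
    where
    all : ∀ p′ → (p′ ≡ p) ⊎ (rowOf X′ p′ ≡ (toℕ p′ <ᵇ toℕ p))
    all p′ with p′ ≟F p | true-⌊⌋ (others? p X) e p′
    ... | yes e′ | _ = inj₁ e′
    ... | no ne | inj₁ e′ = ⊥-elim (ne e′)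
    ... | no ne | inj₂ e′ = inj₂ (trans (sym (same p′ ne)) e′)

  others-≡ : ∀ p X X′ → (∀ p′ → p′ ≢ p → rowOf X p′ ≡ rowOf X′ p′) → others p X ≡ others p X′
  others-≡ p X X′ same = bool-ext (others-cong p X X′ same) (others-cong p X′ X (λ p′ ne → sym (same p′ ne)))

  hybrids : ℕ → ℕ
  hybrids j = total (λ g X → ind (hyb j X))

  strandBlocks : Strand → List (Fin Q)
  strandBlocks p = map (combine p) (allFin q)

  rowList : Fin M → List (Fin Q)
  rowList p = strandBlocks (cyc p)

  row-combine : ∀ p b → row (combine p b) ≡ p
  row-combine p b = cong proj₁ (remQuot-combine {k = q} p b)

  ∈-rowList : ∀ p β → β ∈ rowList p → row β ≡ cyc p
  ∈-rowList p β β∈ with map-∈⁻ (allFin q) β∈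
  ... | b , _ , refl = row-combine (cyc p) b

  cyc-injective : ∀ {p p′} → cyc p ≡ cyc p′ → p ≡ p′
  cyc-injective {p} {p′} e = toℕ-injective (trans (sym (toℕ-↑ˡ p M)) (trans (cong toℕ e) (toℕ-↑ˡ p′ M)))

  Unique-strandBlocks : ∀ p → Unique (strandBlocks p)
  Unique-strandBlocks p = Unique-map-∈ (Uniq.allFin⁺ q) (λ x y _ _ e → proj₂ (combine-injective p x p y e))

  Unique-rowList : ∀ p → Unique (rowList p)
  Unique-rowList p = Unique-strandBlocks (cyc p)

  -- Flipping a single bit of row `p` exchanges the two hybrids.
  hybrids-constant : ∀ p → hybrids (suc (toℕ p)) ≡ hybrids (toℕ p)
  hybrids-constant p = trans (sym (total-twist f (λ g X → ind (hyb (suc (toℕ p)) X))))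
    (total-cong (λ g X → cong ind (flipped X)))
    where
    β₀ : Fin Q
    β₀ = combine (cyc p) (fromℕ< 1≤q)
    f : Fin Q → Bool
    f β = ⌊ β ≟F β₀ ⌋
    absent : ∀ xs → β₀ ∉ xs → parity f xs ≡ false
    absent [] _ = refl
    absent (x ∷ xs) β∉ = cong₂ _xor_ (⌊⌋-false (x ≟F β₀) (λ e → β∉ (here (sym e)))) (absent xs (β∉ ∘ there))
    present : ∀ xs → Unique xs → β₀ ∈ xs → parity f xs ≡ true
    present (x ∷ xs) (x# ∷ u) (here refl) = cong₂ _xor_ (⌊⌋-true (x ≟F β₀) refl) (absent xs (λ β∈ → All.lookup x# β∈ refl))
    present (x ∷ xs) (x# ∷ u) (there β∈) = cong₂ _xor_ (⌊⌋-false (x ≟F β₀) (λ e → All.lookup x# β∈ e)) (present xs u β∈)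
    twisted : ∀ X p′ → rowOf (twistX f X) p′ ≡ rowOf X p′ xor parity f (rowList p′)
    twisted X p′ = trans (parity-cong-∈ (rowList p′) (λ β _ → VP.lookup∘tabulate _ β)) (parity-xor (V.lookup X) f (rowList p′))
    same : ∀ X p′ → p′ ≢ p → rowOf (twistX f X) p′ ≡ rowOf X p′
    same X p′ ne = trans (twisted X p′) (trans (cong (rowOf X p′ xor_) (absent (rowList p′) outside)) (xor-identityʳ _))
      where
      outside : β₀ ∉ rowList p′
      outside β∈ = ne (cyc-injective (trans (sym (∈-rowList p′ β₀ β∈)) (row-combine (cyc p) (fromℕ< 1≤q))))
    inside : β₀ ∈ rowList p
    inside = ∈-map⁺ (combine (cyc p)) (∈-allFin (fromℕ< 1≤q))
    xor-true : ∀ a → a xor true ≡ not a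
    xor-true true = refl
    xor-true false = refl
    flipped : ∀ X → hyb (suc (toℕ p)) (twistX f X) ≡ hyb (toℕ p) X
    flipped X = trans (hyb-suc p (twistX f X)) (trans (cong₂ _∧_ (others-≡ p (twistX f X) X (same X))
      (trans (twisted X p) (trans (cong (rowOf X p xor_) (present (rowList p) (Unique-rowList p) inside)) (xor-true (rowOf X p)))))
      (sym (hyb-same p X)))

  -- Good blocks, and the comparison of consecutive hybrids

  blockSites : Fin Q → List Vtx
  blockSites β = site β 0F true ∷ site β 0F false ∷ site β 1F true ∷ site β 1F false ∷ site β 2F true ∷ site β 2F false ∷ []

  isPattern : List Bool → Bool
  isPattern (false ∷ false ∷ true ∷ true ∷ false ∷ false ∷ []) = true
  isPattern _ = false

  opaque

    isGood : Vec Bool n → Fin Q → Bool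
    isGood κ β = isPattern (map (V.lookup κ) (map enc (blockSites β)))

    isGood≡ : ∀ κ β → isGood κ β ≡ isPattern (map (V.lookup κ) (map enc (blockSites β)))
    isGood≡ κ β = refl

    isGood⇒Good : ∀ κ β → isGood κ β ≡ true → View.Good (colours κ) β
    isGood⇒Good κ β e s with V.lookup κ (enc (site β 0F true)) in e₀ | V.lookup κ (enc (site β 0F false)) in e₁
      | V.lookup κ (enc (site β 1F true)) in e₂ | V.lookup κ (enc (site β 1F false)) in e₃
      | V.lookup κ (enc (site β 2F true)) in e₄ | V.lookup κ (enc (site β 2F false)) in e₅
    isGood⇒Good κ β e true | false | false | true | true | false | false = e₀ , e₂ , e₄
    isGood⇒Good κ β e false | false | false | true | true | false | false = e₁ , e₃ , e₅

  goodInRow : Vec Bool n → Fin M → List (Fin Q)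
  goodInRow κ p = filterᵇ (isGood κ) (rowList p)

  isFree : Vec Bool n → Fin Q → Bool
  isFree κ β = isGood κ β ∧ (M ≤ᵇ toℕ (row β))

  -- The alphabet of the hidden words: good blocks on path pairs, whose crossings do not affect the
  -- type of the graph.
  free : Vec Bool n → List (Fin Q)
  free κ = filterᵇ (isFree κ) (allFin Q)

  out : ∀ {r c} → Protocol n r c → Vec Bool n → Vec Bool r → Labelling → Vec Bool Q → Bool
  out P κ R (Λ , _) X = run P (ordered (view true (V.lookup Λ) (V.lookup X))) (ordered (view false (V.lookup Λ) (V.lookup X))) R
    where open View (colours κ)

  -- The configurations of hybrid j on which Bob answers "type (i)".
  accepted : ∀ {r c} → Protocol n r c → Vec Bool n → Vec Bool r → ℕ → ℕ
  accepted P κ R j = total (λ g X → ind (hyb j X ∧ out P κ R g X))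

  module Comparison {r c} (P : Protocol n r c) (κ : Vec Bool n) (R : Vec Bool r) (p : Fin M) (ℓ : ℕ)
    (enough : ℓ ≤ length (goodInRow κ p)) where

    open View (colours κ)

    -- Row `p` splits into the places `C`, where the hidden word is inserted, and the rest `D`,
    -- which no exchange touches.
    C D γs : List (Fin Q)
    C = take ℓ (goodInRow κ p)
    D = drop ℓ (goodInRow κ p) ++ filterᵇ (not ∘ isGood κ) (rowList p)
    γs = free κ

    𝒜 : List (List (Fin Q))
    𝒜 = words γs ℓ

    S : Fin Q → Set
    S β = β ∈ C ++ γs

    S-C : All S C
    S-C = All.tabulate ∈-++⁺ˡ

    S-a : ∀ {a} → a ∈ 𝒜 → All S a
    S-a a∈ = All.map (∈-++⁺ʳ C) (∈-∈-words γs ℓ a∈)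

    C-good : ∀ β → β ∈ C → row β ≡ cyc p × isGood κ β ≡ true
    C-good β β∈ with ∈-filterᵇ⁻ (isGood κ) (rowList p) (∈-take ℓ (goodInRow κ p) β∈)
    ... | β∈′ , g = ∈-rowList p β β∈′ , g

    γ-good : ∀ β → β ∈ γs → M ≤ toℕ (row β) × isGood κ β ≡ true
    γ-good β β∈ with ∧-true {isGood κ β} (proj₂ (∈-filterᵇ⁻ (isFree κ) (allFin Q) β∈))
    ... | g , m = ≤ᵇ⇒≤ M _ (Equivalence.from T-≡ m) , g

    S-Good : ∀ β → S β → Good β
    S-Good β s with ∈-++⁻ C s
    ... | inj₁ β∈ = isGood⇒Good κ β (proj₂ (C-good β β∈))
    ... | inj₂ β∈ = isGood⇒Good κ β (proj₂ (γ-good β β∈))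

    γ∉row : ∀ β p′ → row β ≡ cyc p′ → β ∉ γs
    γ∉row β p′ e β∈ = <⇒≱ (subst (_< M) (sym (trans (cong toℕ e) (toℕ-↑ˡ p′ M))) (toℕ<n p′)) (proj₁ (γ-good β β∈))

    C∉a : ∀ {a} → a ∈ 𝒜 → ∀ β → β ∈ C → β ∉ a
    C∉a a∈ β β∈ β∈a = γ∉row β p (proj₁ (C-good β β∈)) (All.lookup (∈-∈-words γs ℓ a∈) β∈a)

    unmoved-row : ∀ {a} → a ∈ 𝒜 → ∀ β p′ → row β ≡ cyc p′ → β ∉ C → swaps C a β ≡ β
    unmoved-row {a} a∈ β p′ e β∉ = swaps-fix C a β β∉ (λ β∈a → γ∉row β p′ e (All.lookup (∈-∈-words γs ℓ a∈) β∈a))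

    Unique-C : Unique C
    Unique-C = Uniq.take⁺ ℓ (Uniq.filter⁺ (T? ∘ isGood κ) (Unique-rowList p))

    length-C : length C ≡ ℓ
    length-C = trans (length-take ℓ (goodInRow κ p)) (m≤n⇒m⊓n≡m enough)

    fixed : ∀ {a} → a ∈ 𝒜 → Fixed (swaps C a)
    fixed {a} a∈ β with swaps-cases S C a S-C (S-a a∈) β
    ... | inj₁ e = inj₁ e
    ... | inj₂ (s , s′) = inj₂ (S-Good β s , S-Good (swaps C a β) s′)

    fixed⁻ : ∀ {a} → a ∈ 𝒜 → Fixed (swaps⁻ C a)
    fixed⁻ {a} a∈ β with swaps⁻-cases S C a S-C (S-a a∈) β
    ... | inj₁ e = inj₁ e
    ... | inj₂ (s , s′) = inj₂ (S-Good β s , S-Good (swaps⁻ C a β) s′)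

    -- Alice's random string may act only on blocks that are good, for elsewhere Bob could see it.
    mask : Vec Bool Q → Fin Q → Bool
    mask x β = V.lookup x β ∧ ⌊ mem? _≟F_ β (C ++ γs) ⌋

    mask-S : ∀ x β → S β → mask x β ≡ V.lookup x β
    mask-S x β s = trans (cong (V.lookup x β ∧_) (⌊⌋-true (mem? _≟F_ β (C ++ γs)) s)) (∧-identityʳ _)

    mask-¬S : ∀ x β → ¬ S β → mask x β ≡ false
    mask-¬S x β ¬s = trans (cong (V.lookup x β ∧_) (⌊⌋-false (mem? _≟F_ β (C ++ γs)) ¬s)) (∧-zeroʳ _)

    move : List (Fin Q) → Labelling → Labelling
    move a = moveL (swaps C a) (swaps⁻ C a)

    -- A configuration is drawn as a base point displaced by a random `x` and a random `a`. This
    -- isolates a part of the randomness that is visible to one player only, while the base point is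
    -- treated as known to both.
    moved : Vec Bool Q → List (Fin Q) → Vec Bool Q → Vec Bool Q
    moved x a X = moveX (swaps C a) (twistX (mask x) X)

    lookup-moved : ∀ x a X β → V.lookup (moved x a X) β ≡ V.lookup X (swaps C a β) xor mask x (swaps C a β)
    lookup-moved x a X β = trans (VP.lookup∘tabulate _ β) (VP.lookup∘tabulate _ (swaps C a β))

    swaps-S : ∀ {a} → a ∈ 𝒜 → ∀ β → S (swaps C a β) → S β
    swaps-S {a} a∈ β s with swaps-cases S C a S-C (S-a a∈) β
    ... | inj₁ e = subst S e s
    ... | inj₂ (s′ , _) = s′

    S-swaps : ∀ {a} → a ∈ 𝒜 → ∀ β → S β → S (swaps C a β)
    S-swaps {a} a∈ β s with swaps-cases S C a S-C (S-a a∈) β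
    ... | inj₁ e = subst S (sym e) s
    ... | inj₂ (_ , s′) = s′

    message : Labelling → Vec Bool Q → Vec Bool Q → List Bool
    message (Λ , _) X x = alice P (listAdj (ordered (view true (V.lookup Λ) (V.lookup (twistX (mask x) X))))) R

    answer : Labelling → Vec Bool Q → List Bool → List (Fin Q) → Bool
    answer (Λ , _) X m a =
      bob P m (listAdj (ordered (view false (swaps⁻ C a ∘ V.lookup Λ) (V.lookup X ∘ swaps C a)))) R

    -- Alice's view does not change when good blocks move with their bits, and Bob's view does not
    -- change when bits of good blocks are altered. So the message depends on `x` and not on `a`,
    -- the answer on the message and `a`, as `HiddenParity` requires.
    out-moved : ∀ g X x {a} → a ∈ 𝒜 → out P κ R (move a g) (moved x a X) ≡ answer g X (message g X x) a
    out-moved (Λ , Λ⁻) X x {a} a∈ = cong₂ (λ la lb → bob P (alice P (listAdj la) R) (listAdj lb) R)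
      (ordered-cong (λ u v → trans
        (view-cong true (VP.lookup∘tabulate _) (VP.lookup∘tabulate _) u v)
        (alice-permute (swaps C a) (swaps⁻ C a) (swaps-swaps⁻ C a) (swaps⁻-swaps C a) (fixed a∈) (fixed⁻ a∈)
          (V.lookup Λ) (V.lookup (twistX (mask x) X)) u v)))
      (ordered-cong (λ u v → trans
        (view-cong false (VP.lookup∘tabulate _) (λ _ → refl) u v)
        (bob-retwist (V.lookup (moved x a X)) (V.lookup X ∘ swaps C a) same (swaps⁻ C a ∘ V.lookup Λ) u v)))
      where
      same : ∀ β → (V.lookup (moved x a X) β ≡ V.lookup X (swaps C a β)) ⊎ Good β
      same β with mem? _≟F_ (swaps C a β) (C ++ γs)
      ... | yes s = inj₂ (S-Good β (swaps-S a∈ β s))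
      ... | no ¬s = inj₁ (trans (lookup-moved x a X β)
        (trans (cong (V.lookup X (swaps C a β) xor_) (mask-¬S x _ ¬s)) (xor-identityʳ _)))

    rowOf-other : ∀ x {a} → a ∈ 𝒜 → ∀ X p′ → p′ ≢ p → rowOf (moved x a X) p′ ≡ rowOf X p′
    rowOf-other x {a} a∈ X p′ ne = parity-cong-∈ (rowList p′) λ β β∈ → begin
        V.lookup (moved x a X) β                              ≡⟨ lookup-moved x a X β ⟩
        V.lookup X (swaps C a β) xor mask x (swaps C a β)
          ≡⟨ cong (λ z → V.lookup X z xor mask x z) (unmoved-row a∈ β p′ (∈-rowList p′ β β∈) (β∉C β β∈)) ⟩
        V.lookup X β xor mask x β                             ≡⟨ cong (V.lookup X β xor_) (mask-¬S x β (¬S β β∈)) ⟩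
        V.lookup X β xor false                                ≡⟨ xor-identityʳ _ ⟩
        V.lookup X β                                          ∎
      where
      open ≡-Reasoning
      β∉C : ∀ β → β ∈ rowList p′ → β ∉ C
      β∉C β β∈ β∈C = ne (cyc-injective (trans (sym (∈-rowList p′ β β∈)) (proj₁ (C-good β β∈C))))
      ¬S : ∀ β → β ∈ rowList p′ → ¬ S β
      ¬S β β∈ s with ∈-++⁻ C s
      ... | inj₁ i = β∉C β β∈ i
      ... | inj₂ i = γ∉row β p′ (∈-rowList p′ β β∈) i

    s₁ : Vec Bool Q → List (Fin Q) → Bool
    s₁ X a = parity (V.lookup X) (word C a)

    s₂ : Vec Bool Q → Vec Bool Q → Bool
    s₂ X x = parity (λ β → V.lookup X β xor mask x β) D

    D-fixed : ∀ {a} → a ∈ 𝒜 → ∀ β → β ∈ D → swaps C a β ≡ β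
    D-fixed a∈ β β∈ with ∈-++⁻ (drop ℓ (goodInRow κ p)) β∈
    ... | inj₁ i = unmoved-row a∈ β p (∈-rowList p β (proj₁ (∈-filterᵇ⁻ (isGood κ) (rowList p) (∈-drop ℓ (goodInRow κ p) i))))
      (λ β∈C → take-drop-disjoint ℓ (goodInRow κ p) (Uniq.filter⁺ (T? ∘ isGood κ) (Unique-rowList p)) β∈C i)
    ... | inj₂ i with ∈-filterᵇ⁻ (not ∘ isGood κ) (rowList p) i
    ...   | β∈′ , ng = unmoved-row a∈ β p (∈-rowList p β β∈′) (λ β∈C → clash (isGood κ β) ng (proj₂ (C-good β β∈C)))
      where
      clash : ∀ b → not b ≡ true → b ≡ true → ⊥
      clash true () _
      clash false _ ()

    -- The places in `D` are fixed by the exchange, and their parity does not involve `a`; the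
    -- places in `C` read the bits of `X` and of `x` along `word C a`.
    rowOf-moved : ∀ x {a} → a ∈ 𝒜 → ∀ X → rowOf (moved x a X) p ≡ s₂ X x xor (s₁ X a xor parity (V.lookup x) (word C a))
    rowOf-moved x {a} a∈ X = begin
      parity f (rowList p)
        ≡⟨ parity-filter f (isGood κ) (rowList p) ⟩
      parity f (goodInRow κ p) xor parity f N
        ≡⟨ cong (λ z → parity f z xor parity f N) (take++drop≡id ℓ (goodInRow κ p)) ⟨
      parity f (C ++ drop ℓ (goodInRow κ p)) xor parity f N
        ≡⟨ cong (_xor parity f N) (parity-++ f C _) ⟩
      (parity f C xor parity f (drop ℓ (goodInRow κ p))) xor parity f N
        ≡⟨ xor-assoc (parity f C) _ _ ⟩
      parity f C xor (parity f (drop ℓ (goodInRow κ p)) xor parity f N)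
        ≡⟨ cong (parity f C xor_) (parity-++ f (drop ℓ (goodInRow κ p)) N) ⟨
      parity f C xor parity f D
        ≡⟨ xor-comm (parity f C) _ ⟩
      parity f D xor parity f C
        ≡⟨ cong₂ _xor_ (parity-cong-∈ D onD) onC ⟩
      s₂ X x xor (s₁ X a xor parity (V.lookup x) (word C a)) ∎
      where
      open ≡-Reasoning
      f = V.lookup (moved x a X)
      N = filterᵇ (not ∘ isGood κ) (rowList p)
      onD : ∀ β → β ∈ D → f β ≡ V.lookup X β xor mask x β
      onD β β∈ = trans (lookup-moved x a X β) (cong (λ z → V.lookup X z xor mask x z) (D-fixed a∈ β β∈))
      masked : ∀ β → β ∈ C → mask x (swaps C a β) ≡ V.lookup x (swaps C a β)
      masked β β∈ = mask-S x (swaps C a β) (S-swaps a∈ β (∈-++⁺ˡ β∈))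
      onC : parity f C ≡ s₁ X a xor parity (V.lookup x) (word C a)
      onC = begin
        parity f C
          ≡⟨ parity-cong-∈ C (λ β β∈ → trans (lookup-moved x a X β) (cong (V.lookup X (swaps C a β) xor_) (masked β β∈))) ⟩
        parity (λ β → V.lookup X (swaps C a β) xor V.lookup x (swaps C a β)) C
          ≡⟨ parity-xor (V.lookup X ∘ swaps C a) (V.lookup x ∘ swaps C a) C ⟩
        parity (V.lookup X ∘ swaps C a) C xor parity (V.lookup x ∘ swaps C a) C
          ≡⟨ cong₂ _xor_ (parity-map (V.lookup X) (swaps C a) C) (parity-map (V.lookup x) (swaps C a) C) ⟨
        s₁ X a xor parity (V.lookup x) (word C a) ∎

    length-word : ∀ a → a ∈ 𝒜 → length (word C a) ≡ ℓ
    length-word a _ = trans (LP.length-map (swaps C a) C) length-C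

    word-inj : ∀ a b → a ∈ 𝒜 → b ∈ 𝒜 → word C a ≡ word C b → a ≡ b
    word-inj a b a∈ b∈ = word-injective C a b Unique-C
      (trans (length-∈-words γs ℓ a∈) (sym length-C)) (trans (length-∈-words γs ℓ b∈) (sym length-C)) (C∉a a∈) (C∉a b∈)

    Unique-𝒜 : Unique 𝒜
    Unique-𝒜 = Unique-words (Uniq.filter⁺ (T? ∘ isFree κ) (Uniq.allFin⁺ Q)) ℓ

    module HP (g : Labelling) (X : Vec Bool Q) = HiddenParity 𝒜 (word C) ℓ Unique-𝒜 word-inj length-word
      (messages c) (answer g X) (message g X) (λ x → ∈-messages c _ (msgLen P _ R)) (s₁ X) (s₂ X)

    hyb-moved : ∀ x {a} → a ∈ 𝒜 → ∀ g X → hyb (suc (toℕ p)) (moved x a X) ≡ others p X ∧ HP.par g X x a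
    hyb-moved x {a} a∈ g X = trans (hyb-suc p (moved x a X))
      (cong₂ _∧_ (others-≡ p (moved x a X) X (rowOf-other x a∈ X)) (rowOf-moved x a∈ X))

    hyb-moved′ : ∀ x {a} → a ∈ 𝒜 → ∀ g X → hyb (toℕ p) (moved x a X) ≡ others p X ∧ not (HP.par g X x a)
    hyb-moved′ x {a} a∈ g X = trans (hyb-same p (moved x a X))
      (cong₂ _∧_ (others-≡ p (moved x a X) X (rowOf-other x a∈ X)) (cong not (rowOf-moved x a∈ X)))

    -- Each displacement preserves the measure on configurations, so all `2 ^ Q * length γs ^ ℓ` of
    -- them contribute the same total.
    spreadOut : ∀ F → sumL (λ x → sumL (λ a → total (λ g X → F (move a g) (moved x a X))) 𝒜) (bvecs Q) ≡
      2 ^ Q * (length γs ^ ℓ * total F)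
    spreadOut F = begin
      sumL (λ x → sumL (λ a → total (λ g X → F (move a g) (moved x a X))) 𝒜) (bvecs Q)
        ≡⟨ sum-cong (λ x → sum-cong (λ a → trans
             (total-twist (mask x) (λ g X → F (move a g) (moveX (swaps C a) X)))
             (total-move (swaps C a) (swaps⁻ C a) (swaps-swaps⁻ C a) (swaps⁻-swaps C a) F)) 𝒜) (bvecs Q) ⟩
      sumL (λ x → sumL (λ a → total F) 𝒜) (bvecs Q)
        ≡⟨ sum-cong (λ x → trans (sum-const (total F) 𝒜) (cong (_* total F) (length-words γs ℓ))) (bvecs Q) ⟩
      sumL (λ x → length γs ^ ℓ * total F) (bvecs Q)
        ≡⟨ trans (sum-const _ (bvecs Q)) (cong (_* (length γs ^ ℓ * total F)) (length-vecs bools Q)) ⟩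
      2 ^ Q * (length γs ^ ℓ * total F) ∎
      where open ≡-Reasoning

    gather : ∀ (F : Vec Bool Q → List (Fin Q) → Labelling → Vec Bool Q → ℕ) →
      sumL (λ x → sumL (λ a → total (F x a)) 𝒜) (bvecs Q) ≡ total (λ g X → sumL (λ x → sumL (λ a → F x a g X) 𝒜) (bvecs Q))
    gather F = begin
      sumL (λ x → sumL (λ a → total (F x a)) 𝒜) (bvecs Q)
        ≡⟨ sum-cong (λ x → sum-swap (λ a g → sumL (F x a g) (bvecs Q)) 𝒜 labellings) (bvecs Q) ⟩
      sumL (λ x → sumL (λ g → sumL (λ a → sumL (F x a g) (bvecs Q)) 𝒜) labellings) (bvecs Q)
        ≡⟨ sum-swap (λ x g → sumL (λ a → sumL (F x a g) (bvecs Q)) 𝒜) (bvecs Q) labellings ⟩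
      sumL (λ g → sumL (λ x → sumL (λ a → sumL (F x a g) (bvecs Q)) 𝒜) (bvecs Q)) labellings
        ≡⟨ sum-cong (λ g → trans
             (sum-cong (λ x → sum-swap (λ a X → F x a g X) 𝒜 (bvecs Q)) (bvecs Q))
             (sum-swap (λ x X → sumL (λ a → F x a g X) 𝒜) (bvecs Q) (bvecs Q))) labellings ⟩
      total (λ g X → sumL (λ x → sumL (λ a → F x a g X) 𝒜) (bvecs Q)) ∎
      where open ≡-Reasoning

    factor : ∀ g X (β : Vec Bool Q → List (Fin Q) → Bool) →
      sumL (λ x → sumL (λ a → ind ((others p X ∧ β x a) ∧ answer g X (message g X x) a)) 𝒜) (bvecs Q) ≡
      ind (others p X) * sumL (λ x → sumL (λ a → ind (β x a ∧ answer g X (message g X x) a)) 𝒜) (bvecs Q)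
    factor g X β = trans (sum-cong (λ x → trans
        (sum-cong (λ a → trans (cong ind (∧-assoc (others p X) (β x a) _)) (ind-∧ (others p X) _)) 𝒜)
        (sum-*ˡ (ind (others p X)) _ 𝒜)) (bvecs Q))
      (sum-*ˡ (ind (others p X)) _ (bvecs Q))

    both : total (λ g X → ind (others p X)) ≡ hybrids (suc (toℕ p)) + hybrids (toℕ p)
    both = trans (total-cong (λ g X → trans (cases (others p X) (rowOf X p))
        (sym (cong₂ _+_ (cong ind (hyb-suc p X)) (cong ind (hyb-same p X))))))
      (trans (sum-cong (λ g → sum-+ _ _ (bvecs Q)) labellings) (sum-+ _ _ labellings))
      where
      cases : ∀ a b → ind a ≡ ind (a ∧ b) + ind (a ∧ not b)
      cases true true = refl
      cases true false = refl
      cases false b = refl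

    -- Both hybrids are averaged over all displacements. For a fixed base point satisfying
    -- `others p`, they become the events of odd and even parity, which `hidden-parity` compares.
    compare : ∀ h θ → 1 ≤ θ → length (messages c) * spread {Q} one ((suc h + suc h) * ℓ) ≤ 2 ^ Q * θ ^ (suc h + suc h) →
      length γs ^ ℓ * accepted P κ R (suc (toℕ p)) ≤
      length γs ^ ℓ * accepted P κ R (toℕ p) + 2 * θ * (hybrids (suc (toℕ p)) + hybrids (toℕ p))
    compare h θ θ≥1 small = *-cancelˡ-≤ (2 ^ Q) {{m^n≢0 2 Q}} (begin
      2 ^ Q * (length γs ^ ℓ * accepted P κ R (suc (toℕ p)))
        ≡⟨ expand (suc (toℕ p)) ⟩
      total (λ g X → sumL (λ x → sumL (λ a → ind (hyb (suc (toℕ p)) (moved x a X) ∧ out P κ R (move a g) (moved x a X))) 𝒜) (bvecs Q))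
        ≡⟨ total-cong (λ g X → trans (sum-cong (λ x → sum-cong-∈ 𝒜 (λ a a∈ → cong₂ (λ s t → ind (s ∧ t))
             (hyb-moved x a∈ g X) (out-moved g X x a∈))) (bvecs Q)) (factor g X (HP.par g X))) ⟩
      total (λ g X → ind (others p X) * sumL (λ x → sumL (λ a → ind (HP.par g X x a ∧ answer g X (message g X x) a)) 𝒜) (bvecs Q))
        ≤⟨ sum-mono (λ g → sum-mono (λ X → *-monoʳ-≤ (ind (others p X)) (HP.hidden-parity g X h θ θ≥1 small)) (bvecs Q)) labellings ⟩
      total (λ g X → ind (others p X) * (E g X + 2 * (2 ^ Q * θ)))
        ≡⟨ total-cong (λ g X → trans (*-distribˡ-+ (ind (others p X)) (E g X) (2 * (2 ^ Q * θ)))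
             (cong (ind (others p X) * E g X +_) (*-comm (ind (others p X)) _))) ⟩
      total (λ g X → ind (others p X) * E g X + 2 * (2 ^ Q * θ) * ind (others p X))
        ≡⟨ trans (sum-cong (λ g → sum-+ _ _ (bvecs Q)) labellings) (sum-+ _ _ labellings) ⟩
      total (λ g X → ind (others p X) * E g X) + total (λ g X → 2 * (2 ^ Q * θ) * ind (others p X))
        ≡⟨ cong₂ _+_
             (total-cong (λ g X → trans (sym (factor g X (λ x a → not (HP.par g X x a))))
               (sum-cong (λ x → sum-cong-∈ 𝒜 (λ a a∈ → sym (cong₂ (λ s t → ind (s ∧ t))
                 (hyb-moved′ x a∈ g X) (out-moved g X x a∈)))) (bvecs Q))))
             (trans (sum-cong (λ g → sum-*ˡ (2 * (2 ^ Q * θ)) _ (bvecs Q)) labellings)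
               (trans (sum-*ˡ (2 * (2 ^ Q * θ)) _ labellings) (cong (2 * (2 ^ Q * θ) *_) both))) ⟩
      total (λ g X → sumL (λ x → sumL (λ a → ind (hyb (toℕ p) (moved x a X) ∧ out P κ R (move a g) (moved x a X))) 𝒜) (bvecs Q))
        + 2 * (2 ^ Q * θ) * (hybrids (suc (toℕ p)) + hybrids (toℕ p))
        ≡⟨ cong (_+ 2 * (2 ^ Q * θ) * (hybrids (suc (toℕ p)) + hybrids (toℕ p))) (expand (toℕ p)) ⟨
      2 ^ Q * (length γs ^ ℓ * accepted P κ R (toℕ p)) + 2 * (2 ^ Q * θ) * (hybrids (suc (toℕ p)) + hybrids (toℕ p))
        ≡⟨ regroup (2 ^ Q) (length γs ^ ℓ * accepted P κ R (toℕ p)) θ _ ⟩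
      2 ^ Q * (length γs ^ ℓ * accepted P κ R (toℕ p) + 2 * θ * (hybrids (suc (toℕ p)) + hybrids (toℕ p))) ∎)
      where
      open ≤-Reasoning
      E : Labelling → Vec Bool Q → ℕ
      E g X = sumL (λ x → sumL (λ a → ind (not (HP.par g X x a) ∧ answer g X (message g X x) a)) 𝒜) (bvecs Q)
      regroup : ∀ a b t s → a * b + 2 * (a * t) * s ≡ a * (b + 2 * t * s)
      regroup = solve-∀
      expand : ∀ j → 2 ^ Q * (length γs ^ ℓ * accepted P κ R j) ≡
        total (λ g X → sumL (λ x → sumL (λ a → ind (hyb j (moved x a X) ∧ out P κ R (move a g) (moved x a X))) 𝒜) (bvecs Q))
      expand j = trans (sym (spreadOut (λ g X → ind (hyb j X ∧ out P κ R g X))))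
        (gather (λ x a g X → ind (hyb j (moved x a X) ∧ out P κ R (move a g) (moved x a X))))

  -- A Chernoff bound for the number of good blocks

  weight : List Bool → ℕ
  weight u = if isPattern u then 1 else 2

  weights : ℕ → List Bool → ℕ
  weights zero l = 1
  weights (suc m) l = weight (take 6 l) * weights m (drop 6 l)

  take-++-length : {A : Set} → ∀ l (u w : List A) → length u ≡ l → take l (u ++ w) ≡ u × drop l (u ++ w) ≡ w
  take-++-length zero [] w e = refl , refl
  take-++-length (suc l) (x ∷ u) w e with take-++-length l u w (suc-injective e)
  ... | e₁ , e₂ = cong (x ∷_) e₁ , e₂

  -- One pattern out of 64 is good, and 127 = 1 + 2 · 63.
  sum-weights : ∀ m → sumL (weights m) (words bools (m * 6)) ≡ 127 ^ m
  sum-weights zero = refl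
  sum-weights (suc m) = begin
    sumL (weights (suc m)) (words bools (6 + m * 6))
      ≡⟨ sum-words-++ (weights (suc m)) bools 6 (m * 6) ⟩
    sumL (λ u → sumL (λ w → weights (suc m) (u ++ w)) (words bools (m * 6))) (words bools 6)
      ≡⟨ sum-cong-∈ (words bools 6) (λ u u∈ → trans (sum-cong (λ w → cong₂ (λ a b → weight a * weights m b)
           (proj₁ (take-++-length 6 u w (length-∈-words bools 6 u∈))) (proj₂ (take-++-length 6 u w (length-∈-words bools 6 u∈))))
           (words bools (m * 6))) (sum-*ˡ (weight u) (weights m) (words bools (m * 6)))) ⟩
    sumL (λ u → weight u * sumL (weights m) (words bools (m * 6))) (words bools 6)
      ≡⟨ sum-cong (λ u → *-comm (weight u) (sumL (weights m) (words bools (m * 6)))) (words bools 6) ⟩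
    sumL (λ u → sumL (weights m) (words bools (m * 6)) * weight u) (words bools 6)
      ≡⟨ sum-*ˡ (sumL (weights m) (words bools (m * 6))) weight (words bools 6) ⟩
    sumL (weights m) (words bools (m * 6)) * 127
      ≡⟨ cong (_* 127) (sum-weights m) ⟩
    127 ^ m * 127
      ≡⟨ *-comm (127 ^ m) 127 ⟩
    127 ^ suc m ∎
    where open ≡-Reasoning

  indices : List (Fin Q) → List (Fin n)
  indices [] = []
  indices (β ∷ bs) = map enc (blockSites β) ++ indices bs

  length-indices : ∀ bs → length (indices bs) ≡ length bs * 6
  length-indices [] = refl
  length-indices (β ∷ bs) = cong (6 +_) (length-indices bs)

  ∈-blockSites : ∀ β v → v ∈ blockSites β → ∃ λ j → ∃ λ s → v ≡ site β j s
  ∈-blockSites β v (here e) = 0F , true , e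
  ∈-blockSites β v (there (here e)) = 0F , false , e
  ∈-blockSites β v (there (there (here e))) = 1F , true , e
  ∈-blockSites β v (there (there (there (here e)))) = 1F , false , e
  ∈-blockSites β v (there (there (there (there (here e))))) = 2F , true , e
  ∈-blockSites β v (there (there (there (there (there (here e)))))) = 2F , false , e

  ∈-indices : ∀ bs u → u ∈ indices bs → ∃ λ β → β ∈ bs × ∃ λ j → ∃ λ s → u ≡ enc (site β j s)
  ∈-indices (β ∷ bs) u u∈ with ∈-++⁻ (map enc (blockSites β)) u∈
  ... | inj₂ i with ∈-indices bs u i
  ...   | β′ , β′∈ , rest = β′ , there β′∈ , rest
  ∈-indices (β ∷ bs) u u∈ | inj₁ i with map-∈⁻ {h = enc} (blockSites β) i
  ... | v , v∈ , e with ∈-blockSites β v v∈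
  ... | j , s , e′ = β , here refl , j , s , trans e (cong enc e′)

  sixSites : List (Fin 3 × Bool)
  sixSites = (0F , true) ∷ (0F , false) ∷ (1F , true) ∷ (1F , false) ∷ (2F , true) ∷ (2F , false) ∷ []

  Unique-sixSites : Unique sixSites
  Unique-sixSites = ((λ ()) ∷ (λ ()) ∷ (λ ()) ∷ (λ ()) ∷ (λ ()) ∷ []) ∷ ((λ ()) ∷ (λ ()) ∷ (λ ()) ∷ (λ ()) ∷ [])
    ∷ ((λ ()) ∷ (λ ()) ∷ (λ ()) ∷ []) ∷ ((λ ()) ∷ (λ ()) ∷ []) ∷ ((λ ()) ∷ []) ∷ [] ∷ []

  Unique-blockSites : ∀ β → Unique (map enc (blockSites β))
  Unique-blockSites β = Unique-map-∈ (Unique-map-∈ {h = λ x → site β (proj₁ x) (proj₂ x)} Unique-sixSites site-inj)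
    (λ x y _ _ → enc-injective)
    where
    site-inj : ∀ x y → x ∈ sixSites → y ∈ sixSites → site β (proj₁ x) (proj₂ x) ≡ site β (proj₁ y) (proj₂ y) → x ≡ y
    site-inj (j , s) (j′ , s′) _ _ e with site-injective {β} {j} {s} {β} {j′} {s′} e
    ... | _ , ej , es = cong₂ _,_ ej es

  Unique-indices : ∀ bs → Unique bs → Unique (indices bs)
  Unique-indices [] u = []
  Unique-indices (β ∷ bs) (β# ∷ u) = Uniq.++⁺ (Unique-blockSites β) (Unique-indices bs u) disjoint
    where
    disjoint : ∀ {x} → x ∈ map enc (blockSites β) × x ∈ indices bs → ⊥
    disjoint {x} (x∈ , x∈′) with map-∈⁻ {h = enc} (blockSites β) x∈ | ∈-indices bs x x∈′
    ... | v , v∈ , e | β′ , β′∈ , j′ , s′ , e′ with ∈-blockSites β v v∈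
    ... | j , s , refl = All.lookup β# β′∈ (proj₁ (site-injective {β} {j} {s} {β′} {j′} {s′} (enc-injective (trans (sym e) e′))))

  -- Two to the number of blocks that are not good: the exponential moment `2 ^ (- good)`, scaled by
  -- `2 ^ length bs` to remain an integer.
  goodWeight : Vec Bool n → List (Fin Q) → ℕ
  goodWeight κ [] = 1
  goodWeight κ (β ∷ bs) = (if isGood κ β then 1 else 2) * goodWeight κ bs

  weights≡goodWeight : ∀ κ bs → weights (length bs) (map (V.lookup κ) (indices bs)) ≡ goodWeight κ bs
  weights≡goodWeight κ [] = refl
  weights≡goodWeight κ (β ∷ bs) = cong₂ (λ a b → (if a then 1 else 2) * b) (sym (isGood≡ κ β)) (weights≡goodWeight κ bs)

  good# : Vec Bool n → List (Fin Q) → ℕ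
  good# κ bs = length (filterᵇ (isGood κ) bs)

  goodWeight-exact : ∀ κ bs → goodWeight κ bs * 2 ^ good# κ bs ≡ 2 ^ length bs
  goodWeight-exact κ [] = refl
  goodWeight-exact κ (β ∷ bs) with isGood κ β
  ... | true = trans (regroup (goodWeight κ bs) (2 ^ good# κ bs)) (cong (2 *_) (goodWeight-exact κ bs))
    where
    regroup : ∀ a b → (1 * a) * (2 * b) ≡ 2 * (a * b)
    regroup = solve-∀
  ... | false = trans (*-assoc 2 (goodWeight κ bs) _) (cong (2 *_) (goodWeight-exact κ bs))

  deficient : ℕ → Vec Bool n → List (Fin Q) → Bool
  deficient s κ bs = good# κ bs <ᵇ s

  -- Markov's inequality for the exponential moment, before averaging: fewer than `s` good blocks
  -- leave a weight of at least `2 ^ (length bs - s)`.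
  deficient-weight : ∀ s κ bs → 2 ^ length bs * ind (deficient s κ bs) ≤ 2 ^ s * goodWeight κ bs
  deficient-weight s κ bs with good# κ bs <ᵇ s in e
  ... | false = subst (_≤ 2 ^ s * goodWeight κ bs) (sym (*-zeroʳ (2 ^ length bs))) z≤n
  ... | true = begin
    2 ^ length bs * 1                  ≡⟨ *-identityʳ _ ⟩
    2 ^ length bs                      ≡⟨ goodWeight-exact κ bs ⟨
    goodWeight κ bs * 2 ^ good# κ bs   ≤⟨ *-monoʳ-≤ (goodWeight κ bs) (^-monoʳ-≤ 2 (<⇒≤ (<ᵇ⇒< (good# κ bs) s (Equivalence.from T-≡ e)))) ⟩
    goodWeight κ bs * 2 ^ s            ≡⟨ *-comm (goodWeight κ bs) (2 ^ s) ⟩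
    2 ^ s * goodWeight κ bs            ∎
    where open ≤-Reasoning

  -- Distinct blocks involve disjoint sets of six vertices, so their colours are independent and the
  -- moment factorises, with mean `127/64` per block.
  sum-goodWeight : ∀ bs → Unique bs → 64 ^ length bs * sumL (λ κ → goodWeight κ bs) (bvecs n) ≡ 2 ^ n * 127 ^ length bs
  sum-goodWeight bs u = begin
    64 ^ length bs * sumL (λ κ → goodWeight κ bs) (bvecs n)
      ≡⟨ cong₂ _*_ (trans (^-*-assoc 2 6 (length bs)) (cong (2 ^_) (trans (*-comm 6 (length bs)) (sym (length-indices bs)))))
           (sum-cong (λ κ → sym (weights≡goodWeight κ bs)) (bvecs n)) ⟩
    2 ^ length (indices bs) * sumL (λ κ → weights (length bs) (map (V.lookup κ) (indices bs))) (bvecs n)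
      ≡⟨ sum-marginal {n} (weights (length bs)) (indices bs) (Unique-indices bs u) ⟩
    2 ^ n * sumL (weights (length bs)) (words bools (length (indices bs)))
      ≡⟨ cong (λ z → 2 ^ n * sumL (weights (length bs)) (words bools z)) (length-indices bs) ⟩
    2 ^ n * sumL (weights (length bs)) (words bools (length bs * 6))
      ≡⟨ cong (2 ^ n *_) (sum-weights (length bs)) ⟩
    2 ^ n * 127 ^ length bs ∎
    where open ≡-Reasoning

  deficient-count : ∀ s bs → Unique bs →
    128 ^ length bs * sumL (λ κ → ind (deficient s κ bs)) (bvecs n) ≤ 2 ^ s * (2 ^ n * 127 ^ length bs)
  deficient-count s bs u = begin
    128 ^ l * sumL (λ κ → ind (deficient s κ bs)) (bvecs n)
      ≡⟨ cong (_* N) (^-distribʳ-* l 64 2) ⟩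
    (64 ^ l * 2 ^ l) * N
      ≡⟨ *-assoc (64 ^ l) (2 ^ l) N ⟩
    64 ^ l * (2 ^ l * N)
      ≡⟨ cong (64 ^ l *_) (sum-*ˡ (2 ^ l) _ (bvecs n)) ⟨
    64 ^ l * sumL (λ κ → 2 ^ l * ind (deficient s κ bs)) (bvecs n)
      ≤⟨ *-monoʳ-≤ (64 ^ l) (sum-mono (λ κ → deficient-weight s κ bs) (bvecs n)) ⟩
    64 ^ l * sumL (λ κ → 2 ^ s * goodWeight κ bs) (bvecs n)
      ≡⟨ cong (64 ^ l *_) (sum-*ˡ (2 ^ s) _ (bvecs n)) ⟩
    64 ^ l * (2 ^ s * W)
      ≡⟨ swap (64 ^ l) (2 ^ s) W ⟩
    2 ^ s * (64 ^ l * W)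
      ≡⟨ cong (2 ^ s *_) (sum-goodWeight bs u) ⟩
    2 ^ s * (2 ^ n * 127 ^ l) ∎
    where
    open ≤-Reasoning
    l = length bs
    N = sumL (λ κ → ind (deficient s κ bs)) (bvecs n)
    W = sumL (λ κ → goodWeight κ bs) (bvecs n)
    swap : ∀ a b c → a * (b * c) ≡ b * (a * c)
    swap = solve-∀

  rich? : ∀ s κ → Dec (∀ p → s ≤ good# κ (strandBlocks p))
  rich? s κ = all? (λ p → s ≤? good# κ (strandBlocks p))

  poor : ℕ → Vec Bool n → ℕ
  poor s κ = ind (not ⌊ rich? s κ ⌋)

  length-strandBlocks : ∀ p → length (strandBlocks p) ≡ q
  length-strandBlocks p = trans (length-map (combine p) (allFin q)) (LP.length-tabulate {n = q} id)

  poor≤sum : ∀ s κ → poor s κ ≤ sumL (λ p → ind (deficient s κ (strandBlocks p))) (allFin (M + M))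
  poor≤sum s κ with rich? s κ
  ... | yes _ = z≤n
  ... | no ¬rich with ¬∀⟶∃¬ (M + M) _ (λ p → s ≤? good# κ (strandBlocks p)) ¬rich
  ... | p , lt = ≤-trans (≤-reflexive (cong ind (sym (<ᵇ-true (≰⇒> lt)))))
    (term≤sum (λ p → ind (deficient s κ (strandBlocks p))) (allFin (M + M)) (∈-allFin p))

  poor-count : ∀ s → 128 ^ q * sumL (poor s) (bvecs n) ≤ (M + M) * (2 ^ s * (2 ^ n * 127 ^ q))
  poor-count s = begin
    128 ^ q * sumL (poor s) (bvecs n)
      ≤⟨ *-monoʳ-≤ (128 ^ q) (sum-mono (poor≤sum s) (bvecs n)) ⟩
    128 ^ q * sumL (λ κ → sumL (λ p → ind (deficient s κ (strandBlocks p))) (allFin (M + M))) (bvecs n)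
      ≡⟨ cong (128 ^ q *_) (sum-swap (λ κ p → ind (deficient s κ (strandBlocks p))) (bvecs n) (allFin (M + M))) ⟩
    128 ^ q * sumL (λ p → sumL (λ κ → ind (deficient s κ (strandBlocks p))) (bvecs n)) (allFin (M + M))
      ≡⟨ sum-*ˡ (128 ^ q) _ (allFin (M + M)) ⟨
    sumL (λ p → 128 ^ q * sumL (λ κ → ind (deficient s κ (strandBlocks p))) (bvecs n)) (allFin (M + M))
      ≤⟨ sum-mono (λ p → subst (λ l → 128 ^ l * sumL (λ κ → ind (deficient s κ (strandBlocks p))) (bvecs n) ≤ 2 ^ s * (2 ^ n * 127 ^ l))
           (length-strandBlocks p) (deficient-count s (strandBlocks p) (Unique-strandBlocks p))) (allFin (M + M)) ⟩
    sumL (λ p → 2 ^ s * (2 ^ n * 127 ^ q)) (allFin (M + M))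
      ≡⟨ trans (sum-const _ (allFin (M + M))) (cong (_* (2 ^ s * (2 ^ n * 127 ^ q))) (LP.length-tabulate {n = M + M} id)) ⟩
    (M + M) * (2 ^ s * (2 ^ n * 127 ^ q)) ∎
    where open ≤-Reasoning

  free-count : ∀ s κ → (∀ p → s ≤ good# κ (strandBlocks p)) → M * s ≤ length (free κ)
  free-count s κ rich = begin
    M * s                                                        ≡⟨ cong (_* s) (LP.length-tabulate {n = M} id) ⟨
    length (allFin M) * s                                        ≡⟨ sum-const s (allFin M) ⟨
    sumL (λ p → s) (allFin M)                                    ≤⟨ sum-mono (λ p → rich (M ↑ʳ p)) (allFin M) ⟩
    sumL (λ p → good# κ (strandBlocks (M ↑ʳ p))) (allFin M)      ≡⟨ sum-cong in-path (allFin M) ⟩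
    sumL (λ p → sumL (λ b → ind (isFree κ (combine (M ↑ʳ p) b))) (allFin q)) (allFin M)
      ≡⟨ sum-product (ind ∘ isFree κ) (λ p b → combine (M ↑ʳ p) b) (allFin M) (allFin q) ⟨
    sumL (ind ∘ isFree κ) (cartesianProductWith (λ p b → combine (M ↑ʳ p) b) (allFin M) (allFin q))
      ≤⟨ sum-⊆ (ind ∘ isFree κ) (allFin Q) (Uniq.cartesianProductWith⁺ _ inj (Uniq.allFin⁺ M) (Uniq.allFin⁺ q)) (λ x _ → ∈-allFin x) ⟩
    sumL (ind ∘ isFree κ) (allFin Q)                             ≡⟨ length-filterᵇ (isFree κ) (allFin Q) ⟨
    length (free κ)                                              ∎
    where
    open ≤-Reasoning
    inj : ∀ {p p′ b b′} → combine (M ↑ʳ p) b ≡ combine (M ↑ʳ p′) b′ → p ≡ p′ × b ≡ b′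
    inj {p} {p′} {b} {b′} e with combine-injective (M ↑ʳ p) b (M ↑ʳ p′) b′ e
    ... | e₁ , e₂ = ↑ʳ-injective M p p′ e₁ , e₂
    in-path : ∀ p → good# κ (strandBlocks (M ↑ʳ p)) ≡ sumL (λ b → ind (isFree κ (combine (M ↑ʳ p) b))) (allFin q)
    in-path p = trans (length-filterᵇ (isGood κ) (strandBlocks (M ↑ʳ p))) (trans (sum-map (ind ∘ isGood κ) (combine (M ↑ʳ p)) (allFin q))
      (sum-cong (λ b → cong ind (sym (trans (cong (isGood κ (combine (M ↑ʳ p) b) ∧_)
        (Equivalence.to T-≡ (≤⇒≤ᵇ (subst (M ≤_) (sym (trans (cong toℕ (row-combine (M ↑ʳ p) b)) (toℕ-↑ʳ M p))) (m≤m+n M (toℕ p))))))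
        (∧-identityʳ _)))) (allFin q)))

  -- Averaging over colourings and the final contradiction

  T₀ : ℕ
  T₀ = hybrids 0

  hybrids≡ : ∀ j → j ≤ M → hybrids j ≡ T₀
  hybrids≡ zero _ = refl
  hybrids≡ (suc j) j<M = begin
    hybrids (suc j)                     ≡⟨ cong (hybrids ∘ suc) (toℕ-fromℕ< j<M) ⟨
    hybrids (suc (toℕ (fromℕ< j<M)))    ≡⟨ hybrids-constant (fromℕ< j<M) ⟩
    hybrids (toℕ (fromℕ< j<M))          ≡⟨ cong hybrids (toℕ-fromℕ< j<M) ⟩
    hybrids j                           ≡⟨ hybrids≡ j (<⇒≤ j<M) ⟩
    T₀                                  ∎
    where open ≡-Reasoning

  -- The identity labelling without any crossing is such a configuration; positivity makes the final
  -- inequality strict.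
  T₀>0 : 1 ≤ T₀
  T₀>0 = begin
    1                                                    ≡⟨ cong ind (⌊⌋-true (hyb? 0 X₀) zero-row) ⟨
    ind (hyb 0 X₀)                                       ≤⟨ term≤sum (λ X → ind (hyb 0 X)) (bvecs Q) (∈-bvecs X₀) ⟩
    sumL (λ X → ind (hyb 0 X)) (bvecs Q)                 ≤⟨ term≤sum (λ g → sumL (λ X → ind (hyb 0 X)) (bvecs Q)) labellings g₀∈ ⟩
    T₀                                                   ∎
    where
    open ≤-Reasoning
    X₀ : Vec Bool Q
    X₀ = V.replicate Q false
    ident : Vec (Fin Q) Q
    ident = V.tabulate id
    ident-id : ∀ β → V.lookup ident (V.lookup ident β) ≡ β
    ident-id β = trans (VP.lookup∘tabulate id (V.lookup ident β)) (VP.lookup∘tabulate id β)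
    g₀∈ : (ident , ident) ∈ labellings
    g₀∈ = ∈-labellings (ident , ident) (ident-id , ident-id)
    parity-zero : ∀ xs → parity (V.lookup X₀) xs ≡ false
    parity-zero [] = refl
    parity-zero (x ∷ xs) = cong₂ _xor_ (VP.lookup-replicate x false) (parity-zero xs)
    zero-row : ∀ p → rowOf X₀ p ≡ (toℕ p <ᵇ 0)
    zero-row p = parity-zero (rowList p)

  hyb-type : ∀ t j X → (∀ p → (toℕ {M} p <ᵇ j) ≡ t) → hyb j X ≡ true → HasType t (V.lookup X)
  hyb-type t j X const h p p<M = begin
    rowParity (V.lookup X) p                   ≡⟨ cong (rowParity (V.lookup X)) (toℕ-injective (sym (trans (toℕ-↑ˡ _ M) (toℕ-fromℕ< p<M)))) ⟩
    rowParity (V.lookup X) (cyc (fromℕ< p<M))  ≡⟨ true-⌊⌋ (hyb? j X) h (fromℕ< p<M) ⟩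
    (toℕ (fromℕ< p<M) <ᵇ j)                    ≡⟨ const (fromℕ< p<M) ⟩
    t                                          ∎
    where open ≡-Reasoning

  module _ {r c} (P : Protocol n r c) (err : ErrorAtMostThird k P) where

    N : ℕ
    N = 2 ^ n * 2 ^ r

    overall : (Vec Bool n → Vec Bool r → ℕ) → ℕ
    overall F = sumL (λ κ → sumL (F κ) (allVec r)) (bvecs n)

    overall-const : ∀ z → overall (λ _ _ → z) ≡ N * z
    overall-const z = begin
      sumL (λ κ → sumL (λ R → z) (allVec r)) (bvecs n)  ≡⟨ sum-cong (λ κ → trans (sum-const z (allVec r)) (cong (_* z) (length-allVec r))) (bvecs n) ⟩
      sumL (λ κ → 2 ^ r * z) (bvecs n)                  ≡⟨ trans (sum-const _ (bvecs n)) (cong (_* (2 ^ r * z)) (length-vecs bools n)) ⟩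
      2 ^ n * (2 ^ r * z)                               ≡⟨ *-assoc (2 ^ n) (2 ^ r) z ⟨
      N * z                                             ∎
      where open ≡-Reasoning

    overall-+ : ∀ F G → overall (λ κ R → F κ R + G κ R) ≡ overall F + overall G
    overall-+ F G = trans (sum-cong (λ κ → sum-+ (F κ) (G κ) (allVec r)) (bvecs n)) (sum-+ _ _ (bvecs n))

    overall-* : ∀ z F → overall (λ κ R → z * F κ R) ≡ z * overall F
    overall-* z F = trans (sum-cong (λ κ → sum-*ˡ z (F κ) (allVec r)) (bvecs n)) (sum-*ˡ z _ (bvecs n))

    correct : Bool → ℕ → Vec Bool n → Vec Bool r → ℕ
    correct t j κ R = total (λ g X → ind (hyb j X ∧ boolEq t (out P κ R g X)))

    overall-correct : ∀ t j → overall (correct t j) ≡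
      total (λ g X → ind (hyb j X) * overall (λ κ R → ind (boolEq t (out P κ R g X))))
    overall-correct t j = begin
      overall (correct t j)
        ≡⟨ sum-cong (λ κ → sum-swap (λ R g → sumL (F κ R g) (bvecs Q)) (allVec r) labellings) (bvecs n) ⟩
      sumL (λ κ → sumL (λ g → sumL (λ R → sumL (F κ R g) (bvecs Q)) (allVec r)) labellings) (bvecs n)
        ≡⟨ sum-swap (λ κ g → sumL (λ R → sumL (F κ R g) (bvecs Q)) (allVec r)) (bvecs n) labellings ⟩
      sumL (λ g → sumL (λ κ → sumL (λ R → sumL (F κ R g) (bvecs Q)) (allVec r)) (bvecs n)) labellings
        ≡⟨ sum-cong (λ g → trans (sum-cong (λ κ → sum-swap (λ R X → F κ R g X) (allVec r) (bvecs Q)) (bvecs n))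
             (sum-swap (λ κ X → sumL (λ R → F κ R g X) (allVec r)) (bvecs n) (bvecs Q))) labellings ⟩
      total (λ g X → overall (λ κ R → F κ R g X))
        ≡⟨ total-cong (λ g X → trans (sum-cong (λ κ → sum-cong (λ R → ind-∧ (hyb j X) _) (allVec r)) (bvecs n))
             (overall-* (ind (hyb j X)) (λ κ R → ind (boolEq t (out P κ R g X))))) ⟩
      total (λ g X → ind (hyb j X) * overall (λ κ R → ind (boolEq t (out P κ R g X)))) ∎
      where
      open ≡-Reasoning
      F : Vec Bool n → Vec Bool r → Labelling → Vec Bool Q → ℕ
      F κ R g X = ind (hyb j X ∧ boolEq t (out P κ R g X))

    -- At the two extreme hybrids all cycle rows have the same parity, so every configuration is a
    -- legal input and the guarantee for single graphs can be averaged. Intermediate hybrids carry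
    -- no guarantee.
    mostly-correct : ∀ t j → (∀ p → (toℕ {M} p <ᵇ j) ≡ t) → 2 * (N * hybrids j) ≤ 3 * overall (correct t j)
    mostly-correct t j const = begin
      2 * (N * hybrids j)
        ≡⟨ *-assoc 2 N (hybrids j) ⟨
      2 * N * hybrids j
        ≡⟨ trans (sum-cong (λ g → sum-*ˡ (2 * N) _ (bvecs Q)) labellings) (sum-*ˡ (2 * N) _ labellings) ⟨
      total (λ g X → 2 * N * ind (hyb j X))
        ≤⟨ sum-mono-∈ labellings (λ g g∈ → sum-mono (λ X → each g X (labellings-inverse g g∈)) (bvecs Q)) ⟩
      total (λ g X → 3 * (ind (hyb j X) * overall (λ κ R → ind (boolEq t (out P κ R g X)))))
        ≡⟨ trans (sum-cong (λ g → sum-*ˡ 3 _ (bvecs Q)) labellings) (sum-*ˡ 3 _ labellings) ⟩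
      3 * total (λ g X → ind (hyb j X) * overall (λ κ R → ind (boolEq t (out P κ R g X))))
        ≡⟨ cong (3 *_) (overall-correct t j) ⟨
      3 * overall (correct t j) ∎
      where
      open ≤-Reasoning
      each : ∀ g X → Inverse g → 2 * N * ind (hyb j X) ≤ 3 * (ind (hyb j X) * overall (λ κ R → ind (boolEq t (out P κ R g X))))
      each (Λ , Λ⁻) X (i , i⁻) = go (hyb j X) refl
        where
        O : ℕ
        O = overall (λ κ R → ind (boolEq t (out P κ R (Λ , Λ⁻) X)))
        go : ∀ b → hyb j X ≡ b → 2 * N * ind b ≤ 3 * (ind b * O)
        go false _ = subst (_≤ 0) (sym (*-zeroʳ (2 * N))) z≤n
        go true e = subst₂ _≤_ (sym (*-identityʳ (2 * N))) (cong (3 *_) (sym (*-identityˡ O)))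
          (success-on-configuration (V.lookup Λ) (V.lookup Λ⁻) i i⁻ (V.lookup X) t (hyb-type t j X const e) P err)

    A : ℕ → Vec Bool n → Vec Bool r → ℕ
    A j κ R = accepted P κ R j

    complement : overall (A 0) + overall (correct false 0) ≡ N * T₀
    complement = trans (sym (overall-+ (A 0) (correct false 0)))
      (trans (sum-cong (λ κ → sum-cong (λ R → pointwise κ R) (allVec r)) (bvecs n)) (overall-const T₀))
      where
      split-ind : ∀ a b → ind (a ∧ b) + ind (a ∧ not b) ≡ ind a
      split-ind true true = refl
      split-ind true false = refl
      split-ind false b = refl
      pointwise : ∀ κ R → A 0 κ R + correct false 0 κ R ≡ T₀
      pointwise κ R = trans (sym (trans (sum-cong (λ g → sum-+ _ _ (bvecs Q)) labellings) (sum-+ _ _ labellings)))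
        (total-cong (λ g X → split-ind (hyb 0 X) (out P κ R g X)))

    accepted≤ : ∀ j κ R → j ≤ M → A j κ R ≤ T₀
    accepted≤ j κ R j≤M = subst (A j κ R ≤_) (hybrids≡ j j≤M)
      (sum-mono (λ g → sum-mono (λ X → drop-ind (hyb j X) (out P κ R g X)) (bvecs Q)) labellings)
      where
      drop-ind : ∀ a b → ind (a ∧ b) ≤ ind a
      drop-ind true true = ≤-refl
      drop-ind true false = z≤n
      drop-ind false b = z≤n

    module _ (ℓ s h : ℕ) (ℓ≤s : ℓ ≤ s) (θ : ℕ → ℕ)
      (θ≥1 : ∀ w → M * s ≤ w → 1 ≤ θ w) (θ≤ : ∀ w → 2 ^ ℓ * θ w ≤ w ^ ℓ)
      (small : ∀ w → M * s ≤ w →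
        length (messages c) * spread {Q} one ((suc h + suc h) * ℓ) ≤ 2 ^ Q * θ w ^ (suc h + suc h))
      (few-poor : 12 * ((M + M) * (2 ^ s * 127 ^ q)) ≤ 128 ^ q) (few-cycles : 48 * M ≤ 2 ^ ℓ) where

      Rich : Vec Bool n → Set
      Rich κ = ∀ p → s ≤ good# κ (strandBlocks p)

      -- `compare` divided by the number `w ^ ℓ` of hidden words. The 4 is the factor 2 of
      -- `hidden-parity` times the two hybrids of size `T₀`.
      step : ∀ κ R → Rich κ → ∀ p → 2 ^ ℓ * A (suc (toℕ p)) κ R ≤ 2 ^ ℓ * A (toℕ p) κ R + 4 * T₀
      step κ R rich p = *-cancelˡ-≤ (w ^ ℓ) {{>-nonZero (≤-trans (*-mono-≤ (m^n>0 2 ℓ) (θ≥1 w big)) (θ≤ w))}} (begin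
        w ^ ℓ * (2 ^ ℓ * A (suc (toℕ p)) κ R)
          ≡⟨ swap (w ^ ℓ) (2 ^ ℓ) _ ⟩
        2 ^ ℓ * (w ^ ℓ * A (suc (toℕ p)) κ R)
          ≤⟨ *-monoʳ-≤ (2 ^ ℓ) (Comparison.compare P κ R p ℓ (≤-trans ℓ≤s (rich (cyc p))) h (θ w) (θ≥1 w big) (small w big)) ⟩
        2 ^ ℓ * (w ^ ℓ * A (toℕ p) κ R + 2 * θ w * (hybrids (suc (toℕ p)) + hybrids (toℕ p)))
          ≡⟨ cong₂ (λ a b → 2 ^ ℓ * (w ^ ℓ * A (toℕ p) κ R + 2 * θ w * (a + b)))
               (hybrids≡ (suc (toℕ p)) (toℕ<n p)) (hybrids≡ (toℕ p) (<⇒≤ (toℕ<n p))) ⟩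
        2 ^ ℓ * (w ^ ℓ * A (toℕ p) κ R + 2 * θ w * (T₀ + T₀))
          ≡⟨ expand (2 ^ ℓ) (w ^ ℓ) _ (θ w) T₀ ⟩
        w ^ ℓ * (2 ^ ℓ * A (toℕ p) κ R) + (2 ^ ℓ * θ w) * (4 * T₀)
          ≤⟨ +-monoʳ-≤ (w ^ ℓ * (2 ^ ℓ * A (toℕ p) κ R)) (*-monoˡ-≤ (4 * T₀) (θ≤ w)) ⟩
        w ^ ℓ * (2 ^ ℓ * A (toℕ p) κ R) + w ^ ℓ * (4 * T₀)
          ≡⟨ *-distribˡ-+ (w ^ ℓ) _ _ ⟨
        w ^ ℓ * (2 ^ ℓ * A (toℕ p) κ R + 4 * T₀) ∎)
        where
        open ≤-Reasoning
        w = length (free κ)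
        big : M * s ≤ w
        big = free-count s κ rich
        swap : ∀ a b c → a * (b * c) ≡ b * (a * c)
        swap = solve-∀
        expand : ∀ a b c t z → a * (b * c + 2 * t * (z + z)) ≡ b * (a * c) + (a * t) * (4 * z)
        expand = solve-∀

      telescope : ∀ κ R → Rich κ → ∀ j → j ≤ M → 2 ^ ℓ * A j κ R ≤ 2 ^ ℓ * A 0 κ R + j * (4 * T₀)
      telescope κ R rich zero _ = ≤-reflexive (sym (+-identityʳ _))
      telescope κ R rich (suc j) j<M = begin
        2 ^ ℓ * A (suc j) κ R
          ≡⟨ cong (λ z → 2 ^ ℓ * A (suc z) κ R) (toℕ-fromℕ< j<M) ⟨
        2 ^ ℓ * A (suc (toℕ (fromℕ< j<M))) κ R
          ≤⟨ step κ R rich (fromℕ< j<M) ⟩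
        2 ^ ℓ * A (toℕ (fromℕ< j<M)) κ R + 4 * T₀
          ≡⟨ cong (λ z → 2 ^ ℓ * A z κ R + 4 * T₀) (toℕ-fromℕ< j<M) ⟩
        2 ^ ℓ * A j κ R + 4 * T₀
          ≤⟨ +-monoˡ-≤ (4 * T₀) (telescope κ R rich j (<⇒≤ j<M)) ⟩
        2 ^ ℓ * A 0 κ R + j * (4 * T₀) + 4 * T₀
          ≡⟨ trans (+-assoc (2 ^ ℓ * A 0 κ R) (j * (4 * T₀)) (4 * T₀)) (cong (2 ^ ℓ * A 0 κ R +_) (+-comm (j * (4 * T₀)) (4 * T₀))) ⟩
        2 ^ ℓ * A 0 κ R + suc j * (4 * T₀) ∎
        where open ≤-Reasoning

      -- On a poor colouring the hybrids cannot be compared, and the trivial bound `T₀` is charged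
      -- instead.
      pointwise : ∀ κ R → 2 ^ ℓ * A M κ R ≤ (2 ^ ℓ * A 0 κ R + M * (4 * T₀)) + 2 ^ ℓ * T₀ * poor s κ
      pointwise κ R = go (rich? s κ)
        where
        open ≤-Reasoning
        go : (d : Dec (Rich κ)) → 2 ^ ℓ * A M κ R ≤ (2 ^ ℓ * A 0 κ R + M * (4 * T₀)) + 2 ^ ℓ * T₀ * ind (not ⌊ d ⌋)
        go (yes rich) = ≤-trans (telescope κ R rich M ≤-refl) (m≤m+n _ _)
        go (no _) = begin
          2 ^ ℓ * A M κ R          ≤⟨ *-monoʳ-≤ (2 ^ ℓ) (accepted≤ M κ R ≤-refl) ⟩
          2 ^ ℓ * T₀               ≡⟨ *-identityʳ _ ⟨
          2 ^ ℓ * T₀ * 1           ≤⟨ m≤n+m _ _ ⟩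
          (2 ^ ℓ * A 0 κ R + M * (4 * T₀)) + 2 ^ ℓ * T₀ * 1 ∎

      few-poor′ : 12 * sumL (poor s) (bvecs n) ≤ 2 ^ n
      few-poor′ = *-cancelˡ-≤ (128 ^ q) {{m^n≢0 128 q}} (begin
        128 ^ q * (12 * B)                              ≡⟨ swap (128 ^ q) B ⟩
        12 * (128 ^ q * B)                              ≤⟨ *-monoʳ-≤ 12 (poor-count s) ⟩
        12 * ((M + M) * (2 ^ s * (2 ^ n * 127 ^ q)))    ≡⟨ regroup (M + M) (2 ^ s) (2 ^ n) (127 ^ q) ⟩
        12 * ((M + M) * (2 ^ s * 127 ^ q)) * 2 ^ n      ≤⟨ *-monoˡ-≤ (2 ^ n) few-poor ⟩
        128 ^ q * 2 ^ n                                 ∎)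
        where
        open ≤-Reasoning
        B = sumL (poor s) (bvecs n)
        swap : ∀ a b → a * (12 * b) ≡ 12 * (a * b)
        swap = solve-∀
        regroup : ∀ a b c d → 12 * (a * (b * (c * d))) ≡ 12 * (a * (b * d)) * c
        regroup = solve-∀

      overall-poor : 12 * overall (λ κ _ → poor s κ) ≤ N
      overall-poor = begin
        12 * overall (λ κ _ → poor s κ)
          ≡⟨ cong (12 *_) (trans (sum-cong (λ κ → trans (sum-const (poor s κ) (allVec r)) (cong (_* poor s κ) (length-allVec r))) (bvecs n))
               (sum-*ˡ (2 ^ r) (poor s) (bvecs n))) ⟩
        12 * (2 ^ r * B)       ≡⟨ swap (2 ^ r) B ⟩
        2 ^ r * (12 * B)       ≤⟨ *-monoʳ-≤ (2 ^ r) few-poor′ ⟩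
        2 ^ r * 2 ^ n          ≡⟨ *-comm (2 ^ r) (2 ^ n) ⟩
        N                      ∎
        where
        open ≤-Reasoning
        B = sumL (poor s) (bvecs n)
        swap : ∀ a b → 12 * (a * b) ≡ a * (12 * b)
        swap = solve-∀

      -- Two losses of one twelfth each: `M` steps of size `4 * T₀` over `2 ^ ℓ`, and the poor
      -- colourings.
      advantage : 12 * overall (A M) ≤ 12 * overall (A 0) + 2 * (N * T₀)
      advantage = *-cancelˡ-≤ (2 ^ ℓ) {{m^n≢0 2 ℓ}} (begin
        2 ^ ℓ * (12 * overall (A M))
          ≡⟨ swap (2 ^ ℓ) (overall (A M)) ⟩
        12 * (2 ^ ℓ * overall (A M))
          ≡⟨ cong (12 *_) (overall-* (2 ^ ℓ) (A M)) ⟨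
        12 * overall (λ κ R → 2 ^ ℓ * A M κ R)
          ≤⟨ *-monoʳ-≤ 12 (sum-mono (λ κ → sum-mono (pointwise κ) (allVec r)) (bvecs n)) ⟩
        12 * overall (λ κ R → (2 ^ ℓ * A 0 κ R + M * (4 * T₀)) + 2 ^ ℓ * T₀ * poor s κ)
          ≡⟨ cong (12 *_) (trans (overall-+ _ _) (cong₂ _+_ (trans (overall-+ _ _)
               (cong₂ _+_ (overall-* (2 ^ ℓ) (A 0)) (overall-const (M * (4 * T₀))))) (overall-* (2 ^ ℓ * T₀) (λ κ _ → poor s κ)))) ⟩
        12 * ((2 ^ ℓ * overall (A 0) + N * (M * (4 * T₀))) + 2 ^ ℓ * T₀ * Z)
          ≡⟨ expand (2 ^ ℓ) (overall (A 0)) N M T₀ Z ⟩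
        (2 ^ ℓ * (12 * overall (A 0)) + (48 * M) * (N * T₀)) + 2 ^ ℓ * T₀ * (12 * Z)
          ≤⟨ +-mono-≤ (+-monoʳ-≤ (2 ^ ℓ * (12 * overall (A 0))) (*-monoˡ-≤ (N * T₀) few-cycles)) (*-monoʳ-≤ (2 ^ ℓ * T₀) overall-poor) ⟩
        (2 ^ ℓ * (12 * overall (A 0)) + 2 ^ ℓ * (N * T₀)) + 2 ^ ℓ * T₀ * N
          ≡⟨ collect (2 ^ ℓ) (12 * overall (A 0)) N T₀ ⟩
        2 ^ ℓ * (12 * overall (A 0) + 2 * (N * T₀)) ∎)
        where
        open ≤-Reasoning
        Z = overall (λ κ _ → poor s κ)
        swap : ∀ a b → a * (12 * b) ≡ 12 * (a * b)
        swap = solve-∀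
        expand : ∀ a b n m t z → 12 * ((a * b + n * (m * (4 * t))) + a * t * z) ≡ (a * (12 * b) + (48 * m) * (n * t)) + a * t * (12 * z)
        expand = solve-∀
        collect : ∀ a b n t → (a * b + a * (n * t)) + a * t * n ≡ a * (b + 2 * (n * t))
        collect = solve-∀

      -- Error at most one third separates the acceptance rates of the extreme hybrids by at least
      -- four twelfths, while `advantage` permits two.
      contradiction : ⊥
      contradiction = <-irrefl refl (begin-strict
        6 * Y                                                ≡⟨ +-identityʳ (6 * Y) ⟨
        6 * Y + 0                                            <⟨ +-monoʳ-< (6 * Y) (*-monoʳ-< 2 Y>0) ⟩
        6 * Y + 2 * Y                                        ≡⟨ eight Y ⟩
        4 * (2 * Y)                                          ≤⟨ *-monoʳ-≤ 4 accept-high ⟩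
        4 * (3 * overall (A M))                              ≡⟨ *-assoc 4 3 (overall (A M)) ⟨
        12 * overall (A M)                                   ≤⟨ advantage ⟩
        12 * overall (A 0) + 2 * Y                           ≡⟨ cong (_+ 2 * Y) (*-assoc 4 3 (overall (A 0))) ⟩
        4 * (3 * overall (A 0)) + 2 * Y                      ≤⟨ +-monoˡ-≤ (2 * Y) (*-monoʳ-≤ 4 accept-low) ⟩
        4 * Y + 2 * Y                                        ≡⟨ *-distribʳ-+ Y 4 2 ⟨
        6 * Y                                                ∎)
        where
        open ≤-Reasoning
        Y = N * T₀
        Y>0 : 0 < Y
        Y>0 = *-mono-≤ (*-mono-≤ (m^n>0 2 n) (m^n>0 2 r)) T₀>0
        eight : ∀ y → 6 * y + 2 * y ≡ 4 * (2 * y)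
        eight = solve-∀
        accept-high : 2 * Y ≤ 3 * overall (A M)
        accept-high = subst (λ z → 2 * (N * z) ≤ 3 * overall (A M)) (hybrids≡ M ≤-refl)
          (mostly-correct true M (λ p → <ᵇ-true (toℕ<n p)))
        accept-low : 3 * overall (A 0) ≤ Y
        accept-low = +-cancelʳ-≤ (2 * Y) (3 * overall (A 0)) Y (begin
          3 * overall (A 0) + 2 * Y                          ≤⟨ +-monoʳ-≤ (3 * overall (A 0)) (mostly-correct false 0 (λ p → refl)) ⟩
          3 * overall (A 0) + 3 * overall (correct false 0)  ≡⟨ *-distribˡ-+ 3 (overall (A 0)) _ ⟨
          3 * (overall (A 0) + overall (correct false 0))    ≡⟨ cong (3 *_) complement ⟩
          3 * Y                                              ≡⟨ three Y ⟩
          Y + 2 * Y                                          ∎)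
          where
          three : ∀ y → 3 * y ≡ y + 2 * y
          three = solve-∀

-- From the parameters to the linear bound

too-short-message : ∀ M k₁ ℓ → threshold ≤ M * (4 * suc k₁) → KgeLn (suc k₁) (M * (4 * suc k₁)) →
  2 ^ ℓ ≤ M * (4 * suc k₁) → M * (4 * suc k₁) < 2 ^ suc ℓ →
  ∀ {r c} (P : Protocol (M * (4 * suc k₁)) r c) → ErrorAtMostThird (suc k₁) P → ¬ 2 * (κ₀ * κ₀) * c < M * (4 * suc k₁)
too-short-message M k₁ ℓ large ge lower upper {c = c} P err c< =
  Configurations.contradiction M k₁ q 3≤k 3q≤k 1≤q P err ℓ s h ℓ≤s θ θ≥1 θ≤ small few-poor few-cycles
  where
  positive : ∀ m {z} → 1 ≤ m * z → 1 ≤ m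
  positive (suc m) _ = s≤s z≤n
  open Parameters M (suc k₁) ℓ c (threshold-log (M * (4 * suc k₁)) ℓ large upper)
    (positive M (≤-trans 1≤threshold large)) lower upper (log-bound (suc k₁) (M * (4 * suc k₁)) ℓ ge lower) c<
  small : ∀ w → M * s ≤ w →
    length (messages c) * spread {Q} one ((suc h + suc h) * ℓ) ≤ 2 ^ Q * θ w ^ (suc h + suc h)
  small w w≥ = ≤-trans
    (*-mono-≤ (≤-trans (n≤1+n _) (≤-reflexive (length-messages c)))
      (subst (λ z → spread {Q} one z ≤ 2 ^ Q * ((j w w≥ + j w w≥) * Q) ^ j w w≥) (sym (L≡j+j w w≥)) (spread-bound (j w w≥))))
    (messages-small w w≥)

enough-bits : ∀ M k → threshold ≤ M * (4 * k) → KgeLn k (M * (4 * k)) →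
  ∀ {r c} (P : Protocol (M * (4 * k)) r c) → ErrorAtMostThird k P → M * (4 * k) ≤ 2 * (κ₀ * κ₀) * c
-- For `k = 0` there are no vertices, contrary to the positive threshold.
enough-bits M zero large _ _ _ = ⊥-elim (<⇒≱ 1≤threshold (subst (threshold ≤_) (*-zeroʳ M) large))
enough-bits M (suc k₁) large ge P err = go (binary-log (M * (4 * suc k₁)) (≤-trans 1≤threshold large))
  where
  go : (∃ λ ℓ → 2 ^ ℓ ≤ M * (4 * suc k₁) × M * (4 * suc k₁) < 2 ^ suc ℓ) → _
  go (ℓ , lower , upper) = ≮⇒≥ (too-short-message M k₁ ℓ large ge lower upper P err)

theorem3p1 : Σ ℕ λ d → Σ ℕ λ N → ∀ n k → N ≤ n → KgeLn k n → 4 * k ∣ n →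
    ∀ r c (P : Protocol n r c) → ErrorAtMostThird k P → n ≤ d * c
-- The constant is `2 ^ 31`; the quotient `M` of `n` by `4 * k` is the number of cycle pairs and
-- also of path pairs.
theorem3p1 = 2 * (κ₀ * κ₀) , threshold ,
  λ { n k large ge (divides M refl) r c P err → enough-bits M k large ge P err }
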